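{- There exist constants $C,\alpha>0$ such that the following holds for every $n\in\mathbb{N}$. If $G$ is a $d$-regular bipartite graph on $2n$ vertices with $d\geq(1-\alpha)n$, then there exists a $(C\log n/n)$-spread probability distribution on $1$-factorizations of $G$.
   Context: A $1$-factorization of a $d$-regular graph $G$ is an ordered partition $(M_1,\dots,M_d)$ of $E(G)$ into perfect matchings. A probability distribution on $1$-factorizations $(M_1,\dots,M_d)$ of a $d$-regular bipartite graph $G$ is $q$-spread if for all $S_1,\dots,S_d\subseteq E(G)$ we have $\Pr[S_i\subseteq M_i \text{ for all } i\in[d]]\leq q^{\sum_{i=1}^d|S_i|}$.
   Formalization: The claim is proved for n ≥ 2: at n = 1, log n = 0 makes it false for a single edge, and at n = 0 log n/n is undefined; log n is written as the ceiling of log₂ n, which only changes the constant C, and C, α and the probabilities are taken rational, which says more. -}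

module Defs where

open import Data.Bool using (Bool; true; false; _∧_; if_then_else_)
open import Data.Nat using (ℕ; zero; suc)
open import Data.Nat.Logarithm using (⌈log₂_⌉)
open import Data.Fin using (Fin)
open import Data.List using (List; []; _∷_; map; foldr; allFin; cartesianProduct)
open import Data.Nat.ListAction using (sum)
open import Data.List.Relation.Unary.All using (All)
open import Data.Product using (Σ; ∃; _×_; _,_; proj₁; proj₂)
open import Data.Integer using (+_)
open import Data.Rational as ℚ using (ℚ; 0ℚ; 1ℚ; _/_)
open import Relation.Binary.PropositionalEquality using (_≡_)

-- A bipartite graph with both sides of size n (2n vertices in total),
-- given by its (decidable) bipartite adjacency relation:
-- left vertex u ∈ Fin n is adjacent to right vertex v ∈ Fin n iff E u v ≡ true.
BipGraph : ℕ → Set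
BipGraph n = Fin n → Fin n → Bool

EdgeSet : ℕ → Set
EdgeSet n = Fin n → Fin n → Bool

_⊆ₑ_ : ∀ {n} → EdgeSet n → EdgeSet n → Set
S ⊆ₑ T = ∀ u v → S u v ≡ true → T u v ≡ true

pairs : ∀ n → List (Fin n × Fin n)
pairs n = cartesianProduct (allFin n) (allFin n)

∣_∣ₑ : ∀ {n} → EdgeSet n → ℕ
∣_∣ₑ {n} S = sum (map (λ p → if S (proj₁ p) (proj₂ p) then 1 else 0) (pairs n))

subset? : ∀ {n} → EdgeSet n → EdgeSet n → Bool
subset? {n} S M = foldr (λ p b → (if S (proj₁ p) (proj₂ p) then M (proj₁ p) (proj₂ p) else true) ∧ b) true (pairs n)

count : ∀ {n} → (Fin n → Bool) → ℕ
count {n} f = sum (map (λ i → if f i then 1 else 0) (allFin n))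

Regular : ∀ {n} → ℕ → BipGraph n → Set
Regular d G = (∀ u → count (λ v → G u v) ≡ d) × (∀ v → count (λ u → G u v) ≡ d)

PerfectMatching : ∀ {n} → EdgeSet n → Set
PerfectMatching M =
  (∀ u → ∃ λ v → M u v ≡ true × (∀ w → M u w ≡ true → w ≡ v)) ×
  (∀ v → ∃ λ u → M u v ≡ true × (∀ w → M w v ≡ true → w ≡ u))

Tuple : ℕ → ℕ → Set
Tuple n d = Fin d → EdgeSet n

OneFactorization : ∀ {n d} → BipGraph n → Tuple n d → Set
OneFactorization G M =
  (∀ i → PerfectMatching (M i)) ×
  (∀ i → M i ⊆ₑ G) ×
  (∀ u v → G u v ≡ true → ∃ λ i → M i u v ≡ true × (∀ j → M j u v ≡ true → j ≡ i))

-- A finitely supported probability distribution on 1-factorizations of G: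
-- a list of (weight, factorization) pairs, weights nonnegative rationals
-- summing to 1.
Distribution : ∀ {n d} → BipGraph n → Set
Distribution {n} {d} G = List (ℚ × Tuple n d)

sumℚ : List ℚ → ℚ
sumℚ = foldr ℚ._+_ 0ℚ

IsDistributionOn1F : ∀ {n d} (G : BipGraph n) → Distribution {n} {d} G → Set
IsDistributionOn1F G μ =
  All (λ p → (0ℚ ℚ.≤ proj₁ p) × OneFactorization G (proj₂ p)) μ ×
  sumℚ (map proj₁ μ) ≡ 1ℚ

allSubset? : ∀ {n d} → Tuple n d → Tuple n d → Bool
allSubset? {n} {d} S M = foldr (λ i b → subset? (S i) (M i) ∧ b) true (allFin d)

Pr : ∀ {n d} {G : BipGraph n} → Distribution {n} {d} G → Tuple n d → ℚ
Pr μ S = sumℚ (map (λ p → if allSubset? S (proj₂ p) then proj₁ p else 0ℚ) μ)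

_^ℚ_ : ℚ → ℕ → ℚ
q ^ℚ zero = 1ℚ
q ^ℚ suc k = q ℚ.* (q ^ℚ k)

totalSize : ∀ {n d} → Tuple n d → ℕ
totalSize {n} {d} S = sum (map (λ i → ∣ S i ∣ₑ) (allFin d))

Spread : ∀ {n d} {G : BipGraph n} → ℚ → Distribution {n} {d} G → Set
Spread {n} {d} {G} q μ =
  (S : Tuple n d) → (∀ i → S i ⊆ₑ G) → Pr {G = G} μ S ℚ.≤ q ^ℚ totalSize S

ℕ→ℚ : ℕ → ℚ
ℕ→ℚ k = + k / 1

-- The spread parameter C · log n / n, with log n rendered as ⌈log₂ n⌉
-- (only used for n ≥ 2; the value at n = 0 is irrelevant).
spreadParam : ℚ → ℕ → ℚ
spreadParam C zero = 0ℚ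
spreadParam C (suc m) = C ℚ.* (+ ⌈log₂ (suc m) ⌉ / suc m)

{-# OPTIONS --safe #-}

-- Split G recursively into two regular graphs of (almost) half the degree until the degrees
-- are O(log n), and 1-factorize the leaves arbitrarily: then S_i ⊆ M_i for all i only if every
-- edge of S_i lies in the leaf containing colour i.  In one step each edge is, independently,
-- forced to either side with probability (1 - 1/r) / 2 and left free otherwise.  A Chernoff
-- bound for every vertex cut shows that with high probability the free edges can be distributed
-- so that both sides become regular (an orientation with prescribed out-degrees) and that both
-- sides keep half of every cut up to a factor 1 - O(1/r).  A step thus costs a factor
-- (1 + O(1/r)) / 2 per edge, and taking r quadratic in the height j above the leaves, both
-- the products of these factors and the loss of expansion telescope.
module Submission where

open import Defs
open import Data.Bool using (Bool; true; false; _∧_; _∨_; not; if_then_else_)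
import Data.Bool as B
open import Data.Empty using (⊥; ⊥-elim)
open import Data.Fin using (Fin; zero; suc; _↑ˡ_; _↑ʳ_; splitAt)
import Data.Fin as F
open import Data.Fin.Properties using (any?; splitAt-↑ˡ; splitAt-↑ʳ; splitAt⁻¹-↑ˡ; splitAt⁻¹-↑ʳ; ↑ˡ-injective; ↑ʳ-injective)
import Data.Integer as ℤ
import Data.Integer.Properties as ℤ
open import Data.List using (List; []; _∷_; _++_; allFin; cartesianProduct; concatMap; foldr; map; replicate; tabulate)
open import Data.List.Membership.Propositional using (_∈_)
open import Data.List.Membership.Propositional.Properties using (∈-allFin; ∈-cartesianProduct⁺)
open import Data.List.Properties using (map-++; map-∘; map-cong; map-tabulate)
open import Data.List.Relation.Unary.All using (All; []; _∷_)
open import Data.List.Relation.Unary.All.Properties using (++⁺)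
open import Data.List.Relation.Unary.Any using (here; there)
open import Data.Maybe using (Maybe; just; nothing)
open import Data.Nat
open import Data.Nat.DivMod using (m*n/n≡m; /-monoˡ-≤; m/n*n≤m; m≡m%n+[m/n]*n; m%n<n)
open import Data.Nat.Induction using (<-rec)
open import Data.Nat.ListAction using (sum)
open import Data.Nat.ListAction.Properties using (sum-++)
open import Data.Nat.Logarithm using (⌈log₂_⌉; ⌈log₂⌉-mono-≤; ⌈log₂⌈n/2⌉⌉≡⌈log₂n⌉∸1)
open import Data.Nat.Properties
open import Data.Nat.Tactic.RingSolver using (solve-∀)
open import Data.Product using (Σ; ∃; _×_; _,_; proj₁; proj₂)
open import Data.Rational using (ℚ; 0ℚ; 1ℚ)
import Data.Rational as ℚ
import Data.Rational.Properties as ℚ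
open import Data.Rational.Solver using () renaming (module +-*-Solver to ℚSolver)
import Data.Rational.Unnormalised as ℚᵘ
import Data.Rational.Unnormalised.Properties as ℚᵘ
open import Data.Sum using (_⊎_; inj₁; inj₂; [_,_]′)
open import Data.Unit using (⊤; tt)
import Data.Vec.Functional as V
open import Function using (_∘_)
open import Relation.Binary.PropositionalEquality
open import Relation.Nullary
open import Relation.Nullary.Decidable using (_×-dec_; ¬?; dec-false; decidable-stable)
import Algebra.Properties.CommutativeMonoid.Sum *-1-commutativeMonoid as Product
import Algebra.Properties.Semiring.Sum +-*-semiring as Sum

-- Regularity is a global constraint, so the sides that edges end up on are not independent. The
-- spread bound only needs that forced labels are obeyed: if all of `S` lands on one side, no edge
-- of `S` was forced to the other, and this larger event is a product event. The logarithm comes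
-- from the union bound. At most `2 (2n)^m` vertex sets have `margin` equal to `m`, so each of their
-- cuts may fail with probability about `Z^(-m)`, with `Z` polynomial in `n`. For bias `1/r` the
-- Chernoff exponent is of order `cutSize / r²`, so such a cut needs about `r² m log n` edges.
-- Halving therefore stops once the expansion has fallen to order `log n`, and by then the spread
-- bound is of order `log n / n`. Probabilities are counts of labelings and inequalities are cleared
-- of denominators, hence the many products of powers; rationals appear only when distributions are
-- composed.

private variable
  X Y : Set

-- Finite sums and products of naturals

ind : Bool → ℕ
ind b = if b then 1 else 0

-- Abstract, so that unification treats ∑ and ∏ as injective.
abstract
  ∑ : ∀ {n} → (Fin n → ℕ) → ℕ
  ∑ = Sum.sum

  ∑-nil : (f : Fin 0 → ℕ) → ∑ f ≡ 0
  ∑-nil f = refl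

  ∑-suc : ∀ {n} (f : Fin (suc n) → ℕ) → ∑ f ≡ f zero + ∑ (f ∘ suc)
  ∑-suc f = refl

  ∑-cong : ∀ {n} {f g : Fin n → ℕ} → (∀ i → f i ≡ g i) → ∑ f ≡ ∑ g
  ∑-cong = Sum.sum-cong-≗

  ∑-+ : ∀ {n} (f g : Fin n → ℕ) → ∑ (λ i → f i + g i) ≡ ∑ f + ∑ g
  ∑-+ = Sum.∑-distrib-+

  ∑-comm : ∀ {m n} (f : Fin m → Fin n → ℕ) → ∑ (λ i → ∑ (f i)) ≡ ∑ (λ j → ∑ (λ i → f i j))
  ∑-comm = Sum.∑-comm

  *-∑ : ∀ {n} x (f : Fin n → ℕ) → x * ∑ f ≡ ∑ (λ i → x * f i)
  *-∑ = Sum.*-distribˡ-sum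

  ∑-mono : ∀ {n} {f g : Fin n → ℕ} → (∀ i → f i ≤ g i) → ∑ f ≤ ∑ g
  ∑-mono {zero}  h = z≤n
  ∑-mono {suc n} h = +-mono-≤ (h zero) (∑-mono (h ∘ suc))

  ∑-mono-< : ∀ {n} {f g : Fin n → ℕ} → (∀ i → f i ≤ g i) → ∀ i → f i < g i → ∑ f < ∑ g
  ∑-mono-< h zero    p = +-mono-<-≤ p (∑-mono (h ∘ suc))
  ∑-mono-< h (suc i) p = +-mono-≤-< (h zero) (∑-mono-< (h ∘ suc) i p)

  ∑-zero : ∀ {n} {f : Fin n → ℕ} → (∀ i → f i ≡ 0) → ∑ f ≡ 0
  ∑-zero {zero}  h = refl
  ∑-zero {suc n} h = cong₂ _+_ (h zero) (∑-zero (h ∘ suc))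

  term≤∑ : ∀ {n} (f : Fin n → ℕ) i → f i ≤ ∑ f
  term≤∑ f zero    = m≤m+n _ _
  term≤∑ f (suc i) = ≤-trans (term≤∑ (f ∘ suc) i) (m≤n+m _ (f zero))

  ∑-split : ∀ m {n} (f : Fin (m + n) → ℕ) → ∑ f ≡ ∑ (λ i → f (i ↑ˡ n)) + ∑ (λ j → f (m ↑ʳ j))
  ∑-split zero    f = refl
  ∑-split (suc m) f = trans (cong (f zero +_) (∑-split m (f ∘ suc))) (sym (+-assoc (f zero) _ _))

  ∑-update : ∀ {n} (f g : Fin n → ℕ) i → (∀ j → j ≢ i → f j ≡ g j) → ∑ f + g i ≡ ∑ g + f i
  ∑-update f g zero h = begin
    f zero + ∑ (f ∘ suc) + g zero ≡⟨ cong (λ x → f zero + x + g zero) (∑-cong (λ j → h (suc j) (λ ()))) ⟩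
    f zero + ∑ (g ∘ suc) + g zero ≡⟨ swap (f zero) _ (g zero) ⟩
    g zero + ∑ (g ∘ suc) + f zero ∎
    where
    open ≡-Reasoning
    swap : ∀ x y z → x + y + z ≡ z + y + x
    swap = solve-∀
  ∑-update f g (suc i) h = begin
    f zero + ∑ (f ∘ suc) + g (suc i)   ≡⟨ +-assoc (f zero) _ _ ⟩
    f zero + (∑ (f ∘ suc) + g (suc i)) ≡⟨ cong₂ _+_ (h zero (λ ())) (∑-update (f ∘ suc) (g ∘ suc) i (λ j ne → h (suc j) (λ { refl → ne refl }))) ⟩
    g zero + (∑ (g ∘ suc) + f (suc i)) ≡⟨ +-assoc (g zero) _ _ ⟨
    g zero + ∑ (g ∘ suc) + f (suc i) ∎
    where open ≡-Reasoning

  ∏ : ∀ {n} → (Fin n → ℕ) → ℕ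
  ∏ = Product.sum

  ∏-nil : (f : Fin 0 → ℕ) → ∏ f ≡ 1
  ∏-nil f = refl

  ∏-suc : ∀ {n} (f : Fin (suc n) → ℕ) → ∏ f ≡ f zero * ∏ (f ∘ suc)
  ∏-suc f = refl

  ∏-cong : ∀ {n} {f g : Fin n → ℕ} → (∀ i → f i ≡ g i) → ∏ f ≡ ∏ g
  ∏-cong = Product.sum-cong-≗

  ∏-* : ∀ {n} (f g : Fin n → ℕ) → ∏ (λ i → f i * g i) ≡ ∏ f * ∏ g
  ∏-* = Product.∑-distrib-+

  ∏-mono : ∀ {n} {f g : Fin n → ℕ} → (∀ i → f i ≤ g i) → ∏ f ≤ ∏ g
  ∏-mono {zero}  h = ≤-refl
  ∏-mono {suc n} h = *-mono-≤ (h zero) (∏-mono (h ∘ suc))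

  ∏-^ : ∀ {n} x (f : Fin n → ℕ) → ∏ (λ i → x ^ f i) ≡ x ^ ∑ f
  ∏-^ {zero}  x f = refl
  ∏-^ {suc n} x f = trans (cong (x ^ f zero *_) (∏-^ x (f ∘ suc))) (sym (^-distribˡ-+-* x (f zero) _))

∑-≤-≡ : ∀ {n} {f g : Fin n → ℕ} → (∀ i → f i ≤ g i) → ∑ g ≤ ∑ f → ∀ i → f i ≡ g i
∑-≤-≡ h e i with m≤n⇒m<n∨m≡n (h i)
... | inj₁ p = ⊥-elim (<⇒≱ (∑-mono-< h i p) e)
... | inj₂ p = p

-- Orientations with prescribed out-degrees

Orient : ℕ → Set
Orient m = Fin m → Fin m → Bool

out : ∀ {m} → Orient m → Fin m → ℕ
out c w = ∑ (λ q → ind (c w q))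

-- Reverses the arc z → w.
push : ∀ {m} → Orient m → Fin m → Fin m → Orient m
push c z w p q with p F.≟ z | q F.≟ w
... | yes _ | yes _ = false
... | yes _ | no _ = c p q
... | no _ | _ with p F.≟ w | q F.≟ z
... | yes _ | yes _ = true
... | yes _ | no _  = c p q
... | no _ | _ = c p q

push-zw : ∀ {m} (c : Orient m) z w → push c z w z w ≡ false
push-zw c z w with z F.≟ z | w F.≟ w
... | yes _ | yes _ = refl
... | no n  | _     = ⊥-elim (n refl)
... | yes _ | no n  = ⊥-elim (n refl)

push-wz : ∀ {m} (c : Orient m) z w → z ≢ w → push c z w w z ≡ true
push-wz c z w ne with w F.≟ z | z F.≟ w
... | yes p | _ = ⊥-elim (ne (sym p))
... | no _  | yes p = ⊥-elim (ne p)
... | no _  | no _ with w F.≟ w | z F.≟ z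
... | yes _ | yes _ = refl
... | no n  | _     = ⊥-elim (n refl)
... | yes _ | no n  = ⊥-elim (n refl)

push-off : ∀ {m} (c : Orient m) z w p q → (p ≡ z → q ≢ w) → (p ≡ w → q ≢ z) → push c z w p q ≡ c p q
push-off c z w p q h₁ h₂ with p F.≟ z | q F.≟ w
... | yes a | yes b = ⊥-elim (h₁ a b)
... | yes _ | no _ = refl
... | no _ | _ with p F.≟ w | q F.≟ z
... | yes a | yes b = ⊥-elim (h₂ a b)
... | yes _ | no _  = refl
... | no _ | _ = refl

out-push-tail : ∀ {m} (c : Orient m) z w → z ≢ w → c z w ≡ true → suc (out (push c z w) z) ≡ out c z
out-push-tail c z w ne e = begin
  suc (out (push c z w) z)                        ≡⟨ +-comm 1 _ ⟩
  out (push c z w) z + 1                          ≡⟨ cong (λ b → out (push c z w) z + ind b) e ⟨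
  out (push c z w) z + ind (c z w)                ≡⟨ ∑-update _ _ w (λ j j≢w → cong ind (push-off c z w z j (λ _ → j≢w) (λ p → ⊥-elim (ne p)))) ⟩
  out c z + ind (push c z w z w)                  ≡⟨ cong (λ b → out c z + ind b) (push-zw c z w) ⟩
  out c z + 0                                     ≡⟨ +-identityʳ _ ⟩
  out c z ∎
  where open ≡-Reasoning

out-push-head : ∀ {m} (c : Orient m) z w → z ≢ w → c w z ≡ false → out (push c z w) w ≡ suc (out c w)
out-push-head c z w ne e = begin
  out (push c z w) w                              ≡⟨ +-identityʳ _ ⟨
  out (push c z w) w + 0                          ≡⟨ cong (λ b → out (push c z w) w + ind b) e ⟨
  out (push c z w) w + ind (c w z)                ≡⟨ ∑-update _ _ z (λ j j≢z → cong ind (push-off c z w w j (λ p → ⊥-elim (ne (sym p))) (λ _ → j≢z))) ⟩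
  out c w + ind (push c z w w z)                  ≡⟨ cong (λ b → out c w + ind b) (push-wz c z w ne) ⟩
  out c w + 1                                     ≡⟨ +-comm _ 1 ⟩
  suc (out c w) ∎
  where open ≡-Reasoning

out-push-off : ∀ {m} (c : Orient m) z w p → p ≢ z → p ≢ w → out (push c z w) p ≡ out c p
out-push-off c z w p h₁ h₂ = ∑-cong (λ j → cong ind (push-off c z w p j (λ x → ⊥-elim (h₁ x)) (λ x → ⊥-elim (h₂ x))))

-- Comparing the total over both directions of a pair says that the underlying graph is unchanged.
Reorients : ∀ {m} → Orient m → Orient m → Set
Reorients c₀ c = ∀ p q → ind (c p q) + ind (c q p) ≡ ind (c₀ p q) + ind (c₀ q p)

Antisym : ∀ {m} → Orient m → Set
Antisym c = ∀ p q → c p q ≡ true → c q p ≡ false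

antisym-≢ : ∀ {m} {c : Orient m} → Antisym c → ∀ {z w} → c z w ≡ true → z ≢ w
antisym-≢ as {z} e refl with trans (sym e) (as z z e)
... | ()

ind-antisym : ∀ {a b} → ind a + ind b ≤ 1 → a ≡ true → b ≡ false
ind-antisym {true} {false} _ refl = refl
ind-antisym {true} {true} (s≤s ()) refl

antisym-ind : ∀ {m} {c : Orient m} → Antisym c → ∀ p q → ind (c p q) + ind (c q p) ≤ 1
antisym-ind {c = c} as p q with c p q in e
... | true rewrite as p q e = ≤-refl
... | false with c q p
... | true  = ≤-refl
... | false = z≤n

reorients-antisym : ∀ {m} {c₀ c : Orient m} → Antisym c₀ → Reorients c₀ c → Antisym c
reorients-antisym as r p q = ind-antisym (subst (_≤ 1) (sym (r p q)) (antisym-ind as p q))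

reorients-push : ∀ {m} {c₀ c : Orient m} z w → z ≢ w → c z w ≡ true → c w z ≡ false →
  Reorients c₀ c → Reorients c₀ (push c z w)
reorients-push {c = c} z w ne e₁ e₂ r p q with p F.≟ z ×-dec q F.≟ w
... | yes (refl , refl) = begin
  ind (push c z w z w) + ind (push c z w w z) ≡⟨ cong₂ (λ a b → ind a + ind b) (push-zw c z w) (push-wz c z w ne) ⟩
  1                                           ≡⟨ cong₂ (λ a b → ind a + ind b) e₁ e₂ ⟨
  ind (c z w) + ind (c w z)                   ≡⟨ r z w ⟩
  _ ∎
  where open ≡-Reasoning
... | no n₁ with p F.≟ w ×-dec q F.≟ z
... | yes (refl , refl) = begin
  ind (push c z w w z) + ind (push c z w z w) ≡⟨ cong₂ (λ a b → ind a + ind b) (push-wz c z w ne) (push-zw c z w) ⟩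
  1                                           ≡⟨ cong₂ (λ a b → ind a + ind b) e₂ e₁ ⟨
  ind (c w z) + ind (c z w)                   ≡⟨ r w z ⟩
  _ ∎
  where open ≡-Reasoning
... | no n₂ = trans
  (cong₂ (λ a b → ind a + ind b)
    (push-off c z w p q (λ a b → n₁ (a , b)) (λ a b → n₂ (a , b)))
    (push-off c z w q p (λ a b → n₂ (b , a)) (λ a b → n₁ (b , a))))
  (r p q)

-- Sufficiency in Hakimi's theorem on orientations with prescribed out-degrees. The target at `w` is
-- `b w - a w`, kept as two functions to avoid truncated subtraction.
module Balance {m : ℕ} (c₀ : Orient m) (as₀ : Antisym c₀) (a b : Fin m → ℕ) where

  excess : Orient m → Fin m → ℕ
  excess c w = (out c w + a w) ∸ b w

  Φ : Orient m → ℕ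
  Φ c = ∑ (excess c)

  Token Hole : Orient m → Fin m → Set
  Token c w = b w < out c w + a w
  Hole  c w = out c w + a w < b w

  -- Vertices reached from `z₀`, with the order of discovery kept: removing the vertex found last
  -- leaves a tree again, which drives the recursion of `improve`.
  data Tree (z₀ : Fin m) (c : Orient m) : ℕ → (Fin m → Bool) → Set where
    root : Tree z₀ c 0 (λ x → does (x F.≟ z₀))
    grow : ∀ {k Z} → Tree z₀ c k Z → ∀ z w → Z z ≡ true → Z w ≡ false → c z w ≡ true →
           Tree z₀ c (suc k) (λ x → Z x ∨ does (x F.≟ w))

  root∈ : ∀ {z₀ c k Z} → Tree z₀ c k Z → Z z₀ ≡ true
  root∈ {z₀} root with z₀ F.≟ z₀
  ... | yes _ = refl
  ... | no n = ⊥-elim (n refl)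
  root∈ {z₀} (grow T z w _ _ _) rewrite root∈ T = refl

  -- All arcs of the tree lie inside `Z`, so a reversal at a vertex outside `Z` does not harm it.
  tree-map : ∀ {z₀ c c′ k Z} → (∀ p q → Z p ≡ true → Z q ≡ true → c p q ≡ c′ p q) →
             Tree z₀ c k Z → Tree z₀ c′ k Z
  tree-map h root = root
  tree-map {Z = Z′} h (grow {Z = Z} T z w z∈ w∉ arc) =
    grow (tree-map (λ p q x y → h p q (incl p x) (incl q y)) T) z w z∈ w∉
         (trans (sym (h z w (incl z z∈) w∈)) arc)
    where
    incl : ∀ p → Z p ≡ true → Z p ∨ does (p F.≟ w) ≡ true
    incl p e rewrite e = refl
    w∈ : Z w ∨ does (w F.≟ w) ≡ true
    w∈ with w F.≟ w
    ... | yes _ rewrite w∉ = refl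
    ... | no n = ⊥-elim (n refl)

  module _ (c : Orient m) (as : Antisym c) {z w} (arc : c z w ≡ true) (hole : Hole c w) where
    private
      z≢w : z ≢ w
      z≢w = antisym-≢ as arc

      outw : out (push c z w) w ≡ suc (out c w)
      outw = out-push-head c z w z≢w (as z w arc)

      outz : suc (out (push c z w) z) ≡ out c z
      outz = out-push-tail c z w z≢w arc

    -- At `w` the excess stays zero, since a hole has room for one more out-arc; at `z` an out-arc
    -- is lost.
    excess-push : ∀ p → excess (push c z w) p ≤ excess c p
    excess-push p = go (p F.≟ z) (p F.≟ w)
      where
      go : Dec (p ≡ z) → Dec (p ≡ w) → excess (push c z w) p ≤ excess c p
      go (yes refl) _ = ∸-monoˡ-≤ (b p) (+-monoˡ-≤ (a p) (≤-trans (n≤1+n _) (≤-reflexive outz)))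
      go (no _) (yes refl) rewrite outw | m≤n⇒m∸n≡0 hole = z≤n
      go (no p≢z) (no p≢w) = ≤-reflexive (cong (λ x → x + a p ∸ b p) (out-push-off c z w p p≢z p≢w))

    Φ-push : Φ (push c z w) ≤ Φ c
    Φ-push = ∑-mono excess-push

    Φ-push-token : Token c z → Φ (push c z w) < Φ c
    Φ-push-token t = ∑-mono-< excess-push z
      (∸-monoˡ-< (+-monoˡ-< (a z) (≤-reflexive outz)) (s≤s⁻¹ (≤-trans t (≤-reflexive (cong (_+ a z) (sym outz))))))

    hole-push : ¬ Token c z → Hole (push c z w) z
    hole-push nt = ≤-trans (≤-reflexive (cong (_+ a z) outz)) (≮⇒≥ nt)

    root-push : ∀ {z₀} → z₀ ≢ z → z₀ ≢ w → Token c z₀ → Token (push c z w) z₀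
    root-push {z₀} n₁ n₂ = subst (λ x → b z₀ < x + a z₀) (sym (out-push-off c z w z₀ n₁ n₂))

  Better : Orient m → Set
  Better c = ∃ λ c′ → Reorients c₀ c′ × Φ c′ < Φ c

  -- The hole travels up the tree towards the root, which is a token.
  improve : ∀ k {z₀ c Z} → Reorients c₀ c → Tree z₀ c k Z → Token c z₀ →
            ∀ w → Z w ≡ true → Hole c w → Better c
  improve _ {z₀} r root t w w∈ h with w F.≟ z₀
  ... | yes refl = ⊥-elim (<-asym t h)
  improve (suc k) {z₀} {c} r (grow {Z = Z} T z w′ z∈ w′∉ arc) t w w∈ h with w F.≟ w′
  ... | no _ = improve k r T t w (trans (sym (B-identity (Z w))) w∈) h
    where
    B-identity : ∀ x → x ∨ false ≡ x
    B-identity true  = refl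
    B-identity false = refl
  ... | yes refl with b z <? out c z + a z
  ... | yes tz = push c z w , reorients-push {c₀ = c₀} z w (antisym-≢ as arc) arc (as z w arc) r , Φ-push-token c as arc h tz
    where as = reorients-antisym {c₀ = c₀} as₀ r
  ... | no ntz =
    let (c′ , r′ , lt) = improve k (reorients-push {c₀ = c₀} z w (antisym-≢ as arc) arc (as z w arc) r)
                           (tree-map same T) (root-push c as arc h z₀≢z (λ e → ∉⇒≢ (root∈ T) e) t) z z∈
                           (hole-push c as arc h ntz)
    in c′ , r′ , <-≤-trans lt (Φ-push c as arc h)
    where
    as = reorients-antisym {c₀ = c₀} as₀ r
    ∉⇒≢ : ∀ {p} → Z p ≡ true → p ≢ w
    ∉⇒≢ e refl with trans (sym e) w′∉
    ... | ()
    z₀≢z : z₀ ≢ z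
    z₀≢z refl = ntz t
    same : ∀ p q → Z p ≡ true → Z q ≡ true → c p q ≡ push c z w p q
    same p q p∈ q∈ = sym (push-off c z w p q (λ _ → ∉⇒≢ q∈) (λ e → ⊥-elim (∉⇒≢ p∈ e)))

  Closed : Orient m → (Fin m → Bool) → Set
  Closed c Z = ∀ z w → Z z ≡ true → Z w ≡ false → c z w ≡ false

  -- The fuel bounds the number of unreached vertices, one of which is absorbed in each round.
  search : ∀ f {z₀ c k Z} → Tree z₀ c k Z → ∑ (λ w → ind (not (Z w))) < f →
    (∃ λ k → ∃ λ Z → Tree z₀ c k Z × ∃ λ w → Z w ≡ true × Hole c w) ⊎
    (∃ λ Z → Z z₀ ≡ true × Closed c Z × (∀ w → Z w ≡ true → ¬ Hole c w))
  search (suc f) {z₀} {c} {k} {Z} T (s≤s lt) with any? (λ w → Z w B.≟ true ×-dec (out c w + a w <? b w))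
  ... | yes (w , w∈ , h) = inj₁ (k , Z , T , w , w∈ , h)
  ... | no nh with any? (λ z → any? (λ w → Z z B.≟ true ×-dec (Z w B.≟ false ×-dec c z w B.≟ true)))
  ... | yes (z , w , z∈ , w∉ , arc) = search f (grow T z w z∈ w∉ arc) (<-≤-trans (∑-mono-< le w strict) lt)
    where
    le : ∀ x → ind (not (Z x ∨ does (x F.≟ w))) ≤ ind (not (Z x))
    le x with Z x | x F.≟ w
    ... | true | _ = z≤n
    ... | false | yes _ = z≤n
    ... | false | no _ = ≤-refl
    strict : ind (not (Z w ∨ does (w F.≟ w))) < ind (not (Z w))
    strict rewrite w∉ with w F.≟ w
    ... | yes _ = ≤-refl
    ... | no n = ⊥-elim (n refl)
  ... | no nc = inj₂ (Z , root∈ T , closed , λ w w∈ h → nh (w , w∈ , h))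
    where
    closed : Closed c Z
    closed z w z∈ w∉ with c z w in e
    ... | false = refl
    ... | true = ⊥-elim (nc (z , w , z∈ , w∉ , e))

  -- Ordered pairs are summed, so every edge inside `Z` counts twice; this is the source of the
  -- factors 2 in `Feasible`.
  inside : (Fin m → Bool) → ℕ
  inside Z = ∑ (λ z → ∑ (λ w → ind (Z z) * (ind (Z w) * (ind (c₀ z w) + ind (c₀ w z)))))

  weight : (Fin m → Bool) → (Fin m → ℕ) → ℕ
  weight Z f = ∑ (λ z → ind (Z z) * f z)

  -- With no arc leaving `Z`, the out-degrees over `Z` count each inner edge exactly once.
  inside-closed : ∀ {c Z} → Reorients c₀ c → Closed c Z → inside Z ≡ 2 * weight Z (out c)
  inside-closed {c} {Z} r cl = begin
    inside Z
      ≡⟨ ∑-cong (λ z → ∑-cong (λ w → cong (λ x → ind (Z z) * (ind (Z w) * x)) (sym (r z w)))) ⟩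
    ∑ (λ z → ∑ (λ w → ind (Z z) * (ind (Z w) * (ind (c z w) + ind (c w z)))))
      ≡⟨ ∑-cong (λ z → trans (∑-cong (λ w → dist (ind (Z z)) (ind (Z w)) (ind (c z w)) _)) (∑-+ _ _)) ⟩
    ∑ (λ z → ∑ (λ w → g z w) + ∑ (λ w → g w z))
      ≡⟨ ∑-+ _ _ ⟩
    ∑ (λ z → ∑ (λ w → g z w)) + ∑ (λ z → ∑ (λ w → g w z))
      ≡⟨ cong₂ _+_ refl (∑-comm (λ z w → g w z)) ⟩
    ∑ (λ z → ∑ (λ w → g z w)) + ∑ (λ z → ∑ (λ w → g z w))
      ≡⟨ cong (λ x → x + x) (∑-cong (λ z → trans (∑-cong (drop z)) (sym (*-∑ (ind (Z z)) _)))) ⟩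
    weight Z (out c) + weight Z (out c)
      ≡⟨ cong (weight Z (out c) +_) (sym (+-identityʳ _)) ⟩
    2 * weight Z (out c) ∎
    where
    open ≡-Reasoning
    g : Fin m → Fin m → ℕ
    g z w = ind (Z z) * (ind (Z w) * ind (c z w))
    dist : ∀ x y u v → x * (y * (u + v)) ≡ x * (y * u) + y * (x * v)
    dist = solve-∀
    drop : ∀ z w → g z w ≡ ind (Z z) * ind (c z w)
    drop z w with Z z in ez | Z w in ew
    ... | false | _ = refl
    ... | true | true = cong (_+ 0) (+-identityʳ _)
    ... | true | false rewrite cl z w ez ew = refl

  weight-+ : ∀ Z f g → weight Z (λ z → f z + g z) ≡ weight Z f + weight Z g
  weight-+ Z f g = trans (∑-cong (λ z → *-distribˡ-+ (ind (Z z)) (f z) (g z))) (∑-+ _ _)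

  Feasible : Set
  Feasible = (∀ Z → inside Z + 2 * weight Z a ≤ 2 * weight Z b) ×
             2 * ∑ b ≤ inside (λ _ → true) + 2 * ∑ a

  Balanced : Orient m → Set
  Balanced c = Reorients c₀ c × (∀ w → out c w + a w ≡ b w)

  module _ (feas : Feasible) where

    -- A surplus at `z₀` and no deficit elsewhere would make the edges inside `Z` exceed its demand,
    -- against Hakimi's condition.
    no-deficient-closed : ∀ {c Z z₀} → Reorients c₀ c → Z z₀ ≡ true → Closed c Z → Token c z₀ →
                    ¬ (∀ w → Z w ≡ true → ¬ Hole c w)
    no-deficient-closed {c} {Z} {z₀} r z₀∈ cl t nh = <⇒≱ lt (≤-trans (≤-reflexive eq) (proj₁ feas Z))
      where
      le : ∀ w → ind (Z w) * b w ≤ ind (Z w) * (out c w + a w)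
      le w with Z w in e
      ... | true = *-monoʳ-≤ 1 (≮⇒≥ (nh w e))
      ... | false = z≤n
      lt₀ : ind (Z z₀) * b z₀ < ind (Z z₀) * (out c z₀ + a z₀)
      lt₀ rewrite z₀∈ = *-monoʳ-< 1 t
      lt : 2 * weight Z b < 2 * weight Z (λ w → out c w + a w)
      lt = *-monoʳ-< 2 (∑-mono-< le z₀ lt₀)
      eq : 2 * weight Z (λ w → out c w + a w) ≡ inside Z + 2 * weight Z a
      eq = trans (cong (2 *_) (weight-+ Z (out c) a)) (trans (*-distribˡ-+ 2 (weight Z (out c)) _) (cong (_+ 2 * weight Z a) (sym (inside-closed r cl))))

    -- Every round lowers `Φ`. Once no vertex has a surplus, the comparison of totals excludes
    -- deficits as well.
    balance : ∀ f c → Reorients c₀ c → Φ c < f → ∃ Balanced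
    balance (suc f) c r (s≤s lt) with any? (λ w → b w <? out c w + a w)
    ... | yes (z₀ , t) with search _ (root {z₀} {c}) ≤-refl
    ... | inj₁ (k , Z , T , w , w∈ , h) = let (c′ , r′ , lt′) = improve k r T t w w∈ h in balance f c′ r′ (<-≤-trans lt′ lt)
    ... | inj₂ (Z , z₀∈ , cl , nh) = ⊥-elim (no-deficient-closed r z₀∈ cl t nh)
    balance (suc f) c r (s≤s lt) | no nt = c , r , ∑-≤-≡ (λ w → ≮⇒≥ (λ t → nt (w , t))) (*-cancelˡ-≤ 2 tot)
      where
      one : ∀ g → weight (λ _ → true) g ≡ ∑ g
      one g = ∑-cong (λ z → +-identityʳ (g z))
      tot : 2 * ∑ b ≤ 2 * ∑ (λ w → out c w + a w)
      tot = ≤-trans (proj₂ feas) (≤-reflexive (begin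
        inside (λ _ → true) + 2 * ∑ a ≡⟨ cong (_+ 2 * ∑ a) (trans (inside-closed {c} r (λ _ _ _ ())) (cong (2 *_) (one (out c)))) ⟩
        2 * ∑ (out c) + 2 * ∑ a       ≡⟨ *-distribˡ-+ 2 (∑ (out c)) _ ⟨
        2 * (∑ (out c) + ∑ a)         ≡⟨ cong (2 *_) (∑-+ (out c) a) ⟨
        2 * ∑ (λ w → out c w + a w) ∎))
        where open ≡-Reasoning

    balanced : ∃ Balanced
    balanced = balance _ c₀ (λ _ _ → refl) ≤-refl

-- Bipartite factors

VertexSet : ℕ → Set
VertexSet n = Fin n → Bool

∁ : ∀ {n} → VertexSet n → VertexSet n
∁ A u = not (A u)

size : ∀ {n} → VertexSet n → ℕ
size A = ∑ (λ u → ind (A u))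

degₗ degᵣ : ∀ {n} → EdgeSet n → Fin n → ℕ
degₗ S u = ∑ (λ v → ind (S u v))
degᵣ S v = ∑ (λ u → ind (S u v))

e[_] : ∀ {n} → EdgeSet n → VertexSet n → VertexSet n → ℕ
e[ S ] A B = ∑ (λ u → ∑ (λ v → ind (A u) * (ind (B v) * ind (S u v))))

ind-∁ : ∀ b → ind b + ind (not b) ≡ 1
ind-∁ true = refl
ind-∁ false = refl

ind≤1 : ∀ b → ind b ≤ 1
ind≤1 true = ≤-refl
ind≤1 false = z≤n

∑∑-+ : ∀ {m n} (f g : Fin m → Fin n → ℕ) →
  ∑ (λ u → ∑ (λ v → f u v + g u v)) ≡ ∑ (λ u → ∑ (f u)) + ∑ (λ u → ∑ (g u))
∑∑-+ f g = trans (∑-cong (λ u → ∑-+ (f u) (g u))) (∑-+ (λ u → ∑ (f u)) (λ u → ∑ (g u)))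

e-right : ∀ {n} (S : EdgeSet n) A B → e[ S ] A B + e[ S ] A (∁ B) ≡ ∑ (λ u → ind (A u) * degₗ S u)
e-right S A B = trans (sym (∑∑-+ _ _)) (∑-cong (λ u → trans (∑-cong (λ v → eq (ind (A u)) (B v) (ind (S u v)))) (sym (*-∑ (ind (A u)) _))))
  where
  eq : ∀ x b y → x * (ind b * y) + x * (ind (not b) * y) ≡ x * y
  eq x true y = lem x y where
    lem : ∀ x y → x * (1 * y) + x * (0 * y) ≡ x * y
    lem = solve-∀
  eq x false y = lem x y where
    lem : ∀ x y → x * (0 * y) + x * (1 * y) ≡ x * y
    lem = solve-∀

e-left : ∀ {n} (S : EdgeSet n) A B → e[ S ] A B + e[ S ] (∁ A) B ≡ ∑ (λ v → ind (B v) * degᵣ S v)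
e-left S A B = begin
  e[ S ] A B + e[ S ] (∁ A) B
    ≡⟨ sym (∑∑-+ _ _) ⟩
  ∑ (λ u → ∑ (λ v → ind (A u) * (ind (B v) * ind (S u v)) + ind (not (A u)) * (ind (B v) * ind (S u v))))
    ≡⟨ ∑-cong (λ u → ∑-cong (λ v → eq (A u) (ind (B v) * ind (S u v)))) ⟩
  ∑ (λ u → ∑ (λ v → ind (B v) * ind (S u v)))
    ≡⟨ ∑-comm _ ⟩
  ∑ (λ v → ∑ (λ u → ind (B v) * ind (S u v)))
    ≡⟨ ∑-cong (λ v → sym (*-∑ (ind (B v)) _)) ⟩
  ∑ (λ v → ind (B v) * degᵣ S v) ∎
  where
  open ≡-Reasoning
  eq : ∀ b y → ind b * y + ind (not b) * y ≡ y
  eq b y = trans (sym (*-distribʳ-+ y (ind b) _)) (trans (cong (_* y) (ind-∁ b)) (*-identityˡ y))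

∑-const* : ∀ {n} (A : VertexSet n) {f : Fin n → ℕ} {k} → (∀ u → f u ≡ k) → ∑ (λ u → ind (A u) * f u) ≡ k * size A
∑-const* A {k = k} h = trans (∑-cong (λ u → trans (cong (ind (A u) *_) (h u)) (*-comm (ind (A u)) k))) (sym (*-∑ k _))

-- A regular factor between `Lo` and `Up` is an orientation of the free edges: left to right means
-- chosen, right to left rejected. A left vertex `u` must emit `k - degₗ Lo u` arcs and a right
-- vertex `v` must emit `degᵣ Up v - k`. The hypothesis `cond` is the cut condition of the
-- corresponding flow problem.
module Factor {n} (Lo Up : EdgeSet n) (k : ℕ) (Lo⊆Up : Lo ⊆ₑ Up)
  (cond : ∀ A B → e[ Lo ] A (∁ B) + k * size B ≤ k * size A + e[ Up ] (∁ A) B) where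

  Free : EdgeSet n
  Free u v = Up u v ∧ not (Lo u v)

  free-split : ∀ u v → ind (Lo u v) + ind (Free u v) ≡ ind (Up u v)
  free-split u v with Lo u v in l | Up u v in p
  ... | false | false = refl
  ... | false | true = refl
  ... | true | true = refl
  ... | true | false with trans (sym p) (Lo⊆Up u v l)
  ... | ()

  arcs : Fin n ⊎ Fin n → Fin n ⊎ Fin n → Bool
  arcs (inj₁ u) (inj₂ v) = Free u v
  arcs (inj₁ u) (inj₁ v) = false
  arcs (inj₂ u) _ = false

  lower upper : Fin n ⊎ Fin n → ℕ
  lower = [ degₗ Lo , (λ _ → k) ]′
  upper = [ (λ _ → k) , degᵣ Up ]′

  c₀ : Orient (n + n)
  c₀ p q = arcs (splitAt n p) (splitAt n q)

  as₀ : Antisym c₀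
  as₀ p q with splitAt n p | splitAt n q
  ... | inj₁ u | inj₂ v = λ _ → refl
  ... | inj₁ u | inj₁ v = λ ()
  ... | inj₂ u | _ = λ ()

  open Balance c₀ as₀ (λ p → lower (splitAt n p)) (λ p → upper (splitAt n p))

  ∑-sides : ∀ (f : Fin (n + n) → ℕ) (g : Fin n ⊎ Fin n → ℕ) →
    ∑ (λ p → f p * g (splitAt n p)) ≡ ∑ (λ u → f (u ↑ˡ n) * g (inj₁ u)) + ∑ (λ v → f (n ↑ʳ v) * g (inj₂ v))
  ∑-sides f g = trans (∑-split n _) (cong₂ _+_
    (∑-cong (λ u → cong (λ z → f (u ↑ˡ n) * g z) (splitAt-↑ˡ n u n)))
    (∑-cong (λ v → cong (λ z → f (n ↑ʳ v) * g z) (splitAt-↑ʳ n n v))))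

  module _ (Z : Fin (n + n) → Bool) where
    A B : VertexSet n
    A u = Z (u ↑ˡ n)
    B v = Z (n ↑ʳ v)

    inside-free : inside Z ≡ 2 * e[ Free ] A B
    inside-free = begin
      inside Z
        ≡⟨ ∑-cong (λ p → sym (*-∑ (ind (Z p)) _)) ⟩
      ∑ (λ p → ind (Z p) * ∑ (λ q → ind (Z q) * (ind (c₀ p q) + ind (c₀ q p))))
        ≡⟨ ∑-sides (λ p → ind (Z p)) (λ p → ∑ (λ q → ind (Z q) * (ind (arcs p (splitAt n q)) + ind (arcs (splitAt n q) p)))) ⟩
      ∑ (λ u → ind (A u) * ∑ (λ q → ind (Z q) * (ind (arcs (inj₁ u) (splitAt n q)) + ind (arcs (splitAt n q) (inj₁ u)))))
      + ∑ (λ v → ind (B v) * ∑ (λ q → ind (Z q) * (ind (arcs (inj₂ v) (splitAt n q)) + ind (arcs (splitAt n q) (inj₂ v)))))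
        ≡⟨ cong₂ _+_
             (∑-cong (λ u → cong (ind (A u) *_) (trans (∑-sides (λ q → ind (Z q)) (λ q → ind (arcs (inj₁ u) q) + ind (arcs q (inj₁ u))))
               (cong₂ _+_ (∑-zero (λ v → *-zeroʳ (ind (A v)))) (∑-cong (λ v → cong (ind (B v) *_) (+-identityʳ _)))))))
             (∑-cong (λ v → cong (ind (B v) *_) (trans (∑-sides (λ q → ind (Z q)) (λ q → ind (arcs (inj₂ v) q) + ind (arcs q (inj₂ v))))
               (trans (cong₂ _+_ refl (∑-zero (λ u → *-zeroʳ (ind (B u))))) (+-identityʳ _))))) ⟩
      ∑ (λ u → ind (A u) * ∑ (λ v → ind (B v) * ind (Free u v)))
      + ∑ (λ v → ind (B v) * ∑ (λ u → ind (A u) * ind (Free u v)))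
        ≡⟨ cong₂ _+_ (∑-cong (λ u → *-∑ (ind (A u)) _)) (trans (∑-cong (λ v → *-∑ (ind (B v)) _)) (∑-comm _)) ⟩
      e[ Free ] A B + ∑ (λ u → ∑ (λ v → ind (B v) * (ind (A u) * ind (Free u v))))
        ≡⟨ cong₂ _+_ refl (∑-cong (λ u → ∑-cong (λ v → sw (ind (B v)) (ind (A u)) (ind (Free u v))))) ⟩
      e[ Free ] A B + e[ Free ] A B
        ≡⟨ cong (e[ Free ] A B +_) (sym (+-identityʳ _)) ⟩
      2 * e[ Free ] A B ∎
      where
      open ≡-Reasoning
      sw : ∀ x y z → x * (y * z) ≡ y * (x * z)
      sw = solve-∀

    weight-lower : weight Z (λ p → lower (splitAt n p)) ≡ e[ Lo ] A B + e[ Lo ] A (∁ B) + k * size B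
    weight-lower = trans (∑-sides (λ p → ind (Z p)) lower) (cong₂ _+_ (sym (e-right Lo A B)) (∑-const* B (λ _ → refl)))

    weight-upper : weight Z (λ p → upper (splitAt n p)) ≡ k * size A + (e[ Up ] A B + e[ Up ] (∁ A) B)
    weight-upper = trans (∑-sides (λ p → ind (Z p)) upper) (cong₂ _+_ (∑-const* A (λ _ → refl)) (sym (e-left Up A B)))

    e-free : e[ Lo ] A B + e[ Free ] A B ≡ e[ Up ] A B
    e-free = trans (sym (∑∑-+ _ _)) (∑-cong (λ u → ∑-cong (λ v →
      trans (fac (ind (A u)) (ind (B v)) (ind (Lo u v)) _) (cong (λ x → ind (A u) * (ind (B v) * x)) (free-split u v)))))
      where
      fac : ∀ x y l f → x * (y * l) + x * (y * f) ≡ x * (y * (l + f))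
      fac = solve-∀

    -- Forced and free edges between `A` and `B` add up to `e[ Up ] A B` on both sides of Hakimi's
    -- condition; what remains is twice `cond`.
    feasible-lower : inside Z + 2 * weight Z (λ p → lower (splitAt n p)) ≤ 2 * weight Z (λ p → upper (splitAt n p))
    feasible-lower rewrite inside-free | weight-lower | weight-upper | sym e-free = begin
      2 * f + 2 * (l + l′ + k * size B) ≡⟨ r₁ f l l′ (k * size B) ⟩
      2 * (l + f) + 2 * (l′ + k * size B) ≤⟨ +-monoʳ-≤ (2 * (l + f)) (*-monoʳ-≤ 2 (cond A B)) ⟩
      2 * (l + f) + 2 * (k * size A + u′) ≡⟨ r₂ (l + f) (k * size A) u′ ⟩
      2 * (k * size A + (l + f + u′)) ∎
      where
      open ≤-Reasoning
      f = e[ Free ] A B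
      l = e[ Lo ] A B
      l′ = e[ Lo ] A (∁ B)
      u′ = e[ Up ] (∁ A) B
      r₁ : ∀ f l l′ x → 2 * f + 2 * (l + l′ + x) ≡ 2 * (l + f) + 2 * (l′ + x)
      r₁ = solve-∀
      r₂ : ∀ l x u → 2 * l + 2 * (x + u) ≡ 2 * (x + (l + u))
      r₂ = solve-∀

  e-∅ᵣ : ∀ (S : EdgeSet n) A → e[ S ] A (λ _ → false) ≡ 0
  e-∅ᵣ S A = ∑-zero (λ u → ∑-zero (λ v → *-zeroʳ (ind (A u))))

  weight-all : ∀ f → ∑ f ≡ weight (λ _ → true) f
  weight-all f = ∑-cong (λ p → sym (+-identityʳ (f p)))

  -- For the set of all vertices both sides coincide, because the two colour classes have the same
  -- size.
  feasible-total : 2 * ∑ (λ p → upper (splitAt n p)) ≤ inside (λ _ → true) + 2 * ∑ (λ p → lower (splitAt n p))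
  feasible-total rewrite weight-all (λ p → upper (splitAt n p)) | weight-all (λ p → lower (splitAt n p))
    | inside-free (λ _ → true) | weight-lower (λ _ → true) | weight-upper (λ _ → true)
    | sym (e-free (λ _ → true)) | e-∅ᵣ Lo (λ _ → true) = ≤-reflexive (r l f (k * size {n} (λ _ → true)))
    where
    f = e[ Free ] (λ _ → true) (λ _ → true)
    l = e[ Lo ] (λ _ → true) (λ _ → true)
    r : ∀ l f x → 2 * (x + (l + f + 0)) ≡ 2 * f + 2 * (l + 0 + x)
    r = solve-∀

  balancedArcs : ∃ Balanced
  balancedArcs = balanced (feasible-lower , feasible-total)

  c : Orient (n + n)
  c = proj₁ balancedArcs

  reor : ∀ p q → ind (c p q) + ind (c q p) ≡ ind (c₀ p q) + ind (c₀ q p)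
  reor = proj₁ (proj₂ balancedArcs)

  outs : ∀ p → out c p + lower (splitAt n p) ≡ upper (splitAt n p)
  outs = proj₂ (proj₂ balancedArcs)

  out-sides : ∀ p → out c p ≡ ∑ (λ u → ind (c p (u ↑ˡ n))) + ∑ (λ v → ind (c p (n ↑ʳ v)))
  out-sides p = ∑-split n _

  c-ll : ∀ u v → ind (c (u ↑ˡ n) (v ↑ˡ n)) ≡ 0
  c-ll u v = m+n≡0⇒m≡0 _ (trans (reor _ _) eq)
    where
    eq : ind (c₀ (u ↑ˡ n) (v ↑ˡ n)) + ind (c₀ (v ↑ˡ n) (u ↑ˡ n)) ≡ 0
    eq rewrite splitAt-↑ˡ n u n | splitAt-↑ˡ n v n = refl

  c-rr : ∀ u v → ind (c (n ↑ʳ u) (n ↑ʳ v)) ≡ 0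
  c-rr u v = m+n≡0⇒m≡0 _ (trans (reor _ _) eq)
    where
    eq : ind (c₀ (n ↑ʳ u) (n ↑ʳ v)) + ind (c₀ (n ↑ʳ v) (n ↑ʳ u)) ≡ 0
    eq rewrite splitAt-↑ʳ n n u | splitAt-↑ʳ n n v = refl

  c-lr : ∀ u v → ind (c (u ↑ˡ n) (n ↑ʳ v)) + ind (c (n ↑ʳ v) (u ↑ˡ n)) ≡ ind (Free u v)
  c-lr u v = trans (reor _ _) eq
    where
    eq : ind (c₀ (u ↑ˡ n) (n ↑ʳ v)) + ind (c₀ (n ↑ʳ v) (u ↑ˡ n)) ≡ ind (Free u v)
    eq rewrite splitAt-↑ˡ n u n | splitAt-↑ʳ n n v = +-identityʳ _

  M : EdgeSet n
  M u v = Lo u v ∨ c (u ↑ˡ n) (n ↑ʳ v)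

  ind-M : ∀ u v → ind (M u v) ≡ ind (Lo u v) + ind (c (u ↑ˡ n) (n ↑ʳ v))
  ind-M u v with Lo u v in l | c (u ↑ˡ n) (n ↑ʳ v) | c-lr u v
  ... | false | _ | _ = refl
  ... | true | false | _ = refl
  ... | true | true | p with Up u v
  ind-M u v | true | true | () | false
  ind-M u v | true | true | () | true

  Lo⊆M : Lo ⊆ₑ M
  Lo⊆M u v p rewrite p = refl

  M⊆Up : M ⊆ₑ Up
  M⊆Up u v p with Lo u v in l | c (u ↑ˡ n) (n ↑ʳ v) | c-lr u v
  ... | true | _ | _ = Lo⊆Up u v l
  ... | false | true | q with Up u v
  ... | true = refl
  M⊆Up u v p | false | true | () | false
  M⊆Up u v () | false | false | q

  M-left : ∀ u → degₗ M u ≡ k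
  M-left u = begin
    degₗ M u                                                           ≡⟨ ∑-cong (ind-M u) ⟩
    ∑ (λ v → ind (Lo u v) + ind (c (u ↑ˡ n) (n ↑ʳ v)))                 ≡⟨ ∑-+ _ _ ⟩
    degₗ Lo u + ∑ (λ v → ind (c (u ↑ˡ n) (n ↑ʳ v)))                    ≡⟨ +-comm (degₗ Lo u) _ ⟩
    ∑ (λ v → ind (c (u ↑ˡ n) (n ↑ʳ v))) + degₗ Lo u                    ≡⟨ cong (_+ degₗ Lo u) (sym (trans (out-sides (u ↑ˡ n)) (cong₂ _+_ (∑-zero (c-ll u)) refl))) ⟩
    out c (u ↑ˡ n) + degₗ Lo u                                         ≡⟨ subst (λ z → out c (u ↑ˡ n) + lower z ≡ upper z) (splitAt-↑ˡ n u n) (outs (u ↑ˡ n)) ⟩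
    k ∎
    where open ≡-Reasoning

  M-right : ∀ v → degᵣ M v ≡ k
  M-right v = +-cancelʳ-≡ o _ _ (begin
    degᵣ M v + o                                                       ≡⟨ ∑-+ _ _ ⟨
    ∑ (λ u → ind (M u v) + ind (c (n ↑ʳ v) (u ↑ˡ n)))                  ≡⟨ ∑-cong (λ u → trans (cong (_+ ind (c (n ↑ʳ v) (u ↑ˡ n))) (ind-M u v))
                                                                              (trans (+-assoc (ind (Lo u v)) _ _) (trans (cong (ind (Lo u v) +_) (c-lr u v)) (free-split u v)))) ⟩
    degᵣ Up v                                                          ≡⟨ subst (λ z → out c (n ↑ʳ v) + lower z ≡ upper z) (splitAt-↑ʳ n n v) (outs (n ↑ʳ v)) ⟨
    out c (n ↑ʳ v) + k                                                 ≡⟨ cong (_+ k) (trans (out-sides (n ↑ʳ v)) (trans (cong (o +_) (∑-zero (c-rr v))) (+-identityʳ o))) ⟩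
    o + k                                                              ≡⟨ +-comm o k ⟩
    k + o ∎)
    where
    open ≡-Reasoning
    o : ℕ
    o = ∑ (λ u → ind (c (n ↑ʳ v) (u ↑ˡ n)))

-- Edge colouring of regular bipartite graphs

_∖_ : ∀ {n} → EdgeSet n → EdgeSet n → EdgeSet n
(H ∖ M) u v = H u v ∧ not (M u v)

ind-∖ : ∀ {n} {M H : EdgeSet n} → M ⊆ₑ H → ∀ u v → ind (M u v) + ind ((H ∖ M) u v) ≡ ind (H u v)
ind-∖ {M = M} {H} sub u v with M u v in l | H u v in p
... | false | false = refl
... | false | true = refl
... | true | true = refl
... | true | false with trans (sym p) (sub u v l)
... | ()

∖-⊆ : ∀ {n} (H M : EdgeSet n) → (H ∖ M) ⊆ₑ H
∖-⊆ H M u v p with H u v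
... | true = refl

∖-∉ : ∀ {n} (H M : EdgeSet n) {u v} → (H ∖ M) u v ≡ true → M u v ≡ true → ⊥
∖-∉ H M {u} {v} p q with H u v | M u v
∖-∉ H M {u} {v} () q | true | true
∖-∉ H M {u} {v} () q | false | true

IsRegular : ∀ {n} → EdgeSet n → ℕ → Set
IsRegular H d = (∀ u → degₗ H u ≡ d) × (∀ v → degᵣ H v ≡ d)

∖-regular : ∀ {n} {M H : EdgeSet n} {k d} → M ⊆ₑ H → IsRegular H (k + d) → IsRegular M k → IsRegular (H ∖ M) d
∖-regular {M = M} {H} {k} {d} sub (hₗ , hᵣ) (mₗ , mᵣ) =
  (λ u → +-cancelˡ-≡ k _ _ (trans (cong (_+ degₗ (H ∖ M) u) (sym (mₗ u)))
           (trans (sym (∑-+ _ _)) (trans (∑-cong (λ v → ind-∖ {M = M} {H} sub u v)) (hₗ u))))) ,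
  (λ v → +-cancelˡ-≡ k _ _ (trans (cong (_+ degᵣ (H ∖ M) v) (sym (mᵣ v)))
           (trans (sym (∑-+ _ _)) (trans (∑-cong (λ u → ind-∖ {M = M} {H} sub u v)) (hᵣ v)))))

∑-singleton : ∀ {n} (v : Fin n) → ∑ (λ i → ind (does (i F.≟ v))) ≡ 1
∑-singleton {n} v = begin
  ∑ (λ i → ind (does (i F.≟ v)))     ≡⟨ +-identityʳ _ ⟨
  ∑ (λ i → ind (does (i F.≟ v))) + 0 ≡⟨ ∑-update _ (λ _ → 0) v (λ j ne → off j ne) ⟩
  ∑ {n} (λ _ → 0) + ind (does (v F.≟ v)) ≡⟨ cong₂ _+_ (∑-zero (λ _ → refl)) on ⟩
  1 ∎
  where
  open ≡-Reasoning
  off : ∀ j → j ≢ v → ind (does (j F.≟ v)) ≡ 0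
  off j ne with j F.≟ v
  ... | yes e = ⊥-elim (ne e)
  ... | no _ = refl
  on : ind (does (v F.≟ v)) ≡ 1
  on with v F.≟ v
  ... | yes _ = refl
  ... | no n = ⊥-elim (n refl)

∑-ind≡1 : ∀ {n} (f : Fin n → Bool) → ∑ (λ i → ind (f i)) ≡ 1 →
          ∃ λ v → f v ≡ true × (∀ w → f w ≡ true → w ≡ v)
∑-ind≡1 f e with any? (λ v → f v B.≟ true)
... | no none = ⊥-elim (0≢1+n (trans (sym (∑-zero (λ i → zeros i))) e))
  where
  zeros : ∀ i → ind (f i) ≡ 0
  zeros i with f i in p
  ... | true = ⊥-elim (none (i , p))
  ... | false = refl
... | yes (v , p) = v , p , uniq
  where
  le : ∀ i → ind (does (i F.≟ v)) ≤ ind (f i)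
  le i with i F.≟ v
  ... | no _ = z≤n
  ... | yes refl rewrite p = ≤-refl
  uniq : ∀ w → f w ≡ true → w ≡ v
  uniq w q with w F.≟ v | ∑-≤-≡ le (≤-reflexive (trans e (sym (∑-singleton v)))) w
  ... | yes r | _ = r
  ... | no _ | r rewrite q with r
  ... | ()

regular-1-perfect : ∀ {n} {M : EdgeSet n} → IsRegular M 1 → PerfectMatching M
regular-1-perfect (l , r) = (λ u → ∑-ind≡1 _ (l u)) , (λ v → ∑-ind≡1 _ (r v))

join : ∀ {n d₁ d₂} → Tuple n d₁ → Tuple n d₂ → Tuple n (d₁ + d₂)
join {d₁ = d₁} M₁ M₂ i = [ M₁ , M₂ ]′ (splitAt d₁ i)

join-1F : ∀ {n d₁ d₂} {H H₁ : EdgeSet n} {M₁ : Tuple n d₁} {M₂ : Tuple n d₂} → H₁ ⊆ₑ H →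
  OneFactorization H₁ M₁ → OneFactorization (H ∖ H₁) M₂ → OneFactorization H (join M₁ M₂)
join-1F {n} {d₁} {d₂} {H} {H₁} {M₁} {M₂} sub (pm₁ , in₁ , un₁) (pm₂ , in₂ , un₂) = pm , inc , un
  where
  pm : ∀ i → PerfectMatching (join M₁ M₂ i)
  pm i with splitAt d₁ i
  ... | inj₁ j = pm₁ j
  ... | inj₂ j = pm₂ j
  inc : ∀ i → join M₁ M₂ i ⊆ₑ H
  inc i with splitAt d₁ i
  ... | inj₁ j = λ u v p → sub u v (in₁ j u v p)
  ... | inj₂ j = λ u v p → ∖-⊆ H H₁ u v (in₂ j u v p)
  un : ∀ u v → H u v ≡ true → ∃ λ i → join M₁ M₂ i u v ≡ true × (∀ j → join M₁ M₂ j u v ≡ true → j ≡ i)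
  un u v h with H₁ u v in q
  ... | true with un₁ u v q
  ... | i , p , uq = i ↑ˡ d₂ , trans (cong (λ z → [ M₁ , M₂ ]′ z u v) (splitAt-↑ˡ d₁ i d₂)) p , uq′
    where
    uq′ : ∀ j → join M₁ M₂ j u v ≡ true → j ≡ i ↑ˡ d₂
    uq′ j r with splitAt d₁ j in e
    ... | inj₁ j′ = trans (sym (splitAt⁻¹-↑ˡ e)) (cong (_↑ˡ d₂) (uq j′ r))
    ... | inj₂ j′ = ⊥-elim (∖-∉ H H₁ (in₂ j′ u v r) q)
  un u v h | false with un₂ u v (cong₂ (λ a b → a ∧ not b) h q)
  ... | i , p , uq = d₁ ↑ʳ i , trans (cong (λ z → [ M₁ , M₂ ]′ z u v) (splitAt-↑ʳ d₁ d₂ i)) p , uq′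
    where
    uq′ : ∀ j → join M₁ M₂ j u v ≡ true → j ≡ d₁ ↑ʳ i
    uq′ j r with splitAt d₁ j in e
    ... | inj₂ j′ = trans (sym (splitAt⁻¹-↑ʳ e)) (cong (d₁ ↑ʳ_) (uq j′ r))
    ... | inj₁ j′ with trans (sym q) (in₁ j′ u v r)
    ... | ()

e-regularₗ : ∀ {n} {H : EdgeSet n} {d} → IsRegular H d → ∀ A B → e[ H ] A B + e[ H ] A (∁ B) ≡ d * size A
e-regularₗ {H = H} (l , _) A B = trans (e-right H A B) (∑-const* A l)

e-regularᵣ : ∀ {n} {H : EdgeSet n} {d} → IsRegular H d → ∀ A B → e[ H ] A B + e[ H ] (∁ A) B ≡ d * size B
e-regularᵣ {H = H} (_ , r) A B = trans (e-left H A B) (∑-const* B r)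

abstract
  factor : ∀ {n} (Lo Up : EdgeSet n) k → Lo ⊆ₑ Up →
    (∀ A B → e[ Lo ] A (∁ B) + k * size B ≤ k * size A + e[ Up ] (∁ A) B) →
    ∃ λ M → Lo ⊆ₑ M × M ⊆ₑ Up × IsRegular M k
  factor Lo Up k Lo⊆Up cond = M , Lo⊆M , M⊆Up , M-left , M-right
    where open Factor Lo Up k Lo⊆Up cond

-- König's theorem by peeling: `factor` with nothing forced and `k = 1` yields one perfect matching,
-- and the rest is regular of degree one less.
oneFactorization : ∀ {n} d (H : EdgeSet n) → IsRegular H d → Σ (Tuple n d) (OneFactorization H)
oneFactorization {n} zero H (l , _) = (λ ()) , (λ ()) , (λ ()) , λ u v h →
  ⊥-elim (<⇒≱ (≤-reflexive (sym (cong ind h))) (≤-trans (term≤∑ (λ v → ind (H u v)) v) (≤-reflexive (l u))))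
oneFactorization {n} (suc d) H reg = join {d₁ = 1} (λ _ → M) (proj₁ rest) , join-1F M⊆H one (proj₂ rest)
  where
  cond : ∀ A B → e[ (λ _ _ → false) ] A (∁ B) + 1 * size B ≤ 1 * size A + e[ H ] (∁ A) B
  cond A B = begin
    e[ (λ _ _ → false) ] A (∁ B) + 1 * size B ≡⟨ cong₂ _+_ (∑-zero (λ u → ∑-zero (λ v → trans (cong (ind (A u) *_) (*-zeroʳ (ind (not (B v))))) (*-zeroʳ (ind (A u)))))) (*-identityˡ _) ⟩
    size B                                    ≤⟨ bound ⟩
    size A + e[ H ] (∁ A) B                   ≡⟨ cong (_+ e[ H ] (∁ A) B) (*-identityˡ _) ⟨
    1 * size A + e[ H ] (∁ A) B ∎
    where
    open ≤-Reasoning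
    -- After multiplication by `suc d` this counts the edges at `B` by their left ends; those in `A`
    -- carry at most `suc d` edges each.
    bound : size B ≤ size A + e[ H ] (∁ A) B
    bound = *-cancelˡ-≤ (suc d) (begin
      suc d * size B                       ≡⟨ e-regularᵣ {H = H} reg A B ⟨
      e[ H ] A B + e[ H ] (∁ A) B          ≤⟨ +-mono-≤ (≤-trans (m≤m+n _ _) (≤-reflexive (e-regularₗ {H = H} reg A B))) (m≤n*m _ (suc d)) ⟩
      suc d * size A + suc d * e[ H ] (∁ A) B ≡⟨ *-distribˡ-+ (suc d) (size A) _ ⟨
      suc d * (size A + e[ H ] (∁ A) B) ∎)
  matching = factor (λ _ _ → false) H 1 (λ _ _ ()) cond
  M = proj₁ matching
  M⊆H = proj₁ (proj₂ (proj₂ matching))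
  M-regular = proj₂ (proj₂ (proj₂ matching))
  rest : Σ (Tuple n d) (OneFactorization (H ∖ M))
  rest = oneFactorization d (H ∖ M) (∖-regular {M = M} {H} {1} M⊆H reg M-regular)
  one : OneFactorization M (λ (_ : Fin 1) → M)
  one = (λ _ → regular-1-perfect M-regular) , (λ _ u v p → p) , λ u v p → zero , p , λ { zero _ → refl }

-- Enumeration of labelings and cuts

∑ₗ : List X → (X → ℕ) → ℕ
∑ₗ xs f = sum (map f xs)

∑ₗ-cong : ∀ (xs : List X) {f g : X → ℕ} → (∀ x → f x ≡ g x) → ∑ₗ xs f ≡ ∑ₗ xs g
∑ₗ-cong []       h = refl
∑ₗ-cong (x ∷ xs) h = cong₂ _+_ (h x) (∑ₗ-cong xs h)

∑ₗ-mono : ∀ (xs : List X) {f g : X → ℕ} → (∀ x → f x ≤ g x) → ∑ₗ xs f ≤ ∑ₗ xs g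
∑ₗ-mono []       h = z≤n
∑ₗ-mono (x ∷ xs) h = +-mono-≤ (h x) (∑ₗ-mono xs h)

∑ₗ-+ : ∀ (xs : List X) (f g : X → ℕ) → ∑ₗ xs (λ x → f x + g x) ≡ ∑ₗ xs f + ∑ₗ xs g
∑ₗ-+ []       f g = refl
∑ₗ-+ (x ∷ xs) f g = trans (cong (f x + g x +_) (∑ₗ-+ xs f g)) (swap (f x) (g x) _ _)
  where
  swap : ∀ a b c d → a + b + (c + d) ≡ a + c + (b + d)
  swap = solve-∀

∑ₗ-*ˡ : ∀ (xs : List X) c (f : X → ℕ) → ∑ₗ xs (λ x → c * f x) ≡ c * ∑ₗ xs f
∑ₗ-*ˡ []       c f = sym (*-zeroʳ c)
∑ₗ-*ˡ (x ∷ xs) c f = trans (cong (c * f x +_) (∑ₗ-*ˡ xs c f)) (sym (*-distribˡ-+ c (f x) _))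

∑ₗ-*ʳ : ∀ (xs : List X) c (f : X → ℕ) → ∑ₗ xs (λ x → f x * c) ≡ ∑ₗ xs f * c
∑ₗ-*ʳ []       c f = refl
∑ₗ-*ʳ (x ∷ xs) c f = trans (cong (f x * c +_) (∑ₗ-*ʳ xs c f)) (sym (*-distribʳ-+ c (f x) _))

∑ₗ-zero : ∀ (xs : List X) → ∑ₗ xs (λ _ → 0) ≡ 0
∑ₗ-zero []       = refl
∑ₗ-zero (x ∷ xs) = ∑ₗ-zero xs

∑ₗ-comm : ∀ (xs : List X) (ys : List Y) (f : X → Y → ℕ) →
  ∑ₗ xs (λ x → ∑ₗ ys (f x)) ≡ ∑ₗ ys (λ y → ∑ₗ xs (λ x → f x y))
∑ₗ-comm []       ys f = sym (∑ₗ-zero ys)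
∑ₗ-comm (x ∷ xs) ys f = trans (cong (∑ₗ ys (f x) +_) (∑ₗ-comm xs ys f)) (sym (∑ₗ-+ ys (f x) _))

∑ₗ-++ : ∀ (xs ys : List X) (f : X → ℕ) → ∑ₗ (xs ++ ys) f ≡ ∑ₗ xs f + ∑ₗ ys f
∑ₗ-++ xs ys f = trans (cong sum (map-++ f xs ys)) (sum-++ (map f xs) _)

∑ₗ-map : ∀ (xs : List X) (g : X → Y) (f : Y → ℕ) → ∑ₗ (map g xs) f ≡ ∑ₗ xs (f ∘ g)
∑ₗ-map xs g f = cong sum (sym (map-∘ xs))

∑ₗ-concatMap : ∀ (xs : List X) (g : X → List Y) (f : Y → ℕ) → ∑ₗ (concatMap g xs) f ≡ ∑ₗ xs (λ x → ∑ₗ (g x) f)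
∑ₗ-concatMap []       g f = refl
∑ₗ-concatMap (x ∷ xs) g f = trans (∑ₗ-++ (g x) _ f) (cong (∑ₗ (g x) f +_) (∑ₗ-concatMap xs g f))

∑ₗ-replicate : ∀ k (x : X) (f : X → ℕ) → ∑ₗ (replicate k x) f ≡ k * f x
∑ₗ-replicate zero    x f = refl
∑ₗ-replicate (suc k) x f = cong (f x +_) (∑ₗ-replicate k x f)

markov : ∀ (xs : List X) (P : X → Bool) (f : X → ℕ) K → (∀ x → P x ≡ true → K ≤ f x) →
  ∑ₗ xs (λ x → ind (P x)) * K ≤ ∑ₗ xs f
markov xs P f K h = ≤-trans (≤-reflexive (sym (∑ₗ-*ʳ xs K _))) (∑ₗ-mono xs le)
  where
  le : ∀ x → ind (P x) * K ≤ f x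
  le x with P x in e
  ... | true  = ≤-trans (≤-reflexive (*-identityˡ K)) (h x e)
  ... | false = z≤n

funs : List X → ∀ k → List (Fin k → X)
funs xs zero    = (λ ()) ∷ []
funs xs (suc k) = concatMap (λ a → map (a V.∷_) (funs xs k)) xs

∑ₗ-funs-suc : ∀ (xs : List X) k (F : (Fin (suc k) → X) → ℕ) →
  ∑ₗ (funs xs (suc k)) F ≡ ∑ₗ xs (λ a → ∑ₗ (funs xs k) (λ f → F (a V.∷ f)))
∑ₗ-funs-suc xs k F = trans (∑ₗ-concatMap xs _ F) (∑ₗ-cong xs (λ a → ∑ₗ-map (funs xs k) (a V.∷_) F))

-- Independence of the coordinates of a uniform function, in counting form.
∑ₗ-funs-∏ : ∀ (xs : List X) {k} (w : Fin k → X → ℕ) →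
  ∑ₗ (funs xs k) (λ f → ∏ (λ i → w i (f i))) ≡ ∏ (λ i → ∑ₗ xs (w i))
∑ₗ-funs-∏ xs {zero} w = trans (cong (_+ 0) (∏-nil _)) (sym (∏-nil _))
∑ₗ-funs-∏ xs {suc k} w = begin
  ∑ₗ (funs xs (suc k)) (λ f → ∏ (λ i → w i (f i)))
    ≡⟨ ∑ₗ-funs-suc xs k _ ⟩
  ∑ₗ xs (λ a → ∑ₗ (funs xs k) (λ f → ∏ (λ i → w i ((a V.∷ f) i))))
    ≡⟨ ∑ₗ-cong xs (λ a → trans (∑ₗ-cong (funs xs k) (λ f → ∏-suc _)) (∑ₗ-*ˡ (funs xs k) (w zero a) _)) ⟩
  ∑ₗ xs (λ a → w zero a * ∑ₗ (funs xs k) (λ f → ∏ (λ i → w (suc i) (f i))))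
    ≡⟨ ∑ₗ-*ʳ xs _ (w zero) ⟩
  ∑ₗ xs (w zero) * ∑ₗ (funs xs k) (λ f → ∏ (λ i → w (suc i) (f i)))
    ≡⟨ cong (∑ₗ xs (w zero) *_) (∑ₗ-funs-∏ xs (w ∘ suc)) ⟩
  ∑ₗ xs (w zero) * ∏ (λ i → ∑ₗ xs (w (suc i)))
    ≡⟨ ∏-suc _ ⟨
  ∏ (λ i → ∑ₗ xs (w i)) ∎
  where open ≡-Reasoning

cuts : ∀ n → List (VertexSet n)
cuts = funs (true ∷ false ∷ [])

-- `cuts` enumerates vertex sets only up to pointwise equality.
term≤∑-cuts : ∀ n (F : VertexSet n → ℕ) → (∀ A B → (∀ i → A i ≡ B i) → F A ≡ F B) → ∀ A → F A ≤ ∑ₗ (cuts n) F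
term≤∑-cuts zero F ext A = ≤-trans (≤-reflexive (ext A _ (λ ()))) (m≤m+n _ 0)
term≤∑-cuts (suc n) F ext A = begin
  F A                                                    ≡⟨ ext A (A zero V.∷ (A ∘ suc)) (λ { zero → refl ; (suc i) → refl }) ⟩
  F (A zero V.∷ (A ∘ suc))                               ≤⟨ term≤∑-cuts n (λ B → F (A zero V.∷ B)) (λ B C e → ext _ _ (λ { zero → refl ; (suc i) → e i })) (A ∘ suc) ⟩
  ∑ₗ (cuts n) (λ B → F (A zero V.∷ B))                   ≤⟨ pick (A zero) ⟩
  ∑ₗ (true ∷ false ∷ []) (λ b → ∑ₗ (cuts n) (λ B → F (b V.∷ B))) ≡⟨ ∑ₗ-funs-suc (true ∷ false ∷ []) n F ⟨
  ∑ₗ (cuts (suc n)) F ∎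
  where
  open ≤-Reasoning
  G : Bool → ℕ
  G b = ∑ₗ (cuts n) (λ B → F (b V.∷ B))
  pick : ∀ b → G b ≤ G true + (G false + 0)
  pick true  = m≤m+n _ _
  pick false = ≤-trans (m≤m+n _ 0) (m≤n+m _ (G true))

∏-const : ∀ n x → ∏ {n} (λ _ → x) ≡ x ^ n
∏-const zero    x = ∏-nil _
∏-const (suc n) x = trans (∏-suc _) (cong (x *_) (∏-const n x))

-- The binomial theorem: each vertex contributes a factor `x` if it is in the set and `1` if it is
-- not.
∑ₗ-cuts-size : ∀ n x → ∑ₗ (cuts n) (λ A → x ^ size A) ≡ (x + 1) ^ n
∑ₗ-cuts-size n x = begin
  ∑ₗ (cuts n) (λ A → x ^ size A)              ≡⟨ ∑ₗ-cong (cuts n) (λ A → ∏-^ x (λ i → ind (A i))) ⟨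
  ∑ₗ (cuts n) (λ A → ∏ (λ i → x ^ ind (A i))) ≡⟨ ∑ₗ-funs-∏ (true ∷ false ∷ []) {n} (λ i b → x ^ ind b) ⟩
  ∏ {n} (λ _ → x * 1 + 1)                     ≡⟨ ∏-const n _ ⟩
  (x * 1 + 1) ^ n                             ≡⟨ cong (λ y → (y + 1) ^ n) (*-identityʳ x) ⟩
  (x + 1) ^ n ∎
  where open ≡-Reasoning

∑ₗ-cuts-∁size : ∀ n x → ∑ₗ (cuts n) (λ A → x ^ size (∁ A)) ≡ (x + 1) ^ n
∑ₗ-cuts-∁size n x = begin
  ∑ₗ (cuts n) (λ A → x ^ size (∁ A))                ≡⟨ ∑ₗ-cong (cuts n) (λ A → ∏-^ x (λ i → ind (not (A i)))) ⟨
  ∑ₗ (cuts n) (λ A → ∏ (λ i → x ^ ind (not (A i)))) ≡⟨ ∑ₗ-funs-∏ (true ∷ false ∷ []) {n} (λ i b → x ^ ind (not b)) ⟩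
  ∏ {n} (λ _ → 1 + (x * 1 + 0))                     ≡⟨ ∏-const n _ ⟩
  (1 + (x * 1 + 0)) ^ n                             ≡⟨ cong (_^ n) (eq x) ⟩
  (x + 1) ^ n ∎
  where
  open ≡-Reasoning
  eq : ∀ x → 1 + (x * 1 + 0) ≡ x + 1
  eq = solve-∀

∑∑ : ∀ {m n} → (Fin m → Fin n → ℕ) → ℕ
∑∑ f = ∑ (λ u → ∑ (f u))

∏∏ : ∀ {m n} → (Fin m → Fin n → ℕ) → ℕ
∏∏ f = ∏ (λ u → ∏ (f u))

∏∏-cong : ∀ {m n} {f g : Fin m → Fin n → ℕ} → (∀ u v → f u v ≡ g u v) → ∏∏ f ≡ ∏∏ g
∏∏-cong h = ∏-cong (λ u → ∏-cong (h u))

∏∏-mono : ∀ {m n} {f g : Fin m → Fin n → ℕ} → (∀ u v → f u v ≤ g u v) → ∏∏ f ≤ ∏∏ g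
∏∏-mono h = ∏-mono (λ u → ∏-mono (h u))

∏∏-* : ∀ {m n} (f g : Fin m → Fin n → ℕ) → ∏∏ (λ u v → f u v * g u v) ≡ ∏∏ f * ∏∏ g
∏∏-* f g = trans (∏-cong (λ u → ∏-* (f u) (g u))) (∏-* _ _)

∏∏-^ : ∀ {m n} x (f : Fin m → Fin n → ℕ) → ∏∏ (λ u v → x ^ f u v) ≡ x ^ ∑∑ f
∏∏-^ x f = trans (∏-cong (λ u → ∏-^ x (f u))) (∏-^ x _)

-- `just s` forces an edge to side s of the split, `nothing` leaves it free;
-- a uniform element of `labels q` is free with probability 1 / (q + 1).
Label : Set
Label = Maybe Bool

labels : ℕ → List Label
labels q = replicate q (just true) ++ replicate q (just false) ++ nothing ∷ nothing ∷ []

∑ₗ-labels : ∀ q (f : Label → ℕ) → ∑ₗ (labels q) f ≡ q * f (just true) + (q * f (just false) + 2 * f nothing)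
∑ₗ-labels q f = trans (∑ₗ-++ (replicate q (just true)) _ f) (cong₂ _+_ (∑ₗ-replicate q _ f)
  (trans (∑ₗ-++ (replicate q (just false)) _ f) (cong₂ _+_ (∑ₗ-replicate q _ f) refl)))

Labeling : ℕ → Set
Labeling n = Fin n → Fin n → Label

-- All pairs are labelled, edges or not, so that the sample space is a full product.
labelings : ℕ → ∀ n → List (Labeling n)
labelings q n = funs (funs (labels q) n) n

∑ₗ-labelings : ∀ q {n} (w : Fin n → Fin n → Label → ℕ) →
  ∑ₗ (labelings q n) (λ ω → ∏∏ (λ u v → w u v (ω u v))) ≡ ∏∏ (λ u v → ∑ₗ (labels q) (w u v))
∑ₗ-labelings q {n} w = trans (∑ₗ-funs-∏ (funs (labels q) n) (λ u f → ∏ (λ v → w u v (f v)))) (∏-cong (λ u → ∑ₗ-funs-∏ (labels q) (w u)))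

-- Chernoff bounds for random labelings

does-true : ∀ {A : Set} (d : Dec A) → does d ≡ true → A
does-true (yes a) _ = a

^-distribʳ-* : ∀ k x y → (x * y) ^ k ≡ x ^ k * y ^ k
^-distribʳ-* zero    x y = refl
^-distribʳ-* (suc k) x y = trans (cong (x * y *_) (^-distribʳ-* k x y)) (sw x y _ _)
  where
  sw : ∀ a b c d → a * b * (c * d) ≡ a * c * (b * d)
  sw = solve-∀

-- Cleared form of `(1 + 1/Z)^k ≤ 1 + 2k/Z`. In the induction step a second-order term `2k` appears,
-- which is at most `Z`.
bernoulli-upper : ∀ Z k → 2 * k ≤ Z → Z * (Z + 1) ^ k ≤ (Z + 2 * k) * Z ^ k
bernoulli-upper Z zero h = ≤-reflexive (cong (_* 1) (sym (+-identityʳ Z)))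
bernoulli-upper Z (suc k) h = begin
  Z * ((Z + 1) * (Z + 1) ^ k)     ≡⟨ r₁ Z (Z + 1) ((Z + 1) ^ k) ⟩
  (Z + 1) * (Z * (Z + 1) ^ k)     ≤⟨ *-monoʳ-≤ (Z + 1) (bernoulli-upper Z k h′) ⟩
  (Z + 1) * ((Z + 2 * k) * Z ^ k) ≡⟨ r₂ Z k (Z ^ k) ⟩
  (Z * (Z + 2 * k) + Z + 2 * k) * Z ^ k ≤⟨ *-monoˡ-≤ (Z ^ k) (+-monoʳ-≤ (Z * (Z + 2 * k) + Z) h′) ⟩
  (Z * (Z + 2 * k) + Z + Z) * Z ^ k ≡⟨ r₃ Z k (Z ^ k) ⟩
  (Z + 2 * suc k) * (Z * Z ^ k) ∎
  where
  open ≤-Reasoning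
  h′ : 2 * k ≤ Z
  h′ = ≤-trans (*-monoʳ-≤ 2 (n≤1+n k)) h
  r₁ : ∀ a b c → a * (b * c) ≡ b * (a * c)
  r₁ = solve-∀
  r₂ : ∀ Z k x → (Z + 1) * ((Z + 2 * k) * x) ≡ (Z * (Z + 2 * k) + Z + 2 * k) * x
  r₂ = solve-∀
  r₃ : ∀ Z k x → (Z * (Z + 2 * k) + Z + Z) * x ≡ (Z + 2 * (1 + k)) * (Z * x)
  r₃ = solve-∀

bernoulli-lower : ∀ p k → p ^ suc k + suc k * p ^ k ≤ suc p ^ suc k
bernoulli-lower p zero = ≤-reflexive (r p)
  where
  r : ∀ p → p * 1 + 1 ≡ (1 + p) * 1
  r = solve-∀
bernoulli-lower p (suc k) = begin
  p * p ^ suc k + (p ^ suc k + suc k * p ^ suc k) ≤⟨ m≤m+n _ (suc k * p ^ k) ⟩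
  p * p ^ suc k + (p ^ suc k + suc k * p ^ suc k) + suc k * p ^ k ≡⟨ r p k (p ^ k) ⟩
  suc p * (p ^ suc k + suc k * p ^ k) ≤⟨ *-monoʳ-≤ (suc p) (bernoulli-lower p k) ⟩
  suc p * suc p ^ suc k ∎
  where
  open ≤-Reasoning
  r : ∀ p k x → p * (p * x) + (p * x + (1 + k) * (p * x)) + (1 + k) * x ≡ (1 + p) * (p * x + (1 + k) * x)
  r = solve-∀

-- The second binomial term `(p + 1) p^p` is already at least the first, `p^(p + 1)`.
halving : ∀ p → 2 * p ^ suc p ≤ suc p ^ suc p
halving p = ≤-trans (≤-trans (≤-reflexive (r p (p ^ p))) (+-monoʳ-≤ (p * p ^ p) (m≤n+m (p * p ^ p) (p ^ p)))) (bernoulli-lower p p)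
  where
  r : ∀ p x → 2 * (p * x) ≡ p * x + p * x
  r = solve-∀

-- `N` contains `k` blocks of length `p + 1`, and by `halving` each block halves the power of
-- `p / (p + 1)`.
decay : ∀ p k N → suc p * k ≤ N → p ^ N * 2 ^ k ≤ suc p ^ N
decay p k N h = begin
  p ^ N * 2 ^ k                              ≡⟨ cong (λ x → p ^ x * 2 ^ k) (m+[n∸m]≡n h) ⟨
  p ^ (suc p * k + e) * 2 ^ k                ≡⟨ cong (_* 2 ^ k) (trans (^-distribˡ-+-* p (suc p * k) e) (cong (_* p ^ e) (sym (^-*-assoc p (suc p) k)))) ⟩
  (p ^ suc p) ^ k * p ^ e * 2 ^ k            ≡⟨ r ((p ^ suc p) ^ k) (p ^ e) (2 ^ k) ⟩
  2 ^ k * (p ^ suc p) ^ k * p ^ e            ≡⟨ cong (_* p ^ e) (^-distribʳ-* k 2 (p ^ suc p)) ⟨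
  (2 * p ^ suc p) ^ k * p ^ e                ≤⟨ *-mono-≤ (^-monoˡ-≤ k (halving p)) (^-monoˡ-≤ e (n≤1+n p)) ⟩
  (suc p ^ suc p) ^ k * suc p ^ e            ≡⟨ cong (_* suc p ^ e) (^-*-assoc (suc p) (suc p) k) ⟩
  suc p ^ (suc p * k) * suc p ^ e            ≡⟨ ^-distribˡ-+-* (suc p) (suc p * k) e ⟨
  suc p ^ (suc p * k + e)                    ≡⟨ cong (suc p ^_) (m+[n∸m]≡n h) ⟩
  suc p ^ N ∎
  where
  open ≤-Reasoning
  e = N ∸ suc p * k
  r : ∀ a b c → a * b * c ≡ c * a * b
  r = solve-∀

-- Turns a moment bound into the tail `Z^(-m)`: the decay `2^(-tm)` pays both for the loss `2^m` and
-- for `Z^m`.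
cancel-decay : ∀ p t m N Z x y → suc p * (t * m) ≤ N → 2 * Z ≤ 2 ^ t →
  x * suc p ^ N ≤ 2 ^ m * y * p ^ N → x * Z ^ m ≤ y
cancel-decay p t m N Z x y hN hZ h = *-cancelˡ-≤ (2 ^ m) {{m^n≢0 2 m}} (begin
  2 ^ m * (x * Z ^ m)     ≡⟨ r₁ (2 ^ m) x (Z ^ m) ⟩
  x * (2 ^ m * Z ^ m)     ≡⟨ cong (x *_) (^-distribʳ-* m 2 Z) ⟨
  x * (2 * Z) ^ m         ≤⟨ *-monoʳ-≤ x (^-monoˡ-≤ m hZ) ⟩
  x * (2 ^ t) ^ m         ≡⟨ cong (x *_) (^-*-assoc 2 t m) ⟩
  x * 2 ^ (t * m)         ≤⟨ *-cancelʳ-≤ _ _ (suc p ^ N) {{m^n≢0 (suc p) N}} big ⟩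
  2 ^ m * y ∎)
  where
  open ≤-Reasoning
  r₁ : ∀ a b c → a * (b * c) ≡ b * (a * c)
  r₁ = solve-∀
  r₂ : ∀ a b c → a * b * c ≡ a * c * b
  r₂ = solve-∀
  big : x * 2 ^ (t * m) * suc p ^ N ≤ 2 ^ m * y * suc p ^ N
  big = begin
    x * 2 ^ (t * m) * suc p ^ N        ≡⟨ r₂ x _ _ ⟩
    x * suc p ^ N * 2 ^ (t * m)        ≤⟨ *-monoˡ-≤ (2 ^ (t * m)) h ⟩
    2 ^ m * y * p ^ N * 2 ^ (t * m)    ≡⟨ *-assoc (2 ^ m * y) _ _ ⟩
    2 ^ m * y * (p ^ N * 2 ^ (t * m))  ≤⟨ *-monoʳ-≤ (2 ^ m * y) (decay p (t * m) N hN) ⟩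
    2 ^ m * y * suc p ^ N ∎

module Tail (q n : ℕ) where
  r P : ℕ
  r = suc q
  P = 2 * (q * q) + 4 * q + 1

  Ω : List (Labeling n)
  Ω = labelings q n

  ∣Ω∣ : ℕ
  ∣Ω∣ = ∏∏ {n} {n} (λ _ _ → 2 * r)

  tally : (Labeling n → Bool) → ℕ
  tally Q = ∑ₗ Ω (λ ω → ind (Q ω))

  isEdge : Label → ℕ
  isEdge nothing  = 0
  isEdge (just _) = 1

  bad good free : Label → Label → ℕ
  bad (just true)  (just true)  = 1
  bad (just false) (just false) = 1
  bad _            _            = 0
  good (just true)  (just true)  = 0
  good (just false) (just false) = 0
  good (just _)     _            = 1
  good nothing      _            = 0
  free (just _) nothing = 1
  free _        _       = 0

  bad+good : ∀ x l → bad x l + good x l ≡ isEdge x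
  bad+good nothing      _ = refl
  bad+good (just true)  (just true)  = refl
  bad+good (just true)  (just false) = refl
  bad+good (just true)  nothing      = refl
  bad+good (just false) (just true)  = refl
  bad+good (just false) (just false) = refl
  bad+good (just false) nothing      = refl

  -- Exponential moment with ratio (1 + 1/r)²: the mean of the weight of an edge,
  -- relative to r (r + 1), is 1 - 1/(2r²) = P / (1 + P).
  wt : Label → Label → ℕ
  wt x l = ((r + 1) ^ 2) ^ bad x l * (r ^ 2) ^ good x l

  wt-sum : ∀ x → ∑ₗ (labels q) (wt x) * suc P ^ isEdge x ≡ 2 * r * (r * (r + 1) * P) ^ isEdge x
  wt-sum nothing = trans (cong (_* 1) (∑ₗ-labels q (wt nothing))) (eq q)
    where
    eq : ∀ q → (q * 1 + (q * 1 + 2 * 1)) * 1 ≡ 2 * (1 + q) * 1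
    eq = solve-∀
  wt-sum (just true) = trans (cong (_* (suc P * 1)) (∑ₗ-labels q (wt (just true)))) (eq q)
    where
    eq : ∀ q → (q * (((1 + q + 1) * ((1 + q + 1) * 1)) * 1 * 1) + (q * (1 * (((1 + q) * ((1 + q) * 1)) * 1)) + 2 * (1 * (((1 + q) * ((1 + q) * 1)) * 1))))
           * ((1 + (2 * (q * q) + 4 * q + 1)) * 1)
         ≡ 2 * (1 + q) * (((1 + q) * (1 + q + 1) * (2 * (q * q) + 4 * q + 1)) * 1)
    eq = solve-∀
  wt-sum (just false) = trans (cong (_* (suc P * 1)) (∑ₗ-labels q (wt (just false)))) (eq q)
    where
    eq : ∀ q → (q * (1 * (((1 + q) * ((1 + q) * 1)) * 1)) + (q * (((1 + q + 1) * ((1 + q + 1) * 1)) * 1 * 1) + 2 * (1 * (((1 + q) * ((1 + q) * 1)) * 1))))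
           * ((1 + (2 * (q * q) + 4 * q + 1)) * 1)
         ≡ 2 * (1 + q) * (((1 + q) * (1 + q + 1) * (2 * (q * q) + 4 * q + 1)) * 1)
    eq = solve-∀

  -- In essence `(1 + 1/r)^(g - b) ≤ 2^m`, each factor being crudely at most 2; for `g ≤ b` the left
  -- side is at most 1.
  power-tradeoff : ∀ b g m → g ≤ b + m → r ^ b * (r + 1) ^ g ≤ 2 ^ m * ((r + 1) ^ b * r ^ g)
  power-tradeoff b g m h with ≤-total g b
  ... | inj₁ g≤b rewrite sym (m+[n∸m]≡n g≤b) = begin
    r ^ (g + δ) * (r + 1) ^ g           ≡⟨ cong (_* (r + 1) ^ g) (^-distribˡ-+-* r g δ) ⟩
    r ^ g * r ^ δ * (r + 1) ^ g         ≤⟨ *-monoˡ-≤ ((r + 1) ^ g) (*-monoʳ-≤ (r ^ g) (^-monoˡ-≤ δ (m≤m+n r 1))) ⟩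
    r ^ g * (r + 1) ^ δ * (r + 1) ^ g   ≡⟨ sw (r ^ g) ((r + 1) ^ δ) ((r + 1) ^ g) ⟩
    (r + 1) ^ g * (r + 1) ^ δ * r ^ g   ≡⟨ cong (_* r ^ g) (^-distribˡ-+-* (r + 1) g δ) ⟨
    (r + 1) ^ (g + δ) * r ^ g           ≤⟨ m≤n*m _ (2 ^ m) {{m^n≢0 2 m}} ⟩
    2 ^ m * ((r + 1) ^ (g + δ) * r ^ g) ∎
    where
    open ≤-Reasoning
    δ = b ∸ g
    sw : ∀ x y z → x * y * z ≡ z * y * x
    sw = solve-∀
  ... | inj₂ b≤g with m≤n⇒∃[o]m+o≡n b≤g
  ... | δ , refl = begin
    r ^ b * (r + 1) ^ (b + δ)               ≡⟨ cong (r ^ b *_) (^-distribˡ-+-* (r + 1) b δ) ⟩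
    r ^ b * ((r + 1) ^ b * (r + 1) ^ δ)     ≤⟨ *-monoʳ-≤ (r ^ b) (*-monoʳ-≤ ((r + 1) ^ b) (^-monoˡ-≤ δ r+1≤2r)) ⟩
    r ^ b * ((r + 1) ^ b * (2 * r) ^ δ)     ≡⟨ cong (λ x → r ^ b * ((r + 1) ^ b * x)) (^-distribʳ-* δ 2 r) ⟩
    r ^ b * ((r + 1) ^ b * (2 ^ δ * r ^ δ)) ≤⟨ *-monoʳ-≤ (r ^ b) (*-monoʳ-≤ ((r + 1) ^ b) (*-monoˡ-≤ (r ^ δ) (^-monoʳ-≤ 2 (+-cancelˡ-≤ b δ m h)))) ⟩
    r ^ b * ((r + 1) ^ b * (2 ^ m * r ^ δ)) ≡⟨ sw (r ^ b) ((r + 1) ^ b) (2 ^ m) (r ^ δ) ⟩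
    2 ^ m * ((r + 1) ^ b * (r ^ b * r ^ δ)) ≡⟨ cong (λ x → 2 ^ m * ((r + 1) ^ b * x)) (^-distribˡ-+-* r b δ) ⟨
    2 ^ m * ((r + 1) ^ b * r ^ (b + δ)) ∎
    where
    open ≤-Reasoning
    sw : ∀ x y z w → x * (y * (z * w)) ≡ z * (y * (x * w))
    sw = solve-∀
    r+1≤2r : r + 1 ≤ 2 * r
    r+1≤2r = +-monoʳ-≤ r (≤-trans (s≤s z≤n) (m≤m+n r 0))

  wtF-sum : ∀ x → ∑ₗ (labels q) (λ l → 2 ^ free x l) * r ^ isEdge x ≡ 2 * r * (r + 1) ^ isEdge x
  wtF-sum nothing = trans (cong (_* 1) (∑ₗ-labels q (λ l → 2 ^ free nothing l))) (eq q)
    where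
    eq : ∀ q → (q * 1 + (q * 1 + 2 * 1)) * 1 ≡ 2 * (1 + q) * 1
    eq = solve-∀
  wtF-sum (just s) = trans (cong (_* (r * 1)) (∑ₗ-labels q (λ l → 2 ^ free (just s) l))) (eq q)
    where
    eq : ∀ q → (q * 1 + (q * 1 + 2 * 2)) * ((1 + q) * 1) ≡ 2 * (1 + q) * ((1 + q + 1) * 1)
    eq = solve-∀

  Ω-total : ∑ₗ Ω (λ _ → 1) ≡ ∣Ω∣
  Ω-total = begin
    ∑ₗ Ω (λ _ → 1)                               ≡⟨ ∑ₗ-cong Ω (λ ω → sym (trans (∏∏-^ {n} {n} 1 (λ _ _ → 0)) (^-zeroˡ (∑∑ {n} {n} (λ _ _ → 0))))) ⟩
    ∑ₗ Ω (λ ω → ∏∏ {n} {n} (λ u v → 1))          ≡⟨ ∑ₗ-labelings q {n} (λ u v l → 1) ⟩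
    ∏∏ {n} {n} (λ u v → ∑ₗ (labels q) (λ _ → 1)) ≡⟨ ∏∏-cong (λ u v → trans (∑ₗ-labels q (λ _ → 1)) (eq q)) ⟩
    ∣Ω∣ ∎
    where
    open ≡-Reasoning
    eq : ∀ q → q * 1 + (q * 1 + 2 * 1) ≡ 2 * (1 + q)
    eq = solve-∀

  tally≤ : ∀ Q → tally Q ≤ ∣Ω∣
  tally≤ Q = ≤-trans (∑ₗ-mono Ω (λ ω → le (Q ω))) (≤-reflexive Ω-total)
    where
    le : ∀ b → ind b ≤ 1
    le true = ≤-refl
    le false = z≤n

  -- The exponent `h` is at the end of the range of `bernoulli-upper`, which gives
  -- `(1 + 1/r)^h ≤ 2`; then square.
  [r+1]^r : ∀ h → r ≡ 2 * h → (r + 1) ^ r ≤ 4 * r ^ r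
  [r+1]^r h e = begin
    (r + 1) ^ r         ≡⟨ cong ((r + 1) ^_) (trans e (*-comm 2 h)) ⟩
    (r + 1) ^ (h * 2)   ≡⟨ ^-*-assoc (r + 1) h 2 ⟨
    ((r + 1) ^ h) ^ 2   ≤⟨ ^-monoˡ-≤ 2 half ⟩
    (2 * r ^ h) ^ 2     ≡⟨ ^-distribʳ-* 2 2 (r ^ h) ⟩
    4 * (r ^ h) ^ 2     ≡⟨ cong (4 *_) (^-*-assoc r h 2) ⟩
    4 * r ^ (h * 2)     ≡⟨ cong (λ x → 4 * r ^ x) (trans (*-comm h 2) (sym e)) ⟩
    4 * r ^ r ∎
    where
    open ≤-Reasoning
    half : (r + 1) ^ h ≤ 2 * r ^ h
    half = *-cancelˡ-≤ r (≤-trans (bernoulli-upper r h (≤-reflexive (sym e)))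
      (≤-reflexive (trans (cong (λ x → (r + x) * r ^ h) (sym e)) (eq r (r ^ h)))))
      where
      eq : ∀ r x → (r + r) * x ≡ r * (2 * x)
      eq = solve-∀

  -- χ marks each edge of a cut with the side to which it should not be forced.
  module _ (χ : Fin n → Fin n → Label) where
    N : ℕ
    N = ∑∑ (λ u v → isEdge (χ u v))

    Bad Good Free : Labeling n → ℕ
    Bad  ω = ∑∑ (λ u v → bad (χ u v) (ω u v))
    Good ω = ∑∑ (λ u v → good (χ u v) (ω u v))
    Free ω = ∑∑ (λ u v → free (χ u v) (ω u v))

    Bad+Good : ∀ ω → Bad ω + Good ω ≡ N
    Bad+Good ω = trans (sym (trans (∑-cong (λ u → ∑-+ _ _)) (∑-+ _ _))) (∑-cong (λ u → ∑-cong (λ v → bad+good (χ u v) (ω u v))))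

    Free≤N : ∀ ω → Free ω ≤ N
    Free≤N ω = ∑-mono (λ u → ∑-mono (λ v → le (χ u v) (ω u v)))
      where
      le : ∀ x l → free x l ≤ isEdge x
      le nothing  _ = ≤-refl
      le (just _) nothing = ≤-refl
      le (just _) (just _) = z≤n

    Wt : Labeling n → ℕ
    Wt ω = ∏∏ (λ u v → wt (χ u v) (ω u v))

    Wt-sum : ∑ₗ Ω Wt * suc P ^ N ≡ ∣Ω∣ * (r * (r + 1) * P) ^ N
    Wt-sum = begin
      ∑ₗ Ω Wt * suc P ^ N
        ≡⟨ cong₂ _*_ (∑ₗ-labelings q (λ u v → wt (χ u v))) (sym (∏∏-^ (suc P) (λ u v → isEdge (χ u v)))) ⟩
      ∏∏ (λ u v → ∑ₗ (labels q) (wt (χ u v))) * ∏∏ (λ u v → suc P ^ isEdge (χ u v))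
        ≡⟨ ∏∏-* _ _ ⟨
      ∏∏ (λ u v → ∑ₗ (labels q) (wt (χ u v)) * suc P ^ isEdge (χ u v))
        ≡⟨ ∏∏-cong (λ u v → wt-sum (χ u v)) ⟩
      ∏∏ (λ u v → 2 * r * (r * (r + 1) * P) ^ isEdge (χ u v))
        ≡⟨ ∏∏-* _ _ ⟩
      ∣Ω∣ * ∏∏ (λ u v → (r * (r + 1) * P) ^ isEdge (χ u v))
        ≡⟨ cong (∣Ω∣ *_) (∏∏-^ _ (λ u v → isEdge (χ u v))) ⟩
      ∣Ω∣ * (r * (r + 1) * P) ^ N ∎
      where open ≡-Reasoning

    Wt-pow : ∀ ω → Wt ω ≡ ((r + 1) ^ 2) ^ Bad ω * (r ^ 2) ^ Good ω
    Wt-pow ω = trans (∏∏-* _ _) (cong₂ _*_ (∏∏-^ _ (λ u v → bad (χ u v) (ω u v))) (∏∏-^ _ (λ u v → good (χ u v) (ω u v))))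

    -- The normalization `r (r + 1)` is the geometric mean of the two edge weights. With fewer than
    -- `Bad ω + m` good edges, using it for every edge overestimates `Wt ω` by a factor of at most
    -- `2^m`.
    threshold : ∀ m ω → N < 2 * Bad ω + m → (r * (r + 1)) ^ N ≤ 2 ^ m * Wt ω
    threshold m ω h rewrite Wt-pow ω | sym (Bad+Good ω) = begin
      (r * (r + 1)) ^ (b + g)                                        ≡⟨ trans (^-distribʳ-* (b + g) r (r + 1)) (cong₂ _*_ (^-distribˡ-+-* r b g) (^-distribˡ-+-* (r + 1) b g)) ⟩
      r ^ b * r ^ g * ((r + 1) ^ b * (r + 1) ^ g)                    ≡⟨ sw (r ^ b) (r ^ g) ((r + 1) ^ b) ((r + 1) ^ g) ⟩
      r ^ b * (r + 1) ^ g * ((r + 1) ^ b * r ^ g)                    ≤⟨ *-monoˡ-≤ ((r + 1) ^ b * r ^ g) (power-tradeoff b g m g≤) ⟩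
      2 ^ m * ((r + 1) ^ b * r ^ g) * ((r + 1) ^ b * r ^ g)          ≡⟨ sq (2 ^ m) ((r + 1) ^ b) (r ^ g) ⟩
      2 ^ m * (((r + 1) ^ b) ^ 2 * (r ^ g) ^ 2)                      ≡⟨ cong₂ (λ x y → 2 ^ m * (x * y)) (flip-^ (r + 1) b) (flip-^ r g) ⟩
      2 ^ m * (((r + 1) ^ 2) ^ b * (r ^ 2) ^ g) ∎
      where
      open ≤-Reasoning
      b = Bad ω
      g = Good ω
      g≤ : g ≤ b + m
      g≤ = +-cancelˡ-≤ b _ _ (≤-trans (<⇒≤ h) (≤-reflexive (dbl b m)))
        where
        dbl : ∀ b m → 2 * b + m ≡ b + (b + m)
        dbl = solve-∀
      sw : ∀ x y z w → x * y * (z * w) ≡ x * w * (z * y)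
      sw = solve-∀
      sq : ∀ x y z → x * (y * z) * (y * z) ≡ x * ((y * (y * 1)) * (z * (z * 1)))
      sq = solve-∀
      flip-^ : ∀ x k → (x ^ k) ^ 2 ≡ (x ^ 2) ^ k
      flip-^ x k = trans (^-*-assoc x k 2) (trans (cong (x ^_) (*-comm k 2)) (sym (^-*-assoc x 2 k)))

    -- Markov's inequality for `Wt`. The mean of `2 * Bad` is `N (1 - 1/r)`, so the event is a
    -- deviation of about `N/r`; the extra allowance `m` is small beside it and costs only `2^m`.
    tail-bad : ∀ t m Z → suc P * (t * m) ≤ N → 2 * Z ≤ 2 ^ t →
      tally (λ ω → does (N <? 2 * Bad ω + m)) * Z ^ m ≤ ∣Ω∣
    tail-bad t m Z hN hZ = cancel-decay P t m N Z c ∣Ω∣ hN hZ (*-cancelʳ-≤ _ _ ((r * (r + 1)) ^ N) {{m^n≢0 (r * (r + 1)) N {{>-nonZero (*-mono-≤ (s≤s {n = q} z≤n) (m≤n+m 1 r))}}}} (begin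
      c * suc P ^ N * K                  ≡⟨ sw c (suc P ^ N) K ⟩
      c * K * suc P ^ N                  ≤⟨ *-monoˡ-≤ (suc P ^ N) (markov Ω Q (λ ω → 2 ^ m * Wt ω) K imp) ⟩
      ∑ₗ Ω (λ ω → 2 ^ m * Wt ω) * suc P ^ N ≡⟨ cong (_* suc P ^ N) (∑ₗ-*ˡ Ω (2 ^ m) Wt) ⟩
      2 ^ m * ∑ₗ Ω Wt * suc P ^ N        ≡⟨ *-assoc (2 ^ m) _ _ ⟩
      2 ^ m * (∑ₗ Ω Wt * suc P ^ N)      ≡⟨ cong (2 ^ m *_) Wt-sum ⟩
      2 ^ m * (∣Ω∣ * (r * (r + 1) * P) ^ N) ≡⟨ cong (λ x → 2 ^ m * (∣Ω∣ * x)) (^-distribʳ-* N (r * (r + 1)) P) ⟩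
      2 ^ m * (∣Ω∣ * (K * P ^ N))        ≡⟨ sw₂ (2 ^ m) ∣Ω∣ K (P ^ N) ⟩
      2 ^ m * ∣Ω∣ * P ^ N * K ∎))
      where
      open ≤-Reasoning
      K = (r * (r + 1)) ^ N
      Q : Labeling n → Bool
      Q ω = does (N <? 2 * Bad ω + m)
      c = tally Q
      imp : ∀ ω → Q ω ≡ true → K ≤ 2 ^ m * Wt ω
      imp ω e = threshold m ω (does-true (N <? 2 * Bad ω + m) e)
      sw : ∀ x y z → x * y * z ≡ x * z * y
      sw = solve-∀
      sw₂ : ∀ x y z w → x * (y * (z * w)) ≡ x * y * w * z
      sw₂ = solve-∀

    WtF-sum : ∑ₗ Ω (λ ω → 2 ^ Free ω) * r ^ N ≡ ∣Ω∣ * (r + 1) ^ N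
    WtF-sum = begin
      ∑ₗ Ω (λ ω → 2 ^ Free ω) * r ^ N
        ≡⟨ cong₂ _*_ (trans (∑ₗ-cong Ω (λ ω → sym (∏∏-^ 2 (λ u v → free (χ u v) (ω u v))))) (∑ₗ-labelings q (λ u v l → 2 ^ free (χ u v) l))) (sym (∏∏-^ r (λ u v → isEdge (χ u v)))) ⟩
      ∏∏ (λ u v → ∑ₗ (labels q) (λ l → 2 ^ free (χ u v) l)) * ∏∏ (λ u v → r ^ isEdge (χ u v))
        ≡⟨ ∏∏-* _ _ ⟨
      ∏∏ (λ u v → ∑ₗ (labels q) (λ l → 2 ^ free (χ u v) l) * r ^ isEdge (χ u v))
        ≡⟨ ∏∏-cong (λ u v → wtF-sum (χ u v)) ⟩
      ∏∏ (λ u v → 2 * r * (r + 1) ^ isEdge (χ u v))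
        ≡⟨ ∏∏-* _ _ ⟩
      ∣Ω∣ * ∏∏ (λ u v → (r + 1) ^ isEdge (χ u v))
        ≡⟨ cong (∣Ω∣ *_) (∏∏-^ _ (λ u v → isEdge (χ u v))) ⟩
      ∣Ω∣ * (r + 1) ^ N ∎
      where open ≡-Reasoning

    -- `N` is padded to a multiple of `r`, so that `[r+1]^r` applies to whole blocks.
    growth : ∀ h → r ≡ 2 * h → ∀ a k → r * suc a ≡ N + k → (r + 1) ^ N ≤ 4 ^ suc a * r ^ N
    growth h e a k eq = *-cancelʳ-≤ _ _ (r ^ k) {{m^n≢0 r k}} (begin
      (r + 1) ^ N * r ^ k         ≤⟨ *-monoʳ-≤ ((r + 1) ^ N) (^-monoˡ-≤ k (m≤m+n r 1)) ⟩
      (r + 1) ^ N * (r + 1) ^ k   ≡⟨ trans (sym (^-distribˡ-+-* (r + 1) N k)) (cong ((r + 1) ^_) (sym eq)) ⟩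
      (r + 1) ^ (r * suc a)       ≡⟨ ^-*-assoc (r + 1) r (suc a) ⟨
      ((r + 1) ^ r) ^ suc a       ≤⟨ ^-monoˡ-≤ (suc a) ([r+1]^r h e) ⟩
      (4 * r ^ r) ^ suc a         ≡⟨ ^-distribʳ-* (suc a) 4 (r ^ r) ⟩
      4 ^ suc a * (r ^ r) ^ suc a ≡⟨ cong (4 ^ suc a *_) (trans (^-*-assoc r r (suc a)) (trans (cong (r ^_) eq) (^-distribˡ-+-* r N k))) ⟩
      4 ^ suc a * (r ^ N * r ^ k) ≡⟨ *-assoc (4 ^ suc a) _ _ ⟨
      4 ^ suc a * r ^ N * r ^ k ∎)
      where open ≤-Reasoning

    -- The mean of `Free` is `N/r`; four times that is excluded by the moment of `2 ^ Free`. With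
    -- `a = N / r` rounded down the tail is `4^(a+1) / (2 * 16^a) = 2 / 4^a`, and a positive margin
    -- leaves room to absorb the 2.
    tail-free : ∀ h → r ≡ 2 * h → ∀ t m Z → suc P * (t * m) ≤ N → 2 * Z ≤ 2 ^ t →
      tally (λ ω → does (4 * N <? r * Free ω)) * Z ^ m ≤ ∣Ω∣
    tail-free h e t zero Z hN hZ = ≤-trans (≤-reflexive (*-identityʳ _)) (tally≤ _)
    tail-free h e t (suc m) Z hN hZ = *-cancelˡ-≤ 2 (begin
      2 * (c * Z ^ suc m)     ≡⟨ sw c (Z ^ suc m) ⟩
      c * (2 * Z ^ suc m)     ≤⟨ *-monoʳ-≤ c two ⟩
      c * 4 ^ a               ≤⟨ *-cancelʳ-≤ _ _ (2 * 4 ^ a) {{>-nonZero (*-mono-≤ (s≤s {n = 1} z≤n) (>-nonZero⁻¹ (4 ^ a) {{m^n≢0 4 a}}))}} step ⟩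
      2 * ∣Ω∣ ∎)
      where
      open ≤-Reasoning
      a = N / r
      Q : Labeling n → Bool
      Q ω = does (4 * N <? r * Free ω)
      c = tally Q
      sw : ∀ x y → 2 * (x * y) ≡ x * (2 * y)
      sw = solve-∀
      P≡ : ∀ q → 1 + (2 * (q * q) + 4 * q + 1) ≡ (1 + q) * (2 + 2 * q)
      P≡ = solve-∀
      tm≤a : t * suc m ≤ a
      tm≤a = begin
        t * suc m                   ≡⟨ m*n/n≡m (t * suc m) r ⟨
        (t * suc m) * r / r         ≤⟨ /-monoˡ-≤ r (begin
          (t * suc m) * r           ≡⟨ *-comm (t * suc m) r ⟩
          r * (t * suc m)           ≤⟨ *-monoˡ-≤ (t * suc m) (m≤m*n r (2 + 2 * q)) ⟩
          r * (2 + 2 * q) * (t * suc m) ≡⟨ cong (_* (t * suc m)) (P≡ q) ⟨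
          suc P * (t * suc m)       ≤⟨ hN ⟩
          N ∎) ⟩
        a ∎
      two : 2 * Z ^ suc m ≤ 4 ^ a
      two = begin
        2 * Z ^ suc m           ≤⟨ *-monoˡ-≤ (Z ^ suc m) (m≤m*n 2 (2 ^ m) {{m^n≢0 2 m}}) ⟩
        2 ^ suc m * Z ^ suc m   ≡⟨ ^-distribʳ-* (suc m) 2 Z ⟨
        (2 * Z) ^ suc m         ≤⟨ ^-monoˡ-≤ (suc m) hZ ⟩
        (2 ^ t) ^ suc m         ≡⟨ ^-*-assoc 2 t (suc m) ⟩
        2 ^ (t * suc m)         ≤⟨ ^-monoʳ-≤ 2 tm≤a ⟩
        2 ^ a                   ≤⟨ ^-monoˡ-≤ a (s≤s (s≤s z≤n)) ⟩
        4 ^ a ∎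
      ra≤N : r * a ≤ N
      ra≤N = ≤-trans (≤-reflexive (*-comm r a)) (m/n*n≤m N r)
      N≤ : N ≤ r * suc a
      N≤ = begin
        N                 ≡⟨ m≡m%n+[m/n]*n N r ⟩
        N % r + a * r     ≤⟨ +-monoˡ-≤ (a * r) (<⇒≤ (m%n<n N r)) ⟩
        r + a * r         ≡⟨ cong (r +_) (*-comm a r) ⟩
        r + r * a         ≡⟨ *-suc r a ⟨
        r * suc a ∎
      imp : ∀ ω → Q ω ≡ true → 2 * 16 ^ a ≤ 2 ^ Free ω
      imp ω p = begin
        2 * 16 ^ a          ≡⟨ cong (2 *_) (^-*-assoc 2 4 a) ⟩
        2 ^ suc (4 * a)     ≤⟨ ^-monoʳ-≤ 2 (*-cancelˡ-< r (4 * a) (Free ω) (≤-<-trans (≤-trans (≤-reflexive (sw₄ r a)) (*-monoʳ-≤ 4 ra≤N)) (does-true (4 * N <? r * Free ω) p))) ⟩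
        2 ^ Free ω ∎
        where
        sw₄ : ∀ r a → r * (4 * a) ≡ 4 * (r * a)
        sw₄ = solve-∀
      step : c * 4 ^ a * (2 * 4 ^ a) ≤ 2 * ∣Ω∣ * (2 * 4 ^ a)
      step = *-cancelʳ-≤ _ _ (r ^ N) {{m^n≢0 r N}} (begin
        c * 4 ^ a * (2 * 4 ^ a) * r ^ N       ≡⟨ cong (_* r ^ N) (trans (sw₅ c (4 ^ a)) (cong (λ x → c * (2 * x)) (sym (^-distribʳ-* a 4 4)))) ⟩
        c * (2 * 16 ^ a) * r ^ N              ≤⟨ *-monoˡ-≤ (r ^ N) (markov Ω Q (λ ω → 2 ^ Free ω) _ imp) ⟩
        ∑ₗ Ω (λ ω → 2 ^ Free ω) * r ^ N       ≡⟨ WtF-sum ⟩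
        ∣Ω∣ * (r + 1) ^ N                     ≤⟨ *-monoʳ-≤ ∣Ω∣ (growth h e a (r * suc a ∸ N) (sym (m+[n∸m]≡n N≤))) ⟩
        ∣Ω∣ * (4 ^ suc a * r ^ N)             ≡⟨ sw₆ ∣Ω∣ (4 ^ a) (r ^ N) ⟩
        2 * ∣Ω∣ * (2 * 4 ^ a) * r ^ N ∎)
        where
        sw₅ : ∀ c x → c * x * (2 * x) ≡ c * (2 * (x * x))
        sw₅ = solve-∀
        sw₆ : ∀ w x y → w * (4 * x * y) ≡ 2 * w * (2 * x) * y
        sw₆ = solve-∀

-- Union bound over cuts

-- A pair `A`, `B` encodes one vertex set, `A` on the left together with `B` on the right; these are
-- the edges leaving it. `margin` is the size of that set or of its complement, whichever is
-- smaller.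
cutSize : ∀ {n} → EdgeSet n → VertexSet n → VertexSet n → ℕ
cutSize H A B = e[ H ] A (∁ B) + e[ H ] (∁ A) B

order coorder margin : ∀ {n} → VertexSet n → VertexSet n → ℕ
order   A B = size A + size B
coorder A B = size (∁ A) + size (∁ B)
margin  A B = order A B ⊓ coorder A B

size-∁ : ∀ {n} (A : VertexSet n) → size A + size (∁ A) ≡ n
size-∁ {n} A = trans (sym (∑-+ _ _)) (trans (∑-cong (λ u → ind-∁ (A u))) (ones n))
  where
  ones : ∀ n → ∑ {n} (λ _ → 1) ≡ n
  ones zero    = ∑-nil _
  ones (suc n) = trans (∑-suc _) (cong suc (ones n))

order+coorder : ∀ {n} (A B : VertexSet n) → order A B + coorder A B ≡ n + n
order+coorder A B = trans (sw (size A) (size B) _ _) (cong₂ _+_ (size-∁ A) (size-∁ B))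
  where
  sw : ∀ a b c d → a + b + (c + d) ≡ a + c + (b + d)
  sw = solve-∀

cutSize≤margin : ∀ {n} {H : EdgeSet n} {d} → IsRegular H d → ∀ A B → cutSize H A B ≤ d * margin A B
cutSize≤margin {H = H} {d} reg A B with ⊓-sel (order A B) (coorder A B)
... | inj₁ e rewrite e = ≤-trans
  (+-mono-≤ {e[ H ] A (∁ B)} {d * size A} {e[ H ] (∁ A) B} {d * size B}
    (m+n≤o⇒n≤o (e[ H ] A B) (≤-reflexive (e-regularₗ {H = H} reg A B)))
    (m+n≤o⇒n≤o (e[ H ] A B) (≤-reflexive (e-regularᵣ {H = H} reg A B))))
  (≤-reflexive (sym (*-distribˡ-+ d (size A) _)))
... | inj₂ e rewrite e = ≤-trans
  (+-mono-≤ {e[ H ] A (∁ B)} {d * size (∁ B)} {e[ H ] (∁ A) B} {d * size (∁ A)}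
    (m+n≤o⇒m≤o (e[ H ] A (∁ B)) (≤-reflexive (e-regularᵣ {H = H} reg A (∁ B))))
    (m+n≤o⇒m≤o (e[ H ] (∁ A) B) (≤-reflexive (e-regularₗ {H = H} reg (∁ A) B))))
  (≤-reflexive (trans (+-comm (d * size (∁ B)) _) (sym (*-distribˡ-+ d (size (∁ A)) _))))

-- `0 ^ s` is the indicator of `s ≡ 0`. A trivial cut never fails, so its large term on the right
-- can be subtracted, which the second summand on the left does; for the other cuts the smaller
-- exponent cancels and the larger one remains.
union-term : ∀ k s s′ c W Z → s + s′ ≡ suc k → c * Z ^ (s ⊓ s′) ≤ W → (s ⊓ s′ ≡ 0 → c ≡ 0) →
  c * Z ^ suc k + W * Z ^ suc k * (0 ^ s + 0 ^ s′) ≤ W * (Z ^ s + Z ^ s′)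
union-term k zero s′ c W Z refl h z rewrite z refl = ≤-trans (≤-reflexive (*-assoc W (Z ^ suc k) 1)) (*-monoʳ-≤ W (≤-trans (≤-reflexive (*-identityʳ _)) (m≤n+m _ 1)))
union-term k (suc s) zero c W Z e h z rewrite z refl with trans (sym (+-identityʳ s)) (suc-injective e)
... | refl = ≤-trans (≤-reflexive (*-assoc W (Z ^ suc s) 1)) (*-monoʳ-≤ W (≤-trans (≤-reflexive (*-identityʳ _)) (m≤m+n _ 1)))
union-term k (suc s) (suc s′) c W Z e h z = begin
  c * Z ^ suc k + W * Z ^ suc k * 0 ≡⟨ cong (c * Z ^ suc k +_) (*-zeroʳ (W * Z ^ suc k)) ⟩
  c * Z ^ suc k + 0                 ≡⟨ +-identityʳ _ ⟩
  c * Z ^ suc k                     ≤⟨ go (≤-total (suc s) (suc s′)) ⟩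
  W * (Z ^ suc s + Z ^ suc s′) ∎
  where
  open ≤-Reasoning
  go : suc s ≤ suc s′ ⊎ suc s′ ≤ suc s → c * Z ^ suc k ≤ W * (Z ^ suc s + Z ^ suc s′)
  go (inj₁ le) = begin
    c * Z ^ suc k                ≡⟨ cong (c *_) (trans (cong (Z ^_) (sym e)) (^-distribˡ-+-* Z (suc s) (suc s′))) ⟩
    c * (Z ^ suc s * Z ^ suc s′) ≡⟨ *-assoc c _ _ ⟨
    c * Z ^ suc s * Z ^ suc s′   ≤⟨ *-mono-≤ (subst (λ x → c * Z ^ x ≤ W) (m≤n⇒m⊓n≡m le) h) (m≤n+m _ (Z ^ suc s)) ⟩
    W * (Z ^ suc s + Z ^ suc s′) ∎
  go (inj₂ le) = begin
    c * Z ^ suc k                ≡⟨ cong (c *_) (trans (cong (Z ^_) (trans (sym e) (+-comm (suc s) _))) (^-distribˡ-+-* Z (suc s′) (suc s))) ⟩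
    c * (Z ^ suc s′ * Z ^ suc s) ≡⟨ *-assoc c _ _ ⟨
    c * Z ^ suc s′ * Z ^ suc s   ≤⟨ *-mono-≤ (subst (λ x → c * Z ^ x ≤ W) (m≥n⇒m⊓n≡n le) h) (m≤m+n _ _) ⟩
    W * (Z ^ suc s + Z ^ suc s′) ∎

∑ₗ² : ∀ {n} → (VertexSet n → VertexSet n → ℕ) → ℕ
∑ₗ² {n} F = ∑ₗ (cuts n) (λ A → ∑ₗ (cuts n) (F A))

∑ₗ²-mono : ∀ {n} {F G : VertexSet n → VertexSet n → ℕ} → (∀ A B → F A B ≤ G A B) → ∑ₗ² F ≤ ∑ₗ² G
∑ₗ²-mono {n} h = ∑ₗ-mono (cuts n) (λ A → ∑ₗ-mono (cuts n) (h A))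

∑ₗ²-+ : ∀ {n} (F G : VertexSet n → VertexSet n → ℕ) → ∑ₗ² (λ A B → F A B + G A B) ≡ ∑ₗ² F + ∑ₗ² G
∑ₗ²-+ {n} F G = trans (∑ₗ-cong (cuts n) (λ A → ∑ₗ-+ (cuts n) (F A) (G A))) (∑ₗ-+ (cuts n) _ _)

∑ₗ²-*ˡ : ∀ {n} c (F : VertexSet n → VertexSet n → ℕ) → ∑ₗ² (λ A B → c * F A B) ≡ c * ∑ₗ² F
∑ₗ²-*ˡ {n} c F = trans (∑ₗ-cong (cuts n) (λ A → ∑ₗ-*ˡ (cuts n) c (F A))) (∑ₗ-*ˡ (cuts n) c _)

∑ₗ²-*ʳ : ∀ {n} c (F : VertexSet n → VertexSet n → ℕ) → ∑ₗ² (λ A B → F A B * c) ≡ ∑ₗ² F * c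
∑ₗ²-*ʳ {n} c F = trans (∑ₗ-cong (cuts n) (λ A → ∑ₗ-*ʳ (cuts n) c (F A))) (∑ₗ-*ʳ (cuts n) c _)

∑ₗ²-product : ∀ n (f g : VertexSet n → ℕ) → ∑ₗ² (λ A B → f A * g B) ≡ ∑ₗ (cuts n) f * ∑ₗ (cuts n) g
∑ₗ²-product n f g = trans (∑ₗ-cong (cuts n) (λ A → ∑ₗ-*ˡ (cuts n) (f A) g)) (∑ₗ-*ʳ (cuts n) _ f)

∑ₗ²-powers : ∀ n x → ∑ₗ² {n} (λ A B → x ^ order A B + x ^ coorder A B) ≡ 2 * (x + 1) ^ (n + n)
∑ₗ²-powers n x = begin
  ∑ₗ² {n} (λ A B → x ^ order A B + x ^ coorder A B)
    ≡⟨ ∑ₗ²-+ {n} _ _ ⟩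
  ∑ₗ² {n} (λ A B → x ^ order A B) + ∑ₗ² {n} (λ A B → x ^ coorder A B)
    ≡⟨ cong₂ _+_
         (trans (∑ₗ-cong (cuts n) (λ A → ∑ₗ-cong (cuts n) (λ B → ^-distribˡ-+-* x (size A) _))) (trans (∑ₗ²-product n _ _) (cong₂ _*_ (∑ₗ-cuts-size n x) (∑ₗ-cuts-size n x))))
         (trans (∑ₗ-cong (cuts n) (λ A → ∑ₗ-cong (cuts n) (λ B → ^-distribˡ-+-* x (size (∁ A)) _))) (trans (∑ₗ²-product n _ _) (cong₂ _*_ (∑ₗ-cuts-∁size n x) (∑ₗ-cuts-∁size n x)))) ⟩
  (x + 1) ^ n * (x + 1) ^ n + (x + 1) ^ n * (x + 1) ^ n
    ≡⟨ cong₂ _+_ (sym (^-distribˡ-+-* (x + 1) n n)) (trans (sym (^-distribˡ-+-* (x + 1) n n)) (sym (+-identityʳ _))) ⟩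
  2 * (x + 1) ^ (n + n) ∎
  where open ≡-Reasoning

-- As Z ^ (2n - margin) ≤ Z ^ order + Z ^ coorder, the sum over all cuts is a binomial sum.
union-bound : ∀ k W Z (c : VertexSet (suc k) → VertexSet (suc k) → ℕ) → 2 * (suc k + suc k) ≤ Z →
  (∀ A B → c A B * Z ^ margin A B ≤ W) → (∀ A B → margin A B ≡ 0 → c A B ≡ 0) →
  ∑ₗ² c * Z ≤ W * (8 * suc k)
union-bound k W Z c hZ h h₀ = +-cancelʳ-≤ (2 * W * Z) _ _ (*-cancelʳ-≤ _ _ T {{m^n≢0 Z 2n {{>-nonZero (≤-trans (s≤s z≤n) hZ)}}}} (begin
  (t * Z + 2 * W * Z) * T                   ≡⟨ r₁ t Z W T ⟩
  Z * (t * T + W * T * 2)                   ≡⟨ cong (λ x → Z * (t * T + W * T * x)) τ ⟨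
  Z * (t * T + W * T * ∑ₗ² {n} (λ A B → 0 ^ order A B + 0 ^ coorder A B)) ≡⟨ cong (Z *_) (cong₂ _+_ (∑ₗ²-*ʳ T c) (∑ₗ²-*ˡ {n} (W * T) _)) ⟨
  Z * (∑ₗ² {n} (λ A B → c A B * T) + ∑ₗ² {n} (λ A B → W * T * (0 ^ order A B + 0 ^ coorder A B))) ≡⟨ cong (Z *_) (∑ₗ²-+ {n} _ _) ⟨
  Z * ∑ₗ² {n} (λ A B → c A B * T + W * T * (0 ^ order A B + 0 ^ coorder A B))
    ≤⟨ *-monoʳ-≤ Z (∑ₗ²-mono (λ A B → union-term (k + suc k) (order A B) (coorder A B) (c A B) W Z (order+coorder A B) (h A B) (h₀ A B))) ⟩
  Z * ∑ₗ² {n} (λ A B → W * (Z ^ order A B + Z ^ coorder A B)) ≡⟨ cong (Z *_) (trans (∑ₗ²-*ˡ {n} W _) (cong (W *_) (∑ₗ²-powers n Z))) ⟩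
  Z * (W * (2 * (Z + 1) ^ 2n))              ≡⟨ r₂ Z W ((Z + 1) ^ 2n) ⟩
  2 * W * (Z * (Z + 1) ^ 2n)                ≤⟨ *-monoʳ-≤ (2 * W) (bernoulli-upper Z 2n hZ) ⟩
  2 * W * ((Z + 2 * 2n) * T)                ≡⟨ r₃ W Z n T ⟩
  (W * (8 * n) + 2 * W * Z) * T ∎))
  where
  open ≤-Reasoning
  n = suc k
  2n = n + n
  T = Z ^ 2n
  t = ∑ₗ² c
  -- At `0` the binomial sum counts the trivial cuts, the empty and the full one. Removing this 2
  -- leaves the excess of `(1 + 1/Z)^2n` over 1, of order `n/Z`.
  τ : ∑ₗ² {n} (λ A B → 0 ^ order A B + 0 ^ coorder A B) ≡ 2
  τ = trans (∑ₗ²-powers n 0) (cong (2 *_) (^-zeroˡ 2n))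
  r₁ : ∀ t Z W T → (t * Z + 2 * W * Z) * T ≡ Z * (t * T + W * T * 2)
  r₁ = solve-∀
  r₂ : ∀ Z W x → Z * (W * (2 * x)) ≡ 2 * W * (Z * x)
  r₂ = solve-∀
  r₃ : ∀ W Z n T → 2 * W * ((Z + 2 * (n + n)) * T) ≡ (W * (8 * n) + 2 * W * Z) * T
  r₃ = solve-∀

-- Two marks are needed: the flow condition limits forcing to opposite sides in the two directions
-- of a cut, whereas halving a cut limits forcing to the same side in both.
crossing : ∀ {n} → EdgeSet n → Bool → Bool → VertexSet n → VertexSet n → Fin n → Fin n → Label
crossing H s s′ A B u v =
  if H u v then (if A u then (if B v then nothing else just s) else (if B v then just s′ else nothing)) else nothing

module Events (q k : ℕ) (H : EdgeSet (suc k)) where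
  n = suc k

  open Tail q n public

  N-crossing : ∀ s s′ A B → N (crossing H s s′ A B) ≡ cutSize H A B
  N-crossing s s′ A B = trans (∑-cong (λ u → ∑-cong (λ v → eq (H u v) (A u) (B v)))) (∑∑-+ _ _)
    where
    eq : ∀ h a b → isEdge (if h then (if a then (if b then nothing else just s) else (if b then just s′ else nothing)) else nothing)
         ≡ ind a * (ind (not b) * ind h) + ind (not a) * (ind b * ind h)
    eq true true true = refl
    eq true true false = refl
    eq true false true = refl
    eq true false false = refl
    eq false true true = refl
    eq false true false = refl
    eq false false true = refl
    eq false false false = refl

  crossing-ext : ∀ s s′ {A A′ B B′} → (∀ u → A u ≡ A′ u) → (∀ v → B v ≡ B′ v) → ∀ u v →
    crossing H s s′ A B u v ≡ crossing H s s′ A′ B′ u v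
  crossing-ext s s′ hA hB u v rewrite hA u | hB v = refl

  deviates floods : Bool → Bool → VertexSet n → VertexSet n → Labeling n → Bool
  deviates s s′ A B ω = does (N (crossing H s s′ A B) <? 2 * Bad (crossing H s s′ A B) ω + margin A B)
  floods s s′ A B ω = does (4 * N (crossing H s s′ A B) <? r * Free (crossing H s s′ A B) ω)

  -- The mixed deviation guards `flow-condition`, the two pure ones guard the halving of cuts, and
  -- the last event limits the free edges.
  failures : VertexSet n → VertexSet n → Labeling n → ℕ
  failures A B ω = ind (deviates true false A B ω) + ind (deviates true true A B ω)
                   + ind (deviates false false A B ω) + ind (floods true true A B ω)

  failures-ext : ∀ {A A′ B B′} ω → (∀ u → A u ≡ A′ u) → (∀ v → B v ≡ B′ v) → failures A B ω ≡ failures A′ B′ ω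
  failures-ext {A} {A′} {B} {B′} ω hA hB = cong₂ _+_ (cong₂ _+_ (cong₂ _+_ (dev true false) (dev true true)) (dev false false)) (flood true true)
    where
    size-ext : ∀ {n} {A A′ : VertexSet n} → (∀ u → A u ≡ A′ u) → size A ≡ size A′
    size-ext h = ∑-cong (λ u → cong ind (h u))
    margin-ext : margin A B ≡ margin A′ B′
    margin-ext = cong₂ _⊓_ (cong₂ _+_ (size-ext hA) (size-ext hB))
      (cong₂ _+_ (size-ext (λ u → cong not (hA u))) (size-ext (λ v → cong not (hB v))))
    sums-ext : ∀ s s′ (f : Label → Label → ℕ) → ∑∑ (λ u v → f (crossing H s s′ A B u v) (ω u v)) ≡ ∑∑ (λ u v → f (crossing H s s′ A′ B′ u v) (ω u v))
    sums-ext s s′ f = ∑-cong (λ u → ∑-cong (λ v → cong (λ x → f x (ω u v)) (crossing-ext s s′ hA hB u v)))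
    dev : ∀ s s′ → ind (deviates s s′ A B ω) ≡ ind (deviates s s′ A′ B′ ω)
    dev s s′ rewrite sums-ext s s′ (λ x _ → isEdge x) | sums-ext s s′ bad | margin-ext = refl
    flood : ∀ s s′ → ind (floods s s′ A B ω) ≡ ind (floods s s′ A′ B′ ω)
    flood s s′ rewrite sums-ext s s′ (λ x _ → isEdge x) | sums-ext s s′ free = refl

  totalFailures : Labeling n → ℕ
  totalFailures ω = ∑ₗ² (λ A B → failures A B ω)

  isGood : Labeling n → Bool
  isGood ω = does (totalFailures ω ≟ 0)

  good-failures : ∀ ω → totalFailures ω ≡ 0 → ∀ A B → failures A B ω ≡ 0
  good-failures ω h A B = n≤0⇒n≡0 (begin
    failures A B ω                      ≤⟨ term≤∑-cuts n (λ B → failures A B ω) (λ B B′ e → failures-ext ω (λ _ → refl) e) B ⟩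
    ∑ₗ (cuts n) (λ B → failures A B ω)  ≤⟨ term≤∑-cuts n (λ A → ∑ₗ (cuts n) (λ B → failures A B ω)) (λ A A′ e → ∑ₗ-cong (cuts n) (λ B → failures-ext ω e (λ _ → refl))) A ⟩
    totalFailures ω                     ≡⟨ h ⟩
    0 ∎)
    where open ≤-Reasoning

  module Bound (d t Z h : ℕ) (reg : IsRegular H d) (2Z≤2^t : 2 * Z ≤ 2 ^ t) (r≡2h : r ≡ 2 * h)
    (expand : ∀ A B → suc P * (t * margin A B) ≤ cutSize H A B)
    (large : 32 * n * (r + 2) ≤ Z) where

    failCount : VertexSet n → VertexSet n → ℕ
    failCount A B = ∑ₗ Ω (failures A B)

    failCount-split : ∀ A B → failCount A B ≡
      tally (deviates true false A B) + tally (deviates true true A B) + tally (deviates false false A B) + tally (floods true true A B)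
    failCount-split A B = trans (∑ₗ-+ Ω _ _) (cong (_+ tally (floods true true A B))
      (trans (∑ₗ-+ Ω _ _) (cong (_+ tally (deviates false false A B)) (∑ₗ-+ Ω _ _))))

    expand′ : ∀ s s′ A B → suc P * (t * margin A B) ≤ N (crossing H s s′ A B)
    expand′ s s′ A B = subst (suc P * (t * margin A B) ≤_) (sym (N-crossing s s′ A B)) (expand A B)

    failCount-bound : ∀ A B → failCount A B * Z ^ margin A B ≤ 4 * ∣Ω∣
    failCount-bound A B = begin
      failCount A B * z ≡⟨ cong (_* z) (failCount-split A B) ⟩
      (c₁ + c₂ + c₃ + c₄) * z ≡⟨ dist c₁ c₂ c₃ c₄ z ⟩
      c₁ * z + (c₂ * z + (c₃ * z + (c₄ * z + 0))) ≤⟨ +-mono-≤ (dev true false) (+-mono-≤ (dev true true) (+-mono-≤ (dev false false)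
          (+-monoˡ-≤ 0 (tail-free (crossing H true true A B) h r≡2h t (margin A B) Z (expand′ true true A B) 2Z≤2^t)))) ⟩
      4 * ∣Ω∣ ∎
      where
      open ≤-Reasoning
      z = Z ^ margin A B
      c₁ = tally (deviates true false A B)
      c₂ = tally (deviates true true A B)
      c₃ = tally (deviates false false A B)
      c₄ = tally (floods true true A B)
      dev : ∀ s s′ → tally (deviates s s′ A B) * z ≤ ∣Ω∣
      dev s s′ = tail-bad (crossing H s s′ A B) t (margin A B) Z (expand′ s s′ A B) 2Z≤2^t
      dist : ∀ a b c d z → (a + b + c + d) * z ≡ a * z + (b * z + (c * z + (d * z + 0)))
      dist = solve-∀

    -- A cut of margin 0 has no edges by `cutSize≤margin`, and the strict inequalities defining the
    -- events become `0 < 0`.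
    failCount-trivial : ∀ A B → margin A B ≡ 0 → failCount A B ≡ 0
    failCount-trivial A B e = trans (∑ₗ-cong Ω zero-failures) (∑ₗ-zero Ω)
      where
      cut≡0 : ∀ s s′ → N (crossing H s s′ A B) ≡ 0
      cut≡0 s s′ = trans (N-crossing s s′ A B) (n≤0⇒n≡0 (≤-trans (cutSize≤margin {H = H} reg A B) (≤-reflexive (trans (cong (d *_) e) (*-zeroʳ d)))))
      no-dev : ∀ s s′ ω → ind (deviates s s′ A B ω) ≡ 0
      no-dev s s′ ω = cong ind (dec-false (_ <? _) (λ lt → <⇒≱ lt (≤-trans (≤-reflexive zeroes) z≤n)))
        where
        χ = crossing H s s′ A B
        Bad≡0 : Bad χ ω ≡ 0
        Bad≡0 = m+n≡0⇒m≡0 (Bad χ ω) (trans (Bad+Good χ ω) (cut≡0 s s′))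
        zeroes : 2 * Bad χ ω + margin A B ≡ 0
        zeroes rewrite Bad≡0 | e = refl
      no-flood : ∀ s s′ ω → ind (floods s s′ A B ω) ≡ 0
      no-flood s s′ ω = cong ind (dec-false (_ <? _) (λ lt → <⇒≱ lt (≤-trans (≤-reflexive zeroes) z≤n)))
        where
        χ = crossing H s s′ A B
        zeroes : r * Free χ ω ≡ 0
        zeroes = trans (cong (r *_) (n≤0⇒n≡0 (≤-trans (Free≤N χ ω) (≤-reflexive (cut≡0 s s′))))) (*-zeroʳ r)
      zero-failures : ∀ ω → failures A B ω ≡ 0
      zero-failures ω = cong₂ _+_ (cong₂ _+_ (cong₂ _+_ (no-dev true false ω) (no-dev true true ω)) (no-dev false false ω)) (no-flood true true ω)

    ∑failures : ∑ₗ Ω totalFailures ≡ ∑ₗ² failCount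
    ∑failures = trans (∑ₗ-comm Ω (cuts n) _) (∑ₗ-cong (cuts n) (λ A → ∑ₗ-comm Ω (cuts n) (λ ω B → failures A B ω)))

    -- Origin of `large`: four events per cut and the factor `8 n` of `union-bound` give a mean of
    -- at most `32 n / Z` failures.
    ∑failures-bound : ∑ₗ Ω totalFailures * (r + 2) ≤ ∣Ω∣
    ∑failures-bound = *-cancelˡ-≤ (32 * n) (begin
      32 * n * (T * (r + 2))   ≡⟨ r₁ n T r ⟩
      T * (32 * n * (r + 2))   ≤⟨ *-monoʳ-≤ T large ⟩
      T * Z                    ≡⟨ cong (_* Z) ∑failures ⟩
      ∑ₗ² failCount * Z        ≤⟨ union-bound k (4 * ∣Ω∣) Z failCount 4n≤Z failCount-bound failCount-trivial ⟩
      4 * ∣Ω∣ * (8 * n)        ≡⟨ r₂ ∣Ω∣ n ⟩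
      32 * n * ∣Ω∣ ∎)
      where
      open ≤-Reasoning
      T = ∑ₗ Ω totalFailures
      r₁ : ∀ n T r → 32 * n * (T * (r + 2)) ≡ T * (32 * n * (r + 2))
      r₁ = solve-∀
      r₂ : ∀ w n → 4 * w * (8 * n) ≡ 32 * n * w
      r₂ = solve-∀
      r₃ : ∀ n → 2 * (n + n) + 28 * n ≡ 32 * n
      r₃ = solve-∀
      4n≤Z : 2 * (n + n) ≤ Z
      4n≤Z = ≤-trans (≤-trans (m≤m+n _ (28 * n)) (≤-reflexive (r₃ n))) (≤-trans (m≤m*n (32 * n) (r + 2) {{>-nonZero (≤-trans (s≤s z≤n) (m≤n+m 2 r))}}) large)

    good-many : ∣Ω∣ * (r + 1) ≤ tally isGood * (r + 2)
    good-many = +-cancelʳ-≤ ∣Ω∣ _ _ (begin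
      ∣Ω∣ * (r + 1) + ∣Ω∣                             ≡⟨ r₁ ∣Ω∣ r ⟩
      ∣Ω∣ * (r + 2)                                   ≡⟨ cong (_* (r + 2)) (Ω-total) ⟨
      ∑ₗ Ω (λ _ → 1) * (r + 2)                        ≤⟨ *-monoˡ-≤ (r + 2) (∑ₗ-mono Ω split) ⟩
      ∑ₗ Ω (λ ω → ind (isGood ω) + totalFailures ω) * (r + 2) ≡⟨ cong (_* (r + 2)) (∑ₗ-+ Ω _ _) ⟩
      (tally isGood + ∑ₗ Ω totalFailures) * (r + 2)   ≡⟨ *-distribʳ-+ (r + 2) (tally isGood) _ ⟩
      tally isGood * (r + 2) + ∑ₗ Ω totalFailures * (r + 2) ≤⟨ +-monoʳ-≤ _ ∑failures-bound ⟩
      tally isGood * (r + 2) + ∣Ω∣ ∎)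
      where
      open ≤-Reasoning
      r₁ : ∀ w r → w * (r + 1) + w ≡ w * (r + 2)
      r₁ = solve-∀
      split : ∀ ω → 1 ≤ ind (isGood ω) + totalFailures ω
      split ω with totalFailures ω
      ... | zero  = ≤-refl
      ... | suc _ = s≤s z≤n

-- Splitting a regular graph in two

∧-trueˡ : ∀ {a b} → a ∧ b ≡ true → a ≡ true
∧-trueˡ {true} _ = refl

∧-trueʳ : ∀ {a b} → a ∧ b ≡ true → b ≡ true
∧-trueʳ {true} e = e

all⁻ : ∀ (f : X → Bool) xs → foldr (λ x b → f x ∧ b) true xs ≡ true → ∀ {x} → x ∈ xs → f x ≡ true
all⁻ f (x ∷ xs) e (here refl) = ∧-trueˡ e
all⁻ f (x ∷ xs) e (there m)   = all⁻ f xs (∧-trueʳ {f x} e) m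

all⁺ : ∀ (f : X → Bool) xs → (∀ x → f x ≡ true) → foldr (λ x b → f x ∧ b) true xs ≡ true
all⁺ f []       h = refl
all⁺ f (x ∷ xs) h = cong₂ _∧_ (h x) (all⁺ f xs h)

subset?⁻ : ∀ {n} {S M : EdgeSet n} → subset? S M ≡ true → S ⊆ₑ M
subset?⁻ {n} {S} {M} e u v s = subst (λ b → (if b then M u v else true) ≡ true) s
  (all⁻ (λ p → if S (proj₁ p) (proj₂ p) then M (proj₁ p) (proj₂ p) else true) (pairs n) e (∈-cartesianProduct⁺ (∈-allFin u) (∈-allFin v)))

subset?⁺ : ∀ {n} {S M : EdgeSet n} → S ⊆ₑ M → subset? S M ≡ true
subset?⁺ {n} {S} {M} h = all⁺ _ (pairs n) (λ p → go (proj₁ p) (proj₂ p))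
  where
  go : ∀ u v → (if S u v then M u v else true) ≡ true
  go u v with S u v in e
  ... | true  = h u v e
  ... | false = refl

allSubset?⁻ : ∀ {n d} {S M : Tuple n d} → allSubset? S M ≡ true → ∀ i → S i ⊆ₑ M i
allSubset?⁻ {d = d} {S} {M} e i = subset?⁻ {S = S i} {M i} (all⁻ (λ i → subset? (S i) (M i)) (allFin d) e (∈-allFin i))

allSubset?⁺ : ∀ {n d} {S M : Tuple n d} → (∀ i → S i ⊆ₑ M i) → allSubset? S M ≡ true
allSubset?⁺ {d = d} {S} {M} h = all⁺ _ (allFin d) (λ i → subset?⁺ {S = S i} {M i} (h i))

sum-tabulate : ∀ {n} (f : Fin n → ℕ) → sum (tabulate f) ≡ ∑ f
sum-tabulate {zero}  f = sym (∑-nil f)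
sum-tabulate {suc n} f = trans (cong (f zero +_) (sum-tabulate (f ∘ suc))) (sym (∑-suc f))

∑ₗ-allFin : ∀ {n} (f : Fin n → ℕ) → ∑ₗ (allFin n) f ≡ ∑ f
∑ₗ-allFin f = trans (cong sum (map-tabulate (λ i → i) f)) (sum-tabulate f)

∑ₗ-cartesianProduct : ∀ (xs : List X) (ys : List Y) f → ∑ₗ (cartesianProduct xs ys) f ≡ ∑ₗ xs (λ x → ∑ₗ ys (λ y → f (x , y)))
∑ₗ-cartesianProduct []       ys f = refl
∑ₗ-cartesianProduct (x ∷ xs) ys f = trans (∑ₗ-++ (map (x ,_) ys) _ f) (cong₂ _+_ (∑ₗ-map ys (x ,_) f) (∑ₗ-cartesianProduct xs ys f))

card : ∀ {n} → EdgeSet n → ℕ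
card S = ∑∑ (λ u v → ind (S u v))

∣∣ₑ≡card : ∀ {n} (S : EdgeSet n) → ∣ S ∣ₑ ≡ card S
∣∣ₑ≡card {n} S = trans (∑ₗ-cartesianProduct (allFin n) (allFin n) _)
  (trans (∑ₗ-cong (allFin n) (λ u → ∑ₗ-allFin _)) (∑ₗ-allFin _))

totalSize≡ : ∀ {n d} (S : Tuple n d) → totalSize S ≡ ∑ (λ i → card (S i))
totalSize≡ S = trans (∑ₗ-allFin _) (∑-cong (λ i → ∣∣ₑ≡card (S i)))

module _ (P : X → Bool) (g : ∀ x → P x ≡ true → Y) where
  keep : ∀ x b → P x ≡ b → List Y → List Y
  keep x true  e ys = g x e ∷ ys
  keep x false e ys = ys

  select : List X → List Y
  select []       = []
  select (x ∷ xs) = keep x (P x) refl (select xs)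

  ∑ₗ-select-≤ : ∀ xs (F : Y → ℕ) (G : X → ℕ) → (∀ x e → F (g x e) ≤ G x) → ∑ₗ (select xs) F ≤ ∑ₗ xs G
  ∑ₗ-select-≤ []       F G h = z≤n
  ∑ₗ-select-≤ (x ∷ xs) F G h = go (P x) refl
    where
    go : ∀ b (e : P x ≡ b) → ∑ₗ (keep x b e (select xs)) F ≤ G x + ∑ₗ xs G
    go true  e = +-mono-≤ (h x e) (∑ₗ-select-≤ xs F G h)
    go false e = ≤-trans (∑ₗ-select-≤ xs F G h) (m≤n+m _ (G x))

  select-count : ∀ xs → ∑ₗ (select xs) (λ _ → 1) ≡ ∑ₗ xs (λ x → ind (P x))
  select-count []       = refl
  select-count (x ∷ xs) = go (P x) refl
    where
    go : ∀ b (e : P x ≡ b) → ∑ₗ (keep x b e (select xs)) (λ _ → 1) ≡ ind b + ∑ₗ xs (λ x → ind (P x))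
    go true  e = cong suc (select-count xs)
    go false e = select-count xs

e-+ : ∀ {n} {S T U : EdgeSet n} → (∀ u v → ind (S u v) + ind (T u v) ≡ ind (U u v)) → ∀ A B → e[ S ] A B + e[ T ] A B ≡ e[ U ] A B
e-+ {S = S} {T} h A B = trans (sym (∑∑-+ _ _)) (∑-cong (λ u → ∑-cong (λ v →
  trans (fac (ind (A u)) (ind (B v)) (ind (S u v)) _) (cong (λ x → ind (A u) * (ind (B v) * x)) (h u v)))))
  where
  fac : ∀ x y l f → x * (y * l) + x * (y * f) ≡ x * (y * (l + f))
  fac = solve-∀

ind-mono : ∀ {a b} → (a ≡ true → b ≡ true) → ind a ≤ ind b
ind-mono {false} h = z≤n
ind-mono {true}  h rewrite h refl = ≤-refl

cutSize-mono : ∀ {n} {S T : EdgeSet n} → S ⊆ₑ T → ∀ A B → cutSize S A B ≤ cutSize T A B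
cutSize-mono {S = S} {T} h A B = +-mono-≤ (e-mono A (∁ B)) (e-mono (∁ A) B)
  where
  e-mono : ∀ A B → e[ S ] A B ≤ e[ T ] A B
  e-mono A B = ∑-mono (λ u → ∑-mono (λ v → *-monoʳ-≤ (ind (A u)) (*-monoʳ-≤ (ind (B v)) (ind-mono (h u v)))))

-- If the complement is the smaller set, the difference of the sizes is read off the complements.
-- This controls the rounding of odd degrees in `flow-condition`.
order≤ : ∀ {n} (A B : VertexSet n) → size A ≤ size B + margin A B
order≤ A B with ⊓-sel (order A B) (coorder A B)
... | inj₁ e rewrite e = ≤-trans (m≤m+n _ (size B)) (m≤n+m _ (size B))
... | inj₂ e rewrite e = +-cancelʳ-≤ (size (∁ A)) _ _ (begin
  size A + size (∁ A)                           ≡⟨ trans (size-∁ A) (sym (size-∁ B)) ⟩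
  size B + size (∁ B)                           ≤⟨ +-monoʳ-≤ (size B) (≤-trans (m≤n+m _ (size (∁ A))) (m≤m+n _ (size (∁ A)))) ⟩
  size B + (size (∁ A) + size (∁ B) + size (∁ A)) ≡⟨ +-assoc (size B) _ _ ⟨
  size B + (size (∁ A) + size (∁ B)) + size (∁ A) ∎)
  where open ≤-Reasoning

isSide : Bool → Label → Bool
isSide true  (just true)  = true
isSide false (just false) = true
isSide _     _            = false

isFree : Label → Bool
isFree nothing  = true
isFree (just _) = false

-- `cut` and `cut′` say that each half keeps a proportion of at least `1/2 - 4/r` of every cut.
record Splitting {n} (r d₁ d₂ : ℕ) (H : EdgeSet n) : Set where
  field
    M       : EdgeSet n
    M⊆H     : M ⊆ₑ H
    regular : IsRegular M d₁
    regular′ : IsRegular (H ∖ M) d₂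
    cut     : ∀ A B → r * cutSize H A B ≤ 2 * r * cutSize M A B + 8 * cutSize H A B
    cut′    : ∀ A B → r * cutSize H A B ≤ 2 * r * cutSize (H ∖ M) A B + 8 * cutSize H A B

∖-intro : ∀ {n} {S H M : EdgeSet n} → S ⊆ₑ H → (∀ u v → S u v ≡ true → M u v ≡ true → ⊥) → S ⊆ₑ (H ∖ M)
∖-intro {M = M} S⊆H dis u v e with M u v in f
... | true  = ⊥-elim (dis u v e f)
... | false = cong (_∧ true) (S⊆H u v e)

ind≤ : ∀ b {x} → (b ≡ true → 1 ≤ x) → ind b ≤ x
ind≤ false h = z≤n
ind≤ true  h = h refl

-- `s` and `t` tell whether the edge is wanted in the first and in the second half; only a label
-- forcing it the other way is excluded.
allowed : Bool → Bool → Label → ℕ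
allowed s t l = ind ((if s then not (isSide false l) else true) ∧ (if t then not (isSide true l) else true))

allowed-one : ∀ s t l → (s ≡ true → isSide false l ≡ true → ⊥) → (t ≡ true → isSide true l ≡ true → ⊥) → allowed s t l ≡ 1
allowed-one s t l hs ht = cong ind (cong₂ _∧_ (go s (isSide false l) hs) (go t (isSide true l) ht))
  where
  go : ∀ s b → (s ≡ true → b ≡ true → ⊥) → (if s then not b else true) ≡ true
  go false b     h = refl
  go true  false h = refl
  go true  true  h = ⊥-elim (h refl refl)

conditioning-nonempty : ∀ w ℓ r → 1 ≤ w → w * (r + 1) ≤ ℓ * (r + 2) → 0 < ℓ
conditioning-nonempty w zero    r w≥1 h = ⊥-elim (<⇒≱ (*-mono-≤ w≥1 (m≤n+m 1 r)) h)
conditioning-nonempty w (suc ℓ) r w≥1 h = s≤s z≤n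

-- Conditioning on the good labelings costs a factor (r + 2) / (r + 1), absorbed by
-- the bound of a single edge; the empty event is treated separately.
conditioning-spread : ∀ c κ r w ℓ → c ≤ ℓ → c * (2 * r) ^ κ ≤ (r + 1) ^ κ * w → w * (r + 1) ≤ ℓ * (r + 2) →
  c * (2 * r) ^ κ ≤ (r + 2) ^ κ * ℓ
conditioning-spread c zero    r w ℓ c≤ℓ bound many = ≤-trans (≤-reflexive (*-identityʳ c)) (≤-trans c≤ℓ (≤-reflexive (sym (*-identityˡ ℓ))))
conditioning-spread c (suc κ) r w ℓ c≤ℓ bound many = begin
  c * (2 * r) ^ suc κ           ≤⟨ bound ⟩
  (r + 1) ^ suc κ * w           ≡⟨ eq (r + 1) ((r + 1) ^ κ) w ⟩
  (r + 1) ^ κ * (w * (r + 1))   ≤⟨ *-mono-≤ (^-monoˡ-≤ κ (+-monoʳ-≤ r (s≤s z≤n))) many ⟩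
  (r + 2) ^ κ * (ℓ * (r + 2))   ≡⟨ eq′ (r + 2) ((r + 2) ^ κ) ℓ ⟩
  (r + 2) ^ suc κ * ℓ ∎
  where
  open ≤-Reasoning
  eq : ∀ x y w → x * y * w ≡ y * (w * x)
  eq = solve-∀
  eq′ : ∀ x y w → y * (w * x) ≡ x * y * w
  eq′ = solve-∀

module SplitGood (q k : ℕ) (H : EdgeSet (suc k)) (d θ : ℕ) (θ≤1 : θ ≤ 1) (reg : IsRegular H (d + (d + θ))) where
  open Events q k H public

  module _ (ω : Labeling n) where
    side : Bool → EdgeSet n
    side s u v = H u v ∧ isSide s (ω u v)

    freeEdges : EdgeSet n
    freeEdges u v = H u v ∧ isFree (ω u v)

    Bad-e : ∀ s s′ A B → Bad (crossing H s s′ A B) ω ≡ e[ side s ] A (∁ B) + e[ side s′ ] (∁ A) B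
    Bad-e s s′ A B = trans (∑-cong (λ u → ∑-cong (λ v → eq (H u v) (A u) (B v) (ω u v)))) (∑∑-+ _ _)
      where
      one : ∀ s l → bad (just s) l ≡ ind (isSide s l)
      one true (just true) = refl
      one true (just false) = refl
      one true nothing = refl
      one false (just true) = refl
      one false (just false) = refl
      one false nothing = refl
      eq : ∀ h a b l → bad (if h then (if a then (if b then nothing else just s) else (if b then just s′ else nothing)) else nothing) l
         ≡ ind a * (ind (not b) * ind (h ∧ isSide s l)) + ind (not a) * (ind b * ind (h ∧ isSide s′ l))
      eq true true true l = refl
      eq true true false l rewrite one s l = un (ind (isSide s l))
        where
        un : ∀ x → x ≡ x + 0 + 0 + 0
        un = solve-∀
      eq true false true l rewrite one s′ l = un (ind (isSide s′ l))
        where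
        un : ∀ x → x ≡ x + 0 + 0
        un = solve-∀
      eq true false false l = refl
      eq false true true l = refl
      eq false true false l = refl
      eq false false true l = refl
      eq false false false l = refl

    Free-e : ∀ s s′ A B → Free (crossing H s s′ A B) ω ≡ cutSize freeEdges A B
    Free-e s s′ A B = trans (∑-cong (λ u → ∑-cong (λ v → eq (H u v) (A u) (B v) (ω u v)))) (∑∑-+ _ _)
      where
      eq : ∀ h a b l → free (if h then (if a then (if b then nothing else just s) else (if b then just s′ else nothing)) else nothing) l
         ≡ ind a * (ind (not b) * ind (h ∧ isFree l)) + ind (not a) * (ind b * ind (h ∧ isFree l))
      eq true true true l = refl
      eq true true false nothing = refl
      eq true true false (just _) = refl
      eq true false true nothing = refl
      eq true false true (just _) = refl
      eq true false false l = refl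
      eq false true true l = refl
      eq false true false l = refl
      eq false false true l = refl
      eq false false false l = refl

    side⊆H : ∀ s → side s ⊆ₑ H
    side⊆H s u v e = ∧-trueˡ e

    partition : ∀ u v → ind (side true u v) + ind ((H ∖ side true) u v) ≡ ind (H u v)
    partition = ind-∖ {M = side true} {H} (side⊆H true)

    true⊆ : side true ⊆ₑ (H ∖ side false)
    true⊆ u v e with H u v | ω u v
    ... | true | just true = refl

    module _ (good : totalFailures ω ≡ 0) (A B : VertexSet n) where
      private
        no-failure : failures A B ω ≡ 0
        no-failure = good-failures ω good A B
        C = cutSize H A B
        does-ind : ∀ {P : Set} (p : Dec P) → ind (does p) ≡ 0 → ¬ P
        does-ind (no ¬p) _ = ¬p
        f₁ = ind (deviates true false A B ω)
        f₂ = ind (deviates true true A B ω)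
        f₃ = ind (deviates false false A B ω)
        within : ∀ s s′ → ind (deviates s s′ A B ω) ≡ 0 → 2 * (e[ side s ] A (∁ B) + e[ side s′ ] (∁ A) B) + margin A B ≤ C
        within s s′ e = subst₂ (λ x y → 2 * x + margin A B ≤ y) (Bad-e s s′ A B) (N-crossing s s′ A B) (≮⇒≥ (does-ind (_ <? _) e))

      -- Only this bound keeps the `margin` built into `deviates`: it pays for the odd unit `θ` of
      -- the degree.
      skew-bound : 2 * (e[ side true ] A (∁ B) + e[ side false ] (∁ A) B) + margin A B ≤ C
      skew-bound = within true false (m+n≡0⇒m≡0 f₁ (m+n≡0⇒m≡0 (f₁ + f₂) (m+n≡0⇒m≡0 (f₁ + f₂ + f₃) no-failure)))

      true-bound : 2 * cutSize (side true) A B ≤ C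
      true-bound = m+n≤o⇒m≤o _ (within true true (m+n≡0⇒n≡0 f₁ (m+n≡0⇒m≡0 (f₁ + f₂) (m+n≡0⇒m≡0 (f₁ + f₂ + f₃) no-failure))))

      false-bound : 2 * cutSize (side false) A B ≤ C
      false-bound = m+n≤o⇒m≤o _ (within false false (m+n≡0⇒n≡0 (f₁ + f₂) (m+n≡0⇒m≡0 (f₁ + f₂ + f₃) no-failure)))

      free-bound : r * cutSize freeEdges A B ≤ 4 * C
      free-bound = subst₂ (λ x y → r * x ≤ 4 * y) (Free-e true true A B) (N-crossing true true A B)
        (≮⇒≥ (does-ind (_ <? _) (m+n≡0⇒n≡0 (f₁ + f₂ + f₃) no-failure)))

      cut-partition : cutSize (side true) A B + cutSize (side false) A B + cutSize freeEdges A B ≡ C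
      cut-partition = trans (sw (e[ side true ] A (∁ B)) _ (e[ side false ] A (∁ B)) _ (e[ freeEdges ] A (∁ B)) _)
        (cong₂ _+_ (parts A (∁ B)) (parts (∁ A) B))
        where
        sw : ∀ a a′ b b′ c c′ → (a + a′) + (b + b′) + (c + c′) ≡ (a + (b + c)) + (a′ + (b′ + c′))
        sw = solve-∀
        eq₁ : ∀ h l → ind (h ∧ isSide false l) + ind (h ∧ isFree l) ≡ ind (h ∧ not (h ∧ isSide true l))
        eq₁ false l = refl
        eq₁ true (just true) = refl
        eq₁ true (just false) = refl
        eq₁ true nothing = refl
        parts : ∀ A B → e[ side true ] A B + (e[ side false ] A B + e[ freeEdges ] A B) ≡ e[ H ] A B
        parts A B = trans (cong (e[ side true ] A B +_) (e-+ {S = side false} {freeEdges} {H ∖ side true} (λ u v → eq₁ (H u v) (ω u v)) A B))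
          (e-+ {S = side true} {H ∖ side true} {H} partition A B)

      -- The other side takes at most half of the cut and the free edges at most `4 C / r`; the rest
      -- is forced to `s`.
      side-cut : ∀ s → r * C ≤ 2 * r * cutSize (side s) A B + 8 * C
      side-cut s = +-cancelʳ-≤ (r * C) _ _ (begin
        r * C + r * C           ≡⟨ cong (λ x → r * x + r * x) cut-partition ⟨
        r * (t + f + g) + r * (t + f + g) ≡⟨ eq r t f g ⟩
        r * (2 * t) + r * (2 * f) + 2 * (r * g) ≤⟨ +-monoʳ-≤ (r * (2 * t) + r * (2 * f)) (*-monoʳ-≤ 2 free-bound) ⟩
        r * (2 * t) + r * (2 * f) + 2 * (4 * C) ≤⟨ pick s ⟩
        2 * r * cutSize (side s) A B + 8 * C + r * C ∎)
        where
        open ≤-Reasoning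
        t = cutSize (side true) A B
        f = cutSize (side false) A B
        g = cutSize freeEdges A B
        eq : ∀ r t f g → r * (t + f + g) + r * (t + f + g) ≡ r * (2 * t) + r * (2 * f) + 2 * (r * g)
        eq = solve-∀
        eqt : ∀ r t f c → r * (2 * t) + f + 2 * (4 * c) ≡ 2 * r * t + 8 * c + f
        eqt = solve-∀
        eqf : ∀ r t f c → t + r * (2 * f) + 2 * (4 * c) ≡ 2 * r * f + 8 * c + t
        eqf = solve-∀
        pick : ∀ s → r * (2 * t) + r * (2 * f) + 2 * (4 * C) ≤ 2 * r * cutSize (side s) A B + 8 * C + r * C
        pick true  = ≤-trans (≤-reflexive (eqt r t _ C)) (+-monoʳ-≤ (2 * r * t + 8 * C) (*-monoʳ-≤ r false-bound))
        pick false = ≤-trans (≤-reflexive (eqf r _ f C)) (+-monoʳ-≤ (2 * r * f + 8 * C) (*-monoʳ-≤ r true-bound))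

      -- By regularity the two directions of the cut differ by the degree times `size A - size B`.
      -- Inserted in `skew-bound`, this gives the claim up to `θ * (size A - size B)`, which the
      -- margin covers by `order≤`.
      flow-condition : e[ side true ] A (∁ B) + d * size B ≤ d * size A + e[ H ∖ side false ] (∁ A) B
      flow-condition = *-cancelˡ-≤ 2 (+-cancelʳ-≤ (margin A B + θ * size B + 2 * w) _ _ (begin
        2 * (x + d * b) + (μ + θ * b + 2 * w)      ≡⟨ eq₁ x w d b μ (θ * b) ⟩
        2 * (x + w) + μ + (2 * (d * b) + θ * b)    ≤⟨ +-monoˡ-≤ (2 * (d * b) + θ * b) skew-bound ⟩
        x̂ + ŷ + (2 * (d * b) + θ * b)              ≡⟨ cong (x̂ + ŷ +_) (eq₂ d θ b) ⟩
        x̂ + ŷ + (d + (d + θ)) * b                  ≡⟨ cong (x̂ + ŷ +_) (e-regularᵣ {H = H} reg A B) ⟨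
        x̂ + ŷ + (g + ŷ)                            ≡⟨ eq₃ x̂ ŷ g ⟩
        (g + x̂) + 2 * ŷ                            ≡⟨ cong (_+ 2 * ŷ) (e-regularₗ {H = H} reg A B) ⟩
        (d + (d + θ)) * a + 2 * ŷ                  ≡⟨ cong₂ (λ x y → x + 2 * y) (sym (eq₂ d θ a)) (sym y-split) ⟩
        2 * (d * a) + θ * a + 2 * (w + z)          ≤⟨ +-monoˡ-≤ (2 * (w + z)) (+-monoʳ-≤ (2 * (d * a)) θa) ⟩
        2 * (d * a) + (μ + θ * b) + 2 * (w + z)    ≡⟨ eq₄ (d * a) (μ + θ * b) w z ⟩
        2 * (d * a + z) + (μ + θ * b + 2 * w) ∎))
        where
        open ≤-Reasoning
        a = size A
        b = size B
        μ = margin A B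
        x = e[ side true ] A (∁ B)
        w = e[ side false ] (∁ A) B
        z = e[ H ∖ side false ] (∁ A) B
        g = e[ H ] A B
        x̂ = e[ H ] A (∁ B)
        ŷ = e[ H ] (∁ A) B
        y-split : w + z ≡ ŷ
        y-split = e-+ {S = side false} {H ∖ side false} {H} (ind-∖ {M = side false} {H} (side⊆H false)) (∁ A) B
        θa : θ * a ≤ μ + θ * b
        θa = begin
          θ * a           ≤⟨ *-monoʳ-≤ θ (order≤ A B) ⟩
          θ * (b + μ)     ≡⟨ *-distribˡ-+ θ b μ ⟩
          θ * b + θ * μ   ≤⟨ +-monoʳ-≤ (θ * b) (≤-trans (*-monoˡ-≤ μ θ≤1) (≤-reflexive (*-identityˡ μ))) ⟩
          θ * b + μ       ≡⟨ +-comm (θ * b) μ ⟩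
          μ + θ * b ∎
        eq₁ : ∀ x w d b m t → 2 * (x + d * b) + (m + t + 2 * w) ≡ 2 * (x + w) + m + (2 * (d * b) + t)
        eq₁ = solve-∀
        eq₂ : ∀ d θ b → 2 * (d * b) + θ * b ≡ (d + (d + θ)) * b
        eq₂ = solve-∀
        eq₃ : ∀ x y g → x + y + (g + y) ≡ (g + x) + 2 * y
        eq₃ = solve-∀
        eq₄ : ∀ a t w z → 2 * a + t + 2 * (w + z) ≡ 2 * (a + z) + (t + 2 * w)
        eq₄ = solve-∀

    module Build (good : totalFailures ω ≡ 0) where
      factored : ∃ λ M → side true ⊆ₑ M × M ⊆ₑ (H ∖ side false) × IsRegular M d
      factored = factor (side true) (H ∖ side false) d true⊆ (flow-condition good)

      F : EdgeSet n
      F = proj₁ factored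

      true⊆F : side true ⊆ₑ F
      true⊆F = proj₁ (proj₂ factored)

      F⊆¬false : F ⊆ₑ (H ∖ side false)
      F⊆¬false = proj₁ (proj₂ (proj₂ factored))

      F-regular : IsRegular F d
      F-regular = proj₂ (proj₂ (proj₂ factored))

      F⊆H : F ⊆ₑ H
      F⊆H u v e = ∖-⊆ H (side false) u v (F⊆¬false u v e)

      false⊆ : side false ⊆ₑ (H ∖ F)
      false⊆ = ∖-intro (side⊆H false) (λ u v e f → ∖-∉ H (side false) (F⊆¬false u v f) e)

      splitting : Splitting r d (d + θ) H
      splitting = record
        { M = F ; M⊆H = F⊆H ; regular = F-regular
        ; regular′ = ∖-regular {M = F} {H} {d} F⊆H reg F-regular
        ; cut = λ A B → ≤-trans (side-cut good A B true) (+-monoˡ-≤ _ (*-monoʳ-≤ (2 * r) (cutSize-mono {S = side true} {F} true⊆F A B)))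
        ; cut′ = λ A B → ≤-trans (side-cut good A B false) (+-monoˡ-≤ _ (*-monoʳ-≤ (2 * r) (cutSize-mono {S = side false} {H ∖ F} false⊆ A B)))
        }

  splittingOf : ∀ ω → isGood ω ≡ true → Splitting r d (d + θ) H
  splittingOf ω e = Build.splitting ω (does-true (totalFailures ω ≟ 0) e)

  splittings : List (Splitting r d (d + θ) H)
  splittings = select isGood splittingOf Ω

  realizes : EdgeSet n → EdgeSet n → Splitting r d (d + θ) H → Bool
  realizes S T sp = subset? S (Splitting.M sp) ∧ subset? T (H ∖ Splitting.M sp)

  -- An edge required on both sides must be free, which is even rarer than the bound needs.
  allowed-sum : ∀ s t → ∑ₗ (labels q) (allowed s t) * (2 * r) ^ (ind s + ind t) ≤ (r + 1) ^ (ind s + ind t) * (2 * r)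
  allowed-sum s t = ≤-trans (≤-reflexive (cong (_* (2 * r) ^ (ind s + ind t)) (∑ₗ-labels q (allowed s t)))) (go s t)
    where
    go : ∀ s t → (q * allowed s t (just true) + (q * allowed s t (just false) + 2 * allowed s t nothing)) * (2 * r) ^ (ind s + ind t)
      ≤ (r + 1) ^ (ind s + ind t) * (2 * r)
    go false false = ≤-reflexive (eq q)
      where
      eq : ∀ q → (q * 1 + (q * 1 + 2 * 1)) * 1 ≡ 1 * (2 * (1 + q))
      eq = solve-∀
    go true false = ≤-reflexive (eq q)
      where
      eq : ∀ q → (q * 1 + (q * 0 + 2 * 1)) * (2 * (1 + q) * 1) ≡ (1 + q + 1) * 1 * (2 * (1 + q))
      eq = solve-∀
    go false true = ≤-reflexive (eq q)
      where
      eq : ∀ q → (q * 0 + (q * 1 + 2 * 1)) * (2 * (1 + q) * 1) ≡ (1 + q + 1) * 1 * (2 * (1 + q))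
      eq = solve-∀
    go true true = ≤-trans (m≤m+n _ (q * q * (2 * (1 + q)))) (≤-reflexive (eq q))
      where
      eq : ∀ q → (q * 0 + (q * 0 + 2 * 1)) * (2 * (1 + q) * (2 * (1 + q) * 1)) + q * q * (2 * (1 + q)) ≡ (1 + q + 1) * ((1 + q + 1) * 1) * (2 * (1 + q))
      eq = solve-∀

  -- The factor `F` may depend on all labels at once, but it lies between `side true` and
  -- `H ∖ side false`; so a realized demand contradicts no label, which is a product event.
  realizes-allowed : ∀ S T ω e → ind (realizes S T (splittingOf ω e)) ≤ ∏∏ (λ u v → allowed (S u v) (T u v) (ω u v))
  realizes-allowed S T ω e = ind≤ (realizes S T (splittingOf ω e)) (λ ρ → ≤-trans
    (≤-reflexive (sym (trans (∏∏-^ {n} {n} 1 (λ _ _ → 0)) (^-zeroˡ (∑∑ {n} {n} (λ _ _ → 0))))))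
    (∏∏-mono (λ u v → ≤-reflexive (sym (allowed-one (S u v) (T u v) (ω u v) (onS ρ u v) (onT ρ u v))))))
    where
    open Build ω (does-true (totalFailures ω ≟ 0) e)
    onS : realizes S T (splittingOf ω e) ≡ true → ∀ u v → S u v ≡ true → isSide false (ω u v) ≡ true → ⊥
    onS ρ u v s l = ∖-∉ H (side ω false) (F⊆¬false u v Fuv) (cong₂ _∧_ (F⊆H u v Fuv) l)
      where
      Fuv : F u v ≡ true
      Fuv = subset?⁻ {S = S} {F} (∧-trueˡ ρ) u v s
    onT : realizes S T (splittingOf ω e) ≡ true → ∀ u v → T u v ≡ true → isSide true (ω u v) ≡ true → ⊥
    onT ρ u v t l = ∖-∉ H F Tuv (true⊆F u v (cong₂ _∧_ (∖-⊆ H F u v Tuv) l))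
      where
      Tuv : (H ∖ F) u v ≡ true
      Tuv = subset?⁻ {S = T} {H ∖ F} (∧-trueʳ {subset? S F} ρ) u v t

  realize-count : ∀ S T → ∑ₗ splittings (λ sp → ind (realizes S T sp)) * (2 * r) ^ (card S + card T) ≤ (r + 1) ^ (card S + card T) * ∣Ω∣
  realize-count S T = begin
    ∑ₗ splittings (λ sp → ind (realizes S T sp)) * (2 * r) ^ κ
      ≤⟨ *-monoˡ-≤ ((2 * r) ^ κ) (∑ₗ-select-≤ isGood splittingOf Ω _ _ (realizes-allowed S T)) ⟩
    ∑ₗ Ω (λ ω → ∏∏ (λ u v → allowed (S u v) (T u v) (ω u v))) * (2 * r) ^ κ
      ≡⟨ cong₂ _*_ (∑ₗ-labelings q (λ u v → allowed (S u v) (T u v))) (pow (2 * r)) ⟩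
    ∏∏ (λ u v → ∑ₗ (labels q) (allowed (S u v) (T u v))) * ∏∏ (λ u v → (2 * r) ^ (ind (S u v) + ind (T u v)))
      ≡⟨ ∏∏-* _ _ ⟨
    ∏∏ (λ u v → ∑ₗ (labels q) (allowed (S u v) (T u v)) * (2 * r) ^ (ind (S u v) + ind (T u v)))
      ≤⟨ ∏∏-mono (λ u v → allowed-sum (S u v) (T u v)) ⟩
    ∏∏ (λ u v → (r + 1) ^ (ind (S u v) + ind (T u v)) * (2 * r))
      ≡⟨ ∏∏-* _ _ ⟩
    ∏∏ (λ u v → (r + 1) ^ (ind (S u v) + ind (T u v))) * ∣Ω∣
      ≡⟨ cong (_* ∣Ω∣) (pow (r + 1)) ⟨
    (r + 1) ^ κ * ∣Ω∣ ∎
    where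
    open ≤-Reasoning
    κ = card S + card T
    pow : ∀ x → x ^ κ ≡ ∏∏ (λ u v → x ^ (ind (S u v) + ind (T u v)))
    pow x = trans (cong (x ^_) (sym (∑∑-+ _ _))) (sym (∏∏-^ x (λ u v → ind (S u v) + ind (T u v))))

  module _ (many : ∣Ω∣ * (r + 1) ≤ tally isGood * (r + 2)) where
    ℓ : ℕ
    ℓ = ∑ₗ splittings (λ _ → 1)

    many′ : ∣Ω∣ * (r + 1) ≤ ℓ * (r + 2)
    many′ = subst (λ x → ∣Ω∣ * (r + 1) ≤ x * (r + 2)) (sym (select-count isGood splittingOf Ω)) many

    splittings-nonempty : 0 < ℓ
    splittings-nonempty = conditioning-nonempty ∣Ω∣ ℓ r Ω>0 many′
      where
      Ω>0 : 1 ≤ ∣Ω∣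
      Ω>0 = ≤-trans (≤-reflexive (sym (trans (∏∏-^ {n} {n} 1 (λ _ _ → 0)) (^-zeroˡ (∑∑ {n} {n} (λ _ _ → 0)))))) (∏∏-mono {n} {n} {λ _ _ → 1} (λ u v → s≤s z≤n))

    splittings-spread : ∀ S T → ∑ₗ splittings (λ sp → ind (realizes S T sp)) * (2 * r) ^ (card S + card T) ≤ (r + 2) ^ (card S + card T) * ℓ
    splittings-spread S T = conditioning-spread _ (card S + card T) r ∣Ω∣ ℓ
      (∑ₗ-mono splittings (λ sp → ind≤1 (realizes S T sp))) (realize-count S T) many′

-- Finite distributions and spread

abstract
  ι : ℕ → ℚ
  ι = ℕ→ℚ

  ι≡ : ∀ k → ι k ≡ ℕ→ℚ k
  ι≡ k = refl

  private
    frac : ∀ k → ℚ.toℚᵘ (ι k) ℚᵘ.≃ ℚᵘ.mkℚᵘ (ℤ.+ k) 0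
    frac k = ℚ.toℚᵘ-fromℚᵘ (ℚᵘ.mkℚᵘ (ℤ.+ k) 0)

  ι-+ : ∀ a b → ι (a + b) ≡ ι a ℚ.+ ι b
  ι-+ a b = ℚ.toℚᵘ-injective (ℚᵘ.≃-trans (frac (a + b)) (ℚᵘ.≃-trans (ℚᵘ.*≡* eq)
    (ℚᵘ.≃-sym (ℚᵘ.≃-trans (ℚ.toℚᵘ-homo-+ (ι a) (ι b)) (ℚᵘ.+-cong (frac a) (frac b))))))
    where
    eq : ℤ.+ (a + b) ℤ.* ℤ.+ 1 ≡ (ℤ.+ a ℤ.* ℤ.+ 1 ℤ.+ ℤ.+ b ℤ.* ℤ.+ 1) ℤ.* ℤ.+ 1
    eq rewrite ℤ.*-identityʳ (ℤ.+ a) | ℤ.*-identityʳ (ℤ.+ b) = refl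

  ι-* : ∀ a b → ι (a * b) ≡ ι a ℚ.* ι b
  ι-* a b = ℚ.toℚᵘ-injective (ℚᵘ.≃-trans (frac (a * b)) (ℚᵘ.≃-trans (ℚᵘ.*≡* (cong (ℤ._* ℤ.+ 1) (ℤ.pos-* a b)))
    (ℚᵘ.≃-sym (ℚᵘ.≃-trans (ℚ.toℚᵘ-homo-* (ι a) (ι b)) (ℚᵘ.*-cong (frac a) (frac b))))))

  ι-mono : ∀ {a b} → a ≤ b → ι a ℚ.≤ ι b
  ι-mono {a} {b} h = ℚ.toℚᵘ-cancel-≤ (ℚᵘ.≤-trans (ℚᵘ.≤-reflexive (frac a)) (ℚᵘ.≤-trans
    (ℚᵘ.*≤* (ℤ.*-monoʳ-≤-nonNeg (ℤ.+ 1) (ℤ.+≤+ h))) (ℚᵘ.≤-reflexive (ℚᵘ.≃-sym (frac b)))))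

  ι-cancel : ∀ {a b} → ι a ℚ.≤ ι b → a ≤ b
  ι-cancel {a} {b} h with ℚᵘ.≤-trans (ℚᵘ.≤-reflexive (ℚᵘ.≃-sym (frac a))) (ℚᵘ.≤-trans (ℚ.toℚᵘ-mono-≤ h) (ℚᵘ.≤-reflexive (frac b)))
  ... | ℚᵘ.*≤* le = ℤ.drop‿+≤+ (ℤ.*-cancelʳ-≤-pos (ℤ.+ a) (ℤ.+ b) (ℤ.+ 1) le)

  ι-1 : ι 1 ≡ 1ℚ
  ι-1 = refl

  ι-0 : ι 0 ≡ 0ℚ
  ι-0 = refl

  /-*-ι : ∀ a b .{{_ : NonZero b}} → (ℤ.+ a ℚ./ b) ℚ.* ι b ≡ ι a
  /-*-ι a (suc b) = ℚ.toℚᵘ-injective (ℚᵘ.≃-trans (ℚ.toℚᵘ-homo-* (ℤ.+ a ℚ./ suc b) (ι (suc b)))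
    (ℚᵘ.≃-trans (ℚᵘ.*-cong (ℚ.toℚᵘ-fromℚᵘ (ℚᵘ.mkℚᵘ (ℤ.+ a) b)) (frac (suc b)))
    (ℚᵘ.≃-trans (ℚᵘ.*≡* eq) (ℚᵘ.≃-sym (frac a)))))
    where
    eq : (ℤ.+ a ℤ.* ℤ.+ suc b) ℤ.* ℤ.+ 1 ≡ ℤ.+ a ℤ.* ℤ.+ (suc b * 1)
    eq rewrite ℤ.*-identityʳ (ℤ.+ a ℤ.* ℤ.+ suc b) | *-identityʳ b = refl

ι-nonNeg : ∀ k → ℚ.NonNegative (ι k)
ι-nonNeg k = ℚ.nonNegative (subst (ℚ._≤ ι k) ι-0 (ι-mono z≤n))

ι-pos : ∀ k → 0 < k → ℚ.Positive (ι k)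
ι-pos k h = ℚ.positive (ℚ.<-≤-trans (ℚ.positive⁻¹ 1ℚ) (subst (ℚ._≤ ι k) ι-1 (ι-mono h)))

mono-ιʳ : ∀ k {x y} → x ℚ.≤ y → x ℚ.* ι k ℚ.≤ y ℚ.* ι k
mono-ιʳ k = ℚ.*-monoʳ-≤-nonNeg (ι k) {{ι-nonNeg k}}

cancel-ιʳ : ∀ k → 0 < k → ∀ {x y} → x ℚ.* ι k ℚ.≤ y ℚ.* ι k → x ℚ.≤ y
cancel-ιʳ k h = ℚ.*-cancelʳ-≤-pos (ι k) {{ι-pos k h}}

*-mono-≤-nonNeg : ∀ {a b c d} → 0ℚ ℚ.≤ c → 0ℚ ℚ.≤ b → a ℚ.≤ b → c ℚ.≤ d → a ℚ.* c ℚ.≤ b ℚ.* d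
*-mono-≤-nonNeg {a} {b} {c} {d} hc hb p q = ℚ.≤-trans
  (ℚ.*-monoʳ-≤-nonNeg c {{ℚ.nonNegative hc}} p) (ℚ.*-monoˡ-≤-nonNeg b {{ℚ.nonNegative hb}} q)

0≤ι : ∀ k → 0ℚ ℚ.≤ ι k
0≤ι k = ℚ.nonNegative⁻¹ (ι k) {{ι-nonNeg k}}

Dist : Set → Set
Dist X = List (ℚ × X)

E : Dist X → (X → ℚ) → ℚ
E μ f = sumℚ (map (λ p → proj₁ p ℚ.* f (proj₂ p)) μ)

Valid : (X → Set) → Dist X → Set
Valid Q = All (λ p → 0ℚ ℚ.≤ proj₁ p × Q (proj₂ p))

scale : ℚ → Dist X → Dist X
scale w = map (λ p → w ℚ.* proj₁ p , proj₂ p)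

bind : Dist X → (X → Dist Y) → Dist Y
bind μ k = concatMap (λ p → scale (proj₁ p) (k (proj₂ p))) μ

E-++ : ∀ (μ ν : Dist X) f → E (μ ++ ν) f ≡ E μ f ℚ.+ E ν f
E-++ []      ν f = sym (ℚ.+-identityˡ _)
E-++ (p ∷ μ) ν f = trans (cong (λ x → proj₁ p ℚ.* f (proj₂ p) ℚ.+ x) (E-++ μ ν f)) (sym (ℚ.+-assoc (proj₁ p ℚ.* f (proj₂ p)) (E μ f) (E ν f)))

E-scale : ∀ w (μ : Dist X) f → E (scale w μ) f ≡ w ℚ.* E μ f
E-scale w []      f = sym (ℚ.*-zeroʳ w)
E-scale w (p ∷ μ) f = trans (cong₂ ℚ._+_ (ℚ.*-assoc w (proj₁ p) (f (proj₂ p))) (E-scale w μ f)) (sym (ℚ.*-distribˡ-+ w (proj₁ p ℚ.* f (proj₂ p)) (E μ f)))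

E-bind : ∀ (μ : Dist X) (k : X → Dist Y) f → E (bind μ k) f ≡ E μ (λ x → E (k x) f)
E-bind []      k f = refl
E-bind (p ∷ μ) k f = trans (E-++ (scale (proj₁ p) (k (proj₂ p))) _ f) (cong₂ ℚ._+_ (E-scale (proj₁ p) (k (proj₂ p)) f) (E-bind μ k f))

E-cong : ∀ (μ : Dist X) {f g : X → ℚ} → (∀ x → f x ≡ g x) → E μ f ≡ E μ g
E-cong []      h = refl
E-cong (p ∷ μ) h = cong₂ ℚ._+_ (cong (proj₁ p ℚ.*_) (h (proj₂ p))) (E-cong μ h)

E-*ʳ : ∀ (μ : Dist X) f c → E μ (λ x → f x ℚ.* c) ≡ E μ f ℚ.* c
E-*ʳ []      f c = sym (ℚ.*-zeroˡ c)
E-*ʳ (p ∷ μ) f c = trans (cong₂ ℚ._+_ (sym (ℚ.*-assoc (proj₁ p) (f (proj₂ p)) c)) (E-*ʳ μ f c)) (sym (ℚ.*-distribʳ-+ c (proj₁ p ℚ.* f (proj₂ p)) (E μ f)))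

E-mono : ∀ {Q : X → Set} {μ : Dist X} → Valid Q μ → ∀ {f g : X → ℚ} → (∀ x → Q x → f x ℚ.≤ g x) → E μ f ℚ.≤ E μ g
E-mono []                  h = ℚ.≤-refl
E-mono (_∷_ {x = p} (w≥0 , q) v) h = ℚ.+-mono-≤ (ℚ.*-monoˡ-≤-nonNeg (proj₁ p) {{ℚ.nonNegative w≥0}} (h _ q)) (E-mono v h)

E-nonNeg : ∀ {Q : X → Set} {μ : Dist X} → Valid Q μ → ∀ {f : X → ℚ} → (∀ x → 0ℚ ℚ.≤ f x) → 0ℚ ℚ.≤ E μ f
E-nonNeg {μ = μ} v {f} h = ℚ.≤-trans (ℚ.≤-reflexive (sym (trans (E-cong μ (λ x → sym (ℚ.*-zeroʳ (f x)))) (trans (E-*ʳ μ f 0ℚ) (ℚ.*-zeroʳ (E μ f))))))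
  (E-mono v (λ x _ → h x))

scale-valid : ∀ {Q : X → Set} {w} {μ : Dist X} → 0ℚ ℚ.≤ w → Valid Q μ → Valid Q (scale w μ)
scale-valid w≥0 [] = []
scale-valid {w = w} w≥0 ((v≥0 , q) ∷ v) =
  (ℚ.≤-trans (ℚ.≤-reflexive (sym (ℚ.*-zeroʳ w))) (ℚ.*-monoˡ-≤-nonNeg w {{ℚ.nonNegative w≥0}} v≥0) , q) ∷ scale-valid w≥0 v

bind-valid : ∀ {Q : X → Set} {R : Y → Set} {μ : Dist X} {k : X → Dist Y} →
  Valid Q μ → (∀ x → Q x → Valid R (k x)) → Valid R (bind μ k)
bind-valid []            h = []
bind-valid ((w≥0 , q) ∷ v) h = ++⁺ (scale-valid w≥0 (h _ q)) (bind-valid v h)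

-- `ℓ` is a parameter here; `Combine` takes it to be the number of entries, and then the weights sum
-- to 1.
uniform : ∀ (ℓ : ℕ) .{{_ : NonZero ℓ}} → List X → Dist X
uniform ℓ xs = map (ℤ.+ 1 ℚ./ ℓ ,_) xs

E-uniform : ∀ ℓ .{{_ : NonZero ℓ}} (xs : List X) (g : X → ℕ) → E (uniform ℓ xs) (ι ∘ g) ℚ.* ι ℓ ≡ ι (∑ₗ xs g)
E-uniform ℓ []       g = trans (ℚ.*-zeroˡ (ι ℓ)) (sym ι-0)
E-uniform ℓ (x ∷ xs) g = begin
  ((ℤ.+ 1 ℚ./ ℓ) ℚ.* ι (g x) ℚ.+ E (uniform ℓ xs) (ι ∘ g)) ℚ.* ι ℓ ≡⟨ ℚ.*-distribʳ-+ (ι ℓ) ((ℤ.+ 1 ℚ./ ℓ) ℚ.* ι (g x)) (E (uniform ℓ xs) (ι ∘ g)) ⟩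
  (ℤ.+ 1 ℚ./ ℓ) ℚ.* ι (g x) ℚ.* ι ℓ ℚ.+ E (uniform ℓ xs) (ι ∘ g) ℚ.* ι ℓ ≡⟨ cong₂ ℚ._+_ first (E-uniform ℓ xs g) ⟩
  ι (g x) ℚ.+ ι (∑ₗ xs g) ≡⟨ ι-+ (g x) _ ⟨
  ι (g x + ∑ₗ xs g) ∎
  where
  open ≡-Reasoning
  first : (ℤ.+ 1 ℚ./ ℓ) ℚ.* ι (g x) ℚ.* ι ℓ ≡ ι (g x)
  first = begin
    (ℤ.+ 1 ℚ./ ℓ) ℚ.* ι (g x) ℚ.* ι ℓ   ≡⟨ trans (cong (ℚ._* ι ℓ) (ℚ.*-comm (ℤ.+ 1 ℚ./ ℓ) (ι (g x)))) (ℚ.*-assoc (ι (g x)) (ℤ.+ 1 ℚ./ ℓ) (ι ℓ)) ⟩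
    ι (g x) ℚ.* ((ℤ.+ 1 ℚ./ ℓ) ℚ.* ι ℓ) ≡⟨ cong (ι (g x) ℚ.*_) (trans (/-*-ι 1 ℓ) ι-1) ⟩
    ι (g x) ℚ.* 1ℚ                ≡⟨ ℚ.*-identityʳ _ ⟩
    ι (g x) ∎

uniform-valid : ∀ ℓ .{{_ : NonZero ℓ}} (xs : List X) → Valid (λ _ → ⊤) (uniform ℓ xs)
uniform-valid ℓ []       = []
uniform-valid ℓ (x ∷ xs) = (cancel-ιʳ ℓ (>-nonZero⁻¹ ℓ) (ℚ.≤-trans (ℚ.≤-reflexive (ℚ.*-zeroˡ (ι ℓ)))
  (ℚ.≤-trans (0≤ι 1) (ℚ.≤-reflexive (sym (/-*-ι 1 ℓ))))) , tt) ∷ uniform-valid ℓ xs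

Disjoint : ∀ {n d} → Tuple n d → Set
Disjoint S = ∀ i j u v → S i u v ≡ true → S j u v ≡ true → i ≡ j

⋃ : ∀ {n d} → Tuple n d → EdgeSet n
⋃ S u v = does (any? (λ i → S i u v B.≟ true))

σ : ∀ {n d} → Tuple n d → ℕ
σ S = ∑ (λ i → card (S i))

-- Disjointness enters here: the splitting charges an edge once, however many colours ask for it.
card-⋃ : ∀ {n d} (S : Tuple n d) → Disjoint S → card (⋃ S) ≡ σ S
card-⋃ {n} {d} S dis = begin
  card (⋃ S)                                       ≡⟨ ∑-cong (λ u → trans (∑-cong (λ v → pt u v)) (∑-comm _)) ⟩
  ∑ (λ u → ∑ (λ i → ∑ (λ v → ind (S i u v))))      ≡⟨ ∑-comm _ ⟩
  σ S ∎
  where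
  open ≡-Reasoning
  pt : ∀ u v → ind (⋃ S u v) ≡ ∑ (λ i → ind (S i u v))
  pt u v with any? (λ i → S i u v B.≟ true)
  ... | no none = sym (∑-zero zeros)
    where
    zeros : ∀ i → ind (S i u v) ≡ 0
    zeros i with S i u v in e
    ... | true  = ⊥-elim (none (i , e))
    ... | false = refl
  ... | yes (i , p) = sym (trans (∑-cong only) (∑-singleton i))
    where
    only : ∀ j → ind (S j u v) ≡ ind (does (j F.≟ i))
    only j with j F.≟ i
    ... | yes refl rewrite p = refl
    ... | no j≢i with S j u v in e
    ... | true  = ⊥-elim (j≢i (dis j i u v e p))
    ... | false = refl

⋃-⊆ : ∀ {n d} {S M : Tuple n d} {H : EdgeSet n} → (∀ i → S i ⊆ₑ M i) → (∀ i → M i ⊆ₑ H) → ⋃ S ⊆ₑ H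
⋃-⊆ {S = S} h k u v e with any? (λ i → S i u v B.≟ true)
... | yes (i , p) = k i u v (h i u v p)

contains : ∀ {n d} → Tuple n d → Tuple n d → ℚ
contains S M = ι (ind (allSubset? S M))

-- A distribution on 1-factorizations of H that is (a / b)-spread; the bound is
-- required for pairwise disjoint tuples only, all others having probability 0.
record SpreadDist (a b : ℕ) {n} (d : ℕ) (H : EdgeSet n) : Set where
  field
    μ      : Dist (Tuple n d)
    valid  : Valid (OneFactorization H) μ
    total  : E μ (λ _ → 1ℚ) ≡ 1ℚ
    spread : ∀ S → Disjoint S → E μ (contains S) ℚ.* ι (b ^ σ S) ℚ.≤ ι (a ^ σ S)

open SpreadDist

relax : ∀ {a b a′ b′ n d} {H : EdgeSet n} → 0 < b → a * b′ ≤ a′ * b → SpreadDist a b d H → SpreadDist a′ b′ d H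
relax {a} {b} {a′} {b′} b>0 h D = record { μ = μ D ; valid = valid D ; total = total D ; spread = spr }
  where
  open ℚ.≤-Reasoning
  spr : ∀ S → Disjoint S → E (μ D) (contains S) ℚ.* ι (b′ ^ σ S) ℚ.≤ ι (a′ ^ σ S)
  spr S dis = cancel-ιʳ (b ^ s) (m^n>0 b {{>-nonZero b>0}} s) (begin
    x ℚ.* ι (b′ ^ s) ℚ.* ι (b ^ s)   ≡⟨ trans (ℚ.*-assoc x (ι (b′ ^ s)) (ι (b ^ s))) (trans (cong (x ℚ.*_) (ℚ.*-comm (ι (b′ ^ s)) (ι (b ^ s)))) (sym (ℚ.*-assoc x (ι (b ^ s)) (ι (b′ ^ s))))) ⟩
    x ℚ.* ι (b ^ s) ℚ.* ι (b′ ^ s)   ≤⟨ mono-ιʳ (b′ ^ s) (spread D S dis) ⟩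
    ι (a ^ s) ℚ.* ι (b′ ^ s)       ≡⟨ ι-* (a ^ s) (b′ ^ s) ⟨
    ι (a ^ s * b′ ^ s)         ≤⟨ ι-mono (≤-trans (≤-reflexive (sym (^-distribʳ-* s a b′))) (≤-trans (^-monoˡ-≤ s h) (≤-reflexive (^-distribʳ-* s a′ b)))) ⟩
    ι (a′ ^ s * b ^ s)         ≡⟨ ι-* (a′ ^ s) (b ^ s) ⟩
    ι (a′ ^ s) ℚ.* ι (b ^ s) ∎)
    where
    s = σ S
    x = E (μ D) (contains S)

trivialSpread : ∀ {n} d (H : EdgeSet n) → IsRegular H d → SpreadDist 1 1 d H
trivialSpread d H reg = record
  { μ = (1ℚ , M) ∷ []
  ; valid = (ℚ.nonNegative⁻¹ 1ℚ , proj₂ (oneFactorization d H reg)) ∷ []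
  ; total = refl
  ; spread = λ S _ → spr S
  }
  where
  M = proj₁ (oneFactorization d H reg)
  spr : ∀ S → (1ℚ ℚ.* contains S M ℚ.+ 0ℚ) ℚ.* ι (1 ^ σ S) ℚ.≤ ι (1 ^ σ S)
  spr S rewrite ^-zeroˡ (σ S) | ℚ.+-identityʳ (1ℚ ℚ.* contains S M) | ℚ.*-identityˡ (contains S M) =
    subst₂ ℚ._≤_ (ι-* (ind (allSubset? S M)) 1) refl (ι-mono (≤-trans (≤-reflexive (*-identityʳ _)) (ind≤1 (allSubset? S M))))

-- A uniform splitting is drawn first, then the 1-factorizations of its halves, independently given
-- the splitting. The bound `u / v` for the splitting and `a / b` for the halves multiply.
module Combine {n r d₁ d₂} {H : EdgeSet n} (sps : List (Splitting r d₁ d₂ H)) (u v a b : ℕ)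
  (ℓ>0 : 0 < ∑ₗ sps (λ _ → 1))
  (sps-spread : ∀ S T → ∑ₗ sps (λ sp → ind (subset? S (Splitting.M sp) ∧ subset? T (H ∖ Splitting.M sp))) * v ^ (card S + card T)
      ≤ u ^ (card S + card T) * ∑ₗ sps (λ _ → 1))
  (dist₁ : (sp : Splitting r d₁ d₂ H) → SpreadDist a b d₁ (Splitting.M sp))
  (dist₂ : (sp : Splitting r d₁ d₂ H) → SpreadDist a b d₂ (H ∖ Splitting.M sp)) where

  ℓ : ℕ
  ℓ = ∑ₗ sps (λ _ → 1)

  instance
    ℓ≢0 : NonZero ℓ
    ℓ≢0 = >-nonZero ℓ>0

  ret : Tuple n (d₁ + d₂) → Dist (Tuple n (d₁ + d₂))
  ret M = (1ℚ , M) ∷ []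

  E-ret : ∀ M f → E (ret M) f ≡ f M
  E-ret M f = trans (ℚ.+-identityʳ (1ℚ ℚ.* f M)) (ℚ.*-identityˡ (f M))

  inner : Splitting r d₁ d₂ H → Dist (Tuple n (d₁ + d₂))
  inner sp = bind (μ (dist₁ sp)) (λ M₁ → bind (μ (dist₂ sp)) (λ M₂ → ret (join M₁ M₂)))

  E-inner : ∀ sp f → E (inner sp) f ≡ E (μ (dist₁ sp)) (λ M₁ → E (μ (dist₂ sp)) (λ M₂ → f (join M₁ M₂)))
  E-inner sp f = trans (E-bind (μ (dist₁ sp)) _ f) (E-cong (μ (dist₁ sp)) (λ M₁ →
    trans (E-bind (μ (dist₂ sp)) _ f) (E-cong (μ (dist₂ sp)) (λ M₂ → E-ret _ f))))

  outer : Dist (Tuple n (d₁ + d₂))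
  outer = bind (uniform ℓ sps) inner

  outer-valid : Valid (OneFactorization H) outer
  outer-valid = bind-valid (uniform-valid ℓ sps) (λ sp _ →
    bind-valid (valid (dist₁ sp)) (λ M₁ p₁ →
    bind-valid (valid (dist₂ sp)) (λ M₂ p₂ →
      (ℚ.nonNegative⁻¹ 1ℚ , join-1F {H = H} {Splitting.M sp} (Splitting.M⊆H sp) p₁ p₂) ∷ [])))

  outer-total : E outer (λ _ → 1ℚ) ≡ 1ℚ
  outer-total = begin
    E outer (λ _ → 1ℚ)                     ≡⟨ E-bind (uniform ℓ sps) inner _ ⟩
    E (uniform ℓ sps) (λ sp → E (inner sp) (λ _ → 1ℚ)) ≡⟨ E-cong (uniform ℓ sps) (λ sp → trans (E-inner sp _) (trans (E-cong (μ (dist₁ sp)) (λ _ → total (dist₂ sp))) (total (dist₁ sp)))) ⟩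
    E (uniform ℓ sps) (λ _ → 1ℚ)           ≡⟨ E-cong (uniform ℓ sps) (λ _ → sym ι-1) ⟩
    x                                      ≡⟨ ℚ.*-identityʳ x ⟨
    x ℚ.* 1ℚ                                 ≡⟨ cong (x ℚ.*_) (trans (ℚ.*-comm (ι ℓ) w) (trans (/-*-ι 1 ℓ) ι-1)) ⟨
    x ℚ.* (ι ℓ ℚ.* w)                          ≡⟨ ℚ.*-assoc x (ι ℓ) w ⟨
    x ℚ.* ι ℓ ℚ.* w                            ≡⟨ cong (ℚ._* w) (E-uniform ℓ sps (λ _ → 1)) ⟩
    ι ℓ ℚ.* w                                ≡⟨ trans (ℚ.*-comm (ι ℓ) w) (trans (/-*-ι 1 ℓ) ι-1) ⟩
    1ℚ ∎
    where
    open ≡-Reasoning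
    x = E (uniform ℓ sps) (λ _ → ι 1)
    w = ℤ.+ 1 ℚ./ ℓ

  module _ (S : Tuple n (d₁ + d₂)) (dis : Disjoint S) where
    S₁ : Tuple n d₁
    S₁ i = S (i ↑ˡ d₂)
    S₂ : Tuple n d₂
    S₂ i = S (d₁ ↑ʳ i)

    disjoint₁ : Disjoint S₁
    disjoint₁ i j u v p q = ↑ˡ-injective d₂ _ _ (dis _ _ u v p q)

    disjoint₂ : Disjoint S₂
    disjoint₂ i j u v p q = ↑ʳ-injective d₁ _ _ (dis _ _ u v p q)

    σ-split : σ S ≡ σ S₁ + σ S₂
    σ-split = ∑-split d₁ _

    hits : Splitting r d₁ d₂ H → ℕ
    hits sp = ind (subset? (⋃ S₁) (Splitting.M sp) ∧ subset? (⋃ S₂) (H ∖ Splitting.M sp))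

    -- The event implies `hits sp`, as each matching stays in its half. Keeping this factor, which
    -- depends on `sp` alone, lets the bounds for the halves be applied conditionally on `sp`.
    join-bound : ∀ sp {M₁ M₂} → OneFactorization (Splitting.M sp) M₁ → OneFactorization (H ∖ Splitting.M sp) M₂ →
      contains S (join M₁ M₂) ℚ.≤ ι (hits sp) ℚ.* contains S₁ M₁ ℚ.* contains S₂ M₂
    join-bound sp {M₁} {M₂} (_ , in₁ , _) (_ , in₂ , _) = subst (contains S (join M₁ M₂) ℚ.≤_)
      (trans (ι-* (hits sp * ind (allSubset? S₁ M₁)) _) (cong (ℚ._* contains S₂ M₂) (ι-* (hits sp) _)))
      (ι-mono le)
      where
      le : ind (allSubset? S (join M₁ M₂)) ≤ hits sp * ind (allSubset? S₁ M₁) * ind (allSubset? S₂ M₂)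
      le with allSubset? S (join M₁ M₂) in e
      ... | false = z≤n
      ... | true = ≤-reflexive (sym (cong₂ _*_ (cong₂ _*_ (cong ind (cong₂ _∧_
                (subset?⁺ {S = ⋃ S₁} (⋃-⊆ {S = S₁} {M₁} h₁ in₁)) (subset?⁺ {S = ⋃ S₂} (⋃-⊆ {S = S₂} {M₂} h₂ in₂))))
                (cong ind (allSubset?⁺ {S = S₁} {M₁} h₁))) (cong ind (allSubset?⁺ {S = S₂} {M₂} h₂))))
        where
        h : ∀ i → S i ⊆ₑ join M₁ M₂ i
        h = allSubset?⁻ {S = S} {join M₁ M₂} e
        h₁ : ∀ i → S₁ i ⊆ₑ M₁ i
        h₁ i x y p = subst (λ z → [ M₁ , M₂ ]′ z x y ≡ true) (splitAt-↑ˡ d₁ i d₂) (h (i ↑ˡ d₂) x y p)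
        h₂ : ∀ i → S₂ i ⊆ₑ M₂ i
        h₂ i x y p = subst (λ z → [ M₁ , M₂ ]′ z x y ≡ true) (splitAt-↑ʳ d₁ d₂ i) (h (d₁ ↑ʳ i) x y p)

    s₁ s₂ : ℕ
    s₁ = σ S₁
    s₂ = σ S₂

    inner-bound : ∀ sp → E (inner sp) (contains S) ℚ.* ι (b ^ (s₁ + s₂)) ℚ.≤ ι (hits sp) ℚ.* ι (a ^ (s₁ + s₂))
    inner-bound sp = begin
      E (inner sp) (contains S) ℚ.* ι (b ^ (s₁ + s₂))
        ≡⟨ cong₂ ℚ._*_ (E-inner sp (contains S)) (pow b) ⟩
      E μ₁ (λ M₁ → E μ₂ (λ M₂ → contains S (join M₁ M₂))) ℚ.* (ι (b ^ s₁) ℚ.* ι (b ^ s₂))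
        ≤⟨ ℚ.*-monoʳ-≤-nonNeg (ι (b ^ s₁) ℚ.* ι (b ^ s₂)) {{ℚ.nonNegative bb}} (E-mono (valid (dist₁ sp)) (λ M₁ p₁ → E-mono (valid (dist₂ sp)) (λ M₂ p₂ → join-bound sp p₁ p₂))) ⟩
      E μ₁ (λ M₁ → E μ₂ (λ M₂ → ι (hits sp) ℚ.* contains S₁ M₁ ℚ.* contains S₂ M₂)) ℚ.* (ι (b ^ s₁) ℚ.* ι (b ^ s₂))
        ≡⟨ cong (ℚ._* (ι (b ^ s₁) ℚ.* ι (b ^ s₂))) pull-out ⟩
      ι (hits sp) ℚ.* (P₁ ℚ.* P₂) ℚ.* (ι (b ^ s₁) ℚ.* ι (b ^ s₂))
        ≡⟨ solve 5 (λ h p q x y → h :* (p :* q) :* (x :* y) := h :* ((p :* x) :* (q :* y))) refl (ι (hits sp)) P₁ P₂ (ι (b ^ s₁)) (ι (b ^ s₂)) ⟩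
      ι (hits sp) ℚ.* ((P₁ ℚ.* ι (b ^ s₁)) ℚ.* (P₂ ℚ.* ι (b ^ s₂)))
        ≤⟨ ℚ.*-monoˡ-≤-nonNeg (ι (hits sp)) {{ι-nonNeg _}} (*-mono-≤-nonNeg
             (ℚ.≤-trans (ℚ.≤-reflexive (sym (ℚ.*-zeroˡ (ι (b ^ s₂))))) (mono-ιʳ (b ^ s₂) (E-nonNeg (valid (dist₂ sp)) (λ M → 0≤ι _)))) (0≤ι _)
             (spread (dist₁ sp) S₁ disjoint₁) (spread (dist₂ sp) S₂ disjoint₂)) ⟩
      ι (hits sp) ℚ.* (ι (a ^ s₁) ℚ.* ι (a ^ s₂))
        ≡⟨ cong (ι (hits sp) ℚ.*_) (pow a) ⟨
      ι (hits sp) ℚ.* ι (a ^ (s₁ + s₂)) ∎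
      where
      open ℚ.≤-Reasoning
      open ℚSolver
      μ₁ = μ (dist₁ sp)
      μ₂ = μ (dist₂ sp)
      P₁ = E μ₁ (contains S₁)
      P₂ = E μ₂ (contains S₂)
      pow : ∀ x → ι (x ^ (s₁ + s₂)) ≡ ι (x ^ s₁) ℚ.* ι (x ^ s₂)
      pow x = trans (cong ι (^-distribˡ-+-* x s₁ s₂)) (ι-* (x ^ s₁) _)
      bb : 0ℚ ℚ.≤ ι (b ^ s₁) ℚ.* ι (b ^ s₂)
      bb = subst (0ℚ ℚ.≤_) (pow b) (0≤ι _)
      pull-out : E μ₁ (λ M₁ → E μ₂ (λ M₂ → ι (hits sp) ℚ.* contains S₁ M₁ ℚ.* contains S₂ M₂)) ≡ ι (hits sp) ℚ.* (P₁ ℚ.* P₂)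
      pull-out = trans (E-cong μ₁ (λ M₁ → trans (E-cong μ₂ (λ M₂ → ℚ.*-comm (ι (hits sp) ℚ.* contains S₁ M₁) (contains S₂ M₂))) (trans (E-*ʳ μ₂ (contains S₂) (ι (hits sp) ℚ.* contains S₁ M₁))
            (solve 3 (λ p h c → p :* (h :* c) := c :* (h :* p)) refl P₂ (ι (hits sp)) (contains S₁ M₁)))))
          (trans (E-*ʳ μ₁ (contains S₁) (ι (hits sp) ℚ.* P₂)) (solve 3 (λ p h q → p :* (h :* q) := h :* (p :* q)) refl P₁ (ι (hits sp)) P₂))

    hits-bound : E (uniform ℓ sps) (ι ∘ hits) ℚ.* ι (v ^ (s₁ + s₂)) ℚ.≤ ι (u ^ (s₁ + s₂))
    hits-bound = cancel-ιʳ ℓ ℓ>0 (begin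
      x ℚ.* ι V ℚ.* ι ℓ               ≡⟨ solve 3 (λ x y z → x :* y :* z := x :* z :* y) refl x (ι V) (ι ℓ) ⟩
      x ℚ.* ι ℓ ℚ.* ι V               ≡⟨ cong (ℚ._* ι V) (E-uniform ℓ sps hits) ⟩
      ι (∑ₗ sps hits) ℚ.* ι V       ≡⟨ ι-* (∑ₗ sps hits) V ⟨
      ι (∑ₗ sps hits * V)       ≤⟨ ι-mono (subst (λ k → ∑ₗ sps hits * v ^ k ≤ u ^ k * ℓ)
                                       (cong₂ _+_ (card-⋃ S₁ disjoint₁) (card-⋃ S₂ disjoint₂)) (sps-spread (⋃ S₁) (⋃ S₂))) ⟩
      ι (u ^ (s₁ + s₂) * ℓ) ≡⟨ ι-* (u ^ (s₁ + s₂)) ℓ ⟩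
      ι (u ^ (s₁ + s₂)) ℚ.* ι ℓ ∎)
      where
      open ℚ.≤-Reasoning
      open ℚSolver
      V = v ^ (s₁ + s₂)
      x = E (uniform ℓ sps) (ι ∘ hits)

    outer-spread : E outer (contains S) ℚ.* ι ((v * b) ^ σ S) ℚ.≤ ι ((u * a) ^ σ S)
    outer-spread rewrite σ-split = begin
      E outer (contains S) ℚ.* ι ((v * b) ^ s)
        ≡⟨ cong₂ ℚ._*_ (E-bind (uniform ℓ sps) inner (contains S)) (trans (cong ι (trans (^-distribʳ-* s v b) (*-comm (v ^ s) _))) (ι-* (b ^ s) _)) ⟩
      E un (λ sp → E (inner sp) (contains S)) ℚ.* (ι (b ^ s) ℚ.* ι (v ^ s))
        ≡⟨ ℚ.*-assoc (E un (λ sp → E (inner sp) (contains S))) (ι (b ^ s)) (ι (v ^ s)) ⟨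
      E un (λ sp → E (inner sp) (contains S)) ℚ.* ι (b ^ s) ℚ.* ι (v ^ s)
        ≡⟨ cong (ℚ._* ι (v ^ s)) (E-*ʳ un (λ sp → E (inner sp) (contains S)) (ι (b ^ s))) ⟨
      E un (λ sp → E (inner sp) (contains S) ℚ.* ι (b ^ s)) ℚ.* ι (v ^ s)
        ≤⟨ mono-ιʳ (v ^ s) (E-mono (uniform-valid ℓ sps) (λ sp _ → inner-bound sp)) ⟩
      E un (λ sp → ι (hits sp) ℚ.* ι (a ^ s)) ℚ.* ι (v ^ s)
        ≡⟨ cong (ℚ._* ι (v ^ s)) (E-*ʳ un (ι ∘ hits) (ι (a ^ s))) ⟩
      E un (ι ∘ hits) ℚ.* ι (a ^ s) ℚ.* ι (v ^ s)
        ≡⟨ solve 3 (λ x y z → x :* y :* z := x :* z :* y) refl (E un (ι ∘ hits)) (ι (a ^ s)) (ι (v ^ s)) ⟩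
      E un (ι ∘ hits) ℚ.* ι (v ^ s) ℚ.* ι (a ^ s)
        ≤⟨ mono-ιʳ (a ^ s) hits-bound ⟩
      ι (u ^ s) ℚ.* ι (a ^ s)
        ≡⟨ trans (cong ι (^-distribʳ-* s u a)) (ι-* (u ^ s) _) ⟨
      ι ((u * a) ^ s) ∎
      where
      open ℚ.≤-Reasoning
      open ℚSolver
      s = s₁ + s₂
      un = uniform ℓ sps

  combined : SpreadDist (u * a) (v * b) (d₁ + d₂) H
  combined = record { μ = outer ; valid = outer-valid ; total = outer-total ; spread = outer-spread }

-- Recursive halving

module _ (q k : ℕ) (H : EdgeSet (suc k)) (d θ : ℕ) (θ≤1 : θ ≤ 1) (reg : IsRegular H (d + (d + θ)))
  (t Z h : ℕ) (2Z≤2^t : 2 * Z ≤ 2 ^ t) (r≡2h : suc q ≡ 2 * h)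
  (expand : ∀ A B → suc (2 * (q * q) + 4 * q + 1) * (t * margin A B) ≤ cutSize H A B)
  (large : 32 * suc k * (suc q + 2) ≤ Z) (a b : ℕ)
  (dist : (sp : Splitting (suc q) d (d + θ) H) →
    SpreadDist a b d (Splitting.M sp) × SpreadDist a b (d + θ) (H ∖ Splitting.M sp)) where

  private
    module S = SplitGood q k H d θ θ≤1 reg

    many : S.∣Ω∣ * (suc q + 1) ≤ S.tally S.isGood * (suc q + 2)
    many = S.Bound.good-many (d + (d + θ)) t Z h reg 2Z≤2^t r≡2h expand large

  abstract
    spreadStep : SpreadDist ((suc q + 2) * a) (2 * suc q * b) (d + (d + θ)) H
    spreadStep = Combine.combined S.splittings (suc q + 2) (2 * suc q) a b
      (S.splittings-nonempty many) (S.splittings-spread many) (λ sp → proj₁ (dist sp)) (λ sp → proj₂ (dist sp))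

halve : ∀ d → ∃ λ h → ∃ λ θ → θ ≤ 1 × h + (h + θ) ≡ d
halve zero          = 0 , 0 , z≤n , refl
halve (suc zero)    = 0 , 1 , ≤-refl , refl
halve (suc (suc d)) with halve d
... | h , θ , θ≤1 , refl = suc h , θ , θ≤1 , cong suc (+-suc h (h + θ))

-- The Chernoff bound asks for expansion of order `r²`, and `r` is `8 (j + 2)²`; this lets the
-- expansion `2 ^ j` at height `j` supply it.
quartic : ∀ j → (2 + j) ^ 4 ≤ 128 * 2 ^ j
quartic 0 = ≤ᵇ⇒≤ 16 128 tt
quartic 1 = ≤ᵇ⇒≤ 81 256 tt
quartic 2 = ≤ᵇ⇒≤ 256 512 tt
quartic 3 = ≤ᵇ⇒≤ 625 1024 tt
-- The ratio of consecutive fourth powers is below 2 from `6` onwards but not from `5` to `6`, so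
-- the induction starts at `j = 4`.
quartic (suc (suc (suc (suc i)))) = go i
  where
  open ≤-Reasoning
  doubling : ∀ i → (7 + i) ^ 4 ≤ 2 * (6 + i) ^ 4
  doubling i = ≤-trans (m≤m+n _ (i * (i * (i * i)) + 20 * (i * (i * i)) + 138 * (i * i) + 356 * i + 191)) (≤-reflexive (eq i))
    where
    eq : ∀ i → (7 + i) * ((7 + i) * ((7 + i) * ((7 + i) * 1))) + (i * (i * (i * i)) + 20 * (i * (i * i)) + 138 * (i * i) + 356 * i + 191)
         ≡ 2 * ((6 + i) * ((6 + i) * ((6 + i) * ((6 + i) * 1))))
    eq = solve-∀
  go : ∀ i → (6 + i) ^ 4 ≤ 128 * 2 ^ (4 + i)
  go zero = ≤ᵇ⇒≤ 1296 2048 tt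
  go (suc i) = begin
    (7 + i) ^ 4               ≤⟨ doubling i ⟩
    2 * (6 + i) ^ 4           ≤⟨ *-monoʳ-≤ 2 (go i) ⟩
    2 * (128 * 2 ^ (4 + i))   ≡⟨ sw 2 128 (2 ^ (4 + i)) ⟩
    128 * 2 ^ (4 + suc i) ∎
    where
    sw : ∀ x y z → x * (y * z) ≡ y * (x * z)
    sw = solve-∀

suc≤2^ : ∀ j → suc j ≤ 2 ^ j
suc≤2^ zero    = ≤-refl
suc≤2^ (suc j) = ≤-trans (s≤s (suc≤2^ j)) (≤-trans (+-monoˡ-≤ (2 ^ j) (m^n>0 2 j)) (≤-reflexive (cong (λ x → 2 ^ j + x) (sym (+-identityʳ _)))))

abstract
  -- `2048 = 2 * 8² * 16` comes from `2 r² * 16 L` with `r = 8 (j + 2)²`, and `128` from `quartic`;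
  -- see `expand`.
  K : ℕ
  K = 2048 * 128

  K-def : K ≡ 2048 * 128
  K-def = refl

  K>0 : 0 < K
  K>0 = s≤s z≤n

module Recursion (k L : ℕ) (1≤L : 1 ≤ L) (n≤2^L : suc k ≤ 2 ^ L) where
  n = suc k

  -- The relative expansion (j + 1) / (j + 2) decreases towards the leaves, and the
  -- relative spread 2 (j + 1) / (j + 2) increases from them, by the same telescoping factors.
  Expands : ℕ → EdgeSet n → Set
  Expands j H = ∀ A B → suc j * (2 ^ j * (K * L)) * margin A B ≤ (2 + j) * cutSize H A B

  module Step (j : ℕ) (2^j≤n : 2 ^ suc j ≤ n) where
    y q Z : ℕ
    y = (2 + j) * (2 + j)
    -- Chosen so that `suc q = 8 (j + 2)²`. The relative loss `8/r` of a cut is then `1/(j + 2)²`,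
    -- and `1 - 1/(j + 2)² = (j + 1)(j + 3)/(j + 2)²` telescopes. `Z` below attains equality in
    -- `large`.
    q = 8 * (j * j) + 32 * j + 31
    Z = 32 * n * (suc q + 2)

    r≡8y : suc q ≡ 8 * y
    r≡8y = eq j
      where
      eq : ∀ j → 1 + (8 * (j * j) + 32 * j + 31) ≡ 8 * ((2 + j) * (2 + j))
      eq = solve-∀

    r≡2h : suc q ≡ 2 * (4 * y)
    r≡2h = trans r≡8y (eq y)
      where
      eq : ∀ y → 8 * y ≡ 2 * (4 * y)
      eq = solve-∀

    r+2≤ : suc q + 2 ≤ 16 * (n * n)
    r+2≤ = begin
      suc q + 2     ≡⟨ cong (_+ 2) r≡8y ⟩
      8 * y + 2     ≤⟨ +-monoʳ-≤ (8 * y) (*-mono-≤ {2} {8} (s≤s (s≤s z≤n)) (*-mono-≤ {1} {2 + j} {1} {2 + j} (s≤s z≤n) (s≤s z≤n))) ⟩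
      8 * y + 8 * y ≡⟨ eq y ⟩
      16 * y        ≤⟨ *-monoʳ-≤ 16 (*-mono-≤ j+2≤n j+2≤n) ⟩
      16 * (n * n) ∎
      where
      open ≤-Reasoning
      eq : ∀ y → 8 * y + 8 * y ≡ 16 * y
      eq = solve-∀
      j+2≤n : 2 + j ≤ n
      j+2≤n = ≤-trans (suc≤2^ (suc j)) 2^j≤n

    -- `Z` is cubic in `n`, and `10 + 3 L ≤ 16 L` because `1 ≤ L`.
    2Z≤ : 2 * Z ≤ 2 ^ (16 * L)
    2Z≤ = begin
      2 * (32 * n * (suc q + 2))    ≤⟨ *-monoʳ-≤ 2 (*-monoʳ-≤ (32 * n) r+2≤) ⟩
      2 * (32 * n * (16 * (n * n))) ≡⟨ eq n ⟩
      2 ^ 10 * n ^ 3                ≤⟨ *-monoʳ-≤ (2 ^ 10) (^-monoˡ-≤ 3 n≤2^L) ⟩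
      2 ^ 10 * (2 ^ L) ^ 3          ≡⟨ cong (2 ^ 10 *_) (^-*-assoc 2 L 3) ⟩
      2 ^ 10 * 2 ^ (L * 3)          ≡⟨ ^-distribˡ-+-* 2 10 (L * 3) ⟨
      2 ^ (10 + L * 3)              ≤⟨ ^-monoʳ-≤ 2 (≤-trans (+-monoˡ-≤ (L * 3) (*-monoʳ-≤ 10 1≤L)) (≤-trans (m≤m+n _ (3 * L)) (≤-reflexive (eq′ L)))) ⟩
      2 ^ (16 * L) ∎
      where
      open ≤-Reasoning
      eq : ∀ n → 2 * (32 * n * (16 * (n * n))) ≡ 1024 * (n * (n * (n * 1)))
      eq = solve-∀
      eq′ : ∀ L → 10 * L + L * 3 + 3 * L ≡ 16 * L
      eq′ = solve-∀

    module _ (H : EdgeSet n) (ex : Expands (suc j) H) where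
      halfExpansion : ∀ A B → 2 ^ j * (K * L) * margin A B ≤ cutSize H A B
      halfExpansion A B = *-cancelˡ-≤ (2 * (2 + j)) (begin
        2 * (2 + j) * (2 ^ j * (K * L) * margin A B) ≡⟨ eq (2 + j) (2 ^ j) (K * L) (margin A B) ⟩
        (2 + j) * (2 ^ suc j * (K * L)) * margin A B ≤⟨ ex A B ⟩
        (3 + j) * cutSize H A B                      ≤⟨ *-monoˡ-≤ (cutSize H A B) (≤-trans (m≤m+n _ (1 + j)) (≤-reflexive (eq′ j))) ⟩
        2 * (2 + j) * cutSize H A B ∎)
        where
        open ≤-Reasoning
        eq : ∀ i e x m → 2 * i * (e * x * m) ≡ i * (2 * e * x) * m
        eq = solve-∀
        eq′ : ∀ j → 3 + j + (1 + j) ≡ 2 * (2 + j)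
        eq′ = solve-∀

      expand : ∀ A B → suc (2 * (q * q) + 4 * q + 1) * (16 * L * margin A B) ≤ cutSize H A B
      expand A B = begin
        suc (2 * (q * q) + 4 * q + 1) * (16 * L * margin A B) ≡⟨ cong (_* (16 * L * margin A B)) (trans (sq q) (cong₂ (λ x z → 2 * (x * z)) r≡8y r≡8y)) ⟩
        2 * (8 * y * (8 * y)) * (16 * L * margin A B)         ≡⟨ eq (2 + j) L (margin A B) ⟩
        2048 * (2 + j) ^ 4 * (L * margin A B)                 ≤⟨ *-monoˡ-≤ (L * margin A B) (*-monoʳ-≤ 2048 (quartic j)) ⟩
        2048 * (128 * 2 ^ j) * (L * margin A B)               ≡⟨ eq″ 2048 128 (2 ^ j) L (margin A B) ⟩
        2 ^ j * (2048 * 128 * L) * margin A B                 ≡⟨ cong (λ x → 2 ^ j * (x * L) * margin A B) {K} {2048 * 128} K-def ⟨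
        2 ^ j * (K * L) * margin A B                          ≤⟨ halfExpansion A B ⟩
        cutSize H A B ∎
        where
        open ≤-Reasoning
        sq : ∀ q → 1 + (2 * (q * q) + 4 * q + 1) ≡ 2 * ((1 + q) * (1 + q))
        sq = solve-∀
        eq : ∀ i L m → 2 * (8 * (i * i) * (8 * (i * i))) * (16 * L * m) ≡ 2048 * (i * (i * (i * (i * 1)))) * (L * m)
        eq = solve-∀
        eq″ : ∀ a b e L m → a * (b * e) * (L * m) ≡ e * (a * b * L) * m
        eq″ = solve-∀

      -- Rests on `(j + 1)(j + 3) + 1 = (j + 2)²`: the loss in the cut is exactly the drop from
      -- `(j + 2)/(j + 3)` to `(j + 1)/(j + 2)`.
      inherit : ∀ {M : EdgeSet n} → (∀ A B → suc q * cutSize H A B ≤ 2 * suc q * cutSize M A B + 8 * cutSize H A B) → Expands j M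
      inherit {M} cut A B = *-cancelˡ-≤ (2 * (2 + j)) (begin
        2 * (2 + j) * (suc j * (2 ^ j * (K * L)) * m)     ≡⟨ eq₁ j (2 ^ j) (K * L) m ⟩
        suc j * ((2 + j) * (2 ^ suc j * (K * L)) * m)     ≤⟨ *-monoʳ-≤ (suc j) (ex A B) ⟩
        suc j * ((3 + j) * N)                             ≤⟨ +-cancelʳ-≤ N _ _ cut′ ⟩
        2 * y * C                                         ≡⟨ eq₂ (2 + j) C ⟩
        2 * (2 + j) * ((2 + j) * C) ∎)
        where
        open ≤-Reasoning
        m = margin A B
        N = cutSize H A B
        C = cutSize M A B
        eq₁ : ∀ j e x m → 2 * (2 + j) * ((1 + j) * (e * x) * m) ≡ (1 + j) * ((2 + j) * (2 * e * x) * m)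
        eq₁ = solve-∀
        eq₂ : ∀ i c → 2 * (i * i) * c ≡ 2 * i * (i * c)
        eq₂ = solve-∀
        eq₃ : ∀ j N → 8 * ((1 + j) * ((3 + j) * N) + N) ≡ 8 * ((2 + j) * (2 + j)) * N
        eq₃ = solve-∀
        eq₄ : ∀ y c N → 2 * (8 * y) * c + 8 * N ≡ 8 * (2 * y * c + N)
        eq₄ = solve-∀
        cut′ : suc j * ((3 + j) * N) + N ≤ 2 * y * C + N
        cut′ = *-cancelˡ-≤ 8 (begin
          8 * (suc j * ((3 + j) * N) + N) ≡⟨ eq₃ j N ⟩
          8 * y * N                       ≡⟨ cong (_* N) r≡8y ⟨
          suc q * N                       ≤⟨ cut A B ⟩
          2 * suc q * C + 8 * N           ≡⟨ cong (λ x → 2 * x * C + 8 * N) r≡8y ⟩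
          2 * (8 * y) * C + 8 * N         ≡⟨ eq₄ y C N ⟩
          8 * (2 * y * C + N) ∎)

    -- Amounts to `1 + 2/r ≤ (j + 2)²/((j + 1)(j + 3))`, where `2/r` is only `1/(4 (j + 2)²)`.
    ratio : (suc q + 2) * (2 * suc j) * ((3 + j) * 2 ^ suc j) ≤ 2 * (2 + j) * (2 * suc q * ((2 + j) * 2 ^ j))
    ratio = begin
      (suc q + 2) * (2 * suc j) * ((3 + j) * 2 ^ suc j)           ≡⟨ cong (λ x → (x + 2) * (2 * suc j) * ((3 + j) * 2 ^ suc j)) r≡8y ⟩
      (8 * y + 2) * (2 * suc j) * ((3 + j) * (2 * 2 ^ j))         ≤⟨ m≤m+n _ (4 * 2 ^ j * (6 * y + 2)) ⟩
      (8 * y + 2) * (2 * suc j) * ((3 + j) * (2 * 2 ^ j)) + 4 * 2 ^ j * (6 * y + 2) ≡⟨ eq j (2 ^ j) ⟩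
      2 * (2 + j) * (2 * (8 * y) * ((2 + j) * 2 ^ j))             ≡⟨ cong (λ x → 2 * (2 + j) * (2 * x * ((2 + j) * 2 ^ j))) r≡8y ⟨
      2 * (2 + j) * (2 * suc q * ((2 + j) * 2 ^ j)) ∎
      where
      open ≤-Reasoning
      eq : ∀ j e → (8 * ((2 + j) * (2 + j)) + 2) * (2 * (1 + j)) * ((3 + j) * (2 * e)) + 4 * e * (6 * ((2 + j) * (2 + j)) + 2)
        ≡ 2 * (2 + j) * (2 * (8 * ((2 + j) * (2 + j))) * ((2 + j) * e))
      eq = solve-∀

  spreadDist : ∀ j d (H : EdgeSet n) → IsRegular H d → Expands j H → 2 ^ j ≤ n →
    SpreadDist (2 * suc j) ((2 + j) * 2 ^ j) d H
  -- At height 0 the claimed parameter `2 / 2` is 1, so any single 1-factorization will do.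
  spreadDist zero d H reg ex le = relax (s≤s z≤n) ≤-refl (trivialSpread d H reg)
  spreadDist (suc j) d H reg ex le with halve d
  ... | d′ , θ , θ≤1 , refl = relax pos ratio
    (spreadStep q k H d′ θ θ≤1 reg (16 * L) Z (4 * y) 2Z≤ r≡2h (expand H ex) ≤-refl (2 * suc j) ((2 + j) * 2 ^ j) dist)
    where
    open Step j le
    2^j≤n′ : 2 ^ j ≤ n
    2^j≤n′ = ≤-trans (m≤m+n (2 ^ j) _) le
    pos : 0 < 2 * suc q * ((2 + j) * 2 ^ j)
    pos = *-mono-≤ {1} {2 * suc q} (s≤s z≤n) (*-mono-≤ {1} {2 + j} (s≤s z≤n) (m^n>0 2 j))
    dist : (sp : Splitting (suc q) d′ (d′ + θ) H) →
      SpreadDist (2 * suc j) ((2 + j) * 2 ^ j) d′ (Splitting.M sp) × SpreadDist (2 * suc j) ((2 + j) * 2 ^ j) (d′ + θ) (H ∖ Splitting.M sp)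
    dist sp = spreadDist j d′ (Splitting.M sp) (Splitting.regular sp) (inherit H ex {Splitting.M sp} (Splitting.cut sp)) 2^j≤n′ ,
              spreadDist j (d′ + θ) (H ∖ Splitting.M sp) (Splitting.regular′ sp) (inherit H ex {H ∖ Splitting.M sp} (Splitting.cut′ sp)) 2^j≤n′

-- Dense graphs and the choice of the depth

regular⇒ : ∀ {n d} {G : BipGraph n} → Regular d G → IsRegular G d
regular⇒ (l , r) = (λ u → trans (sym (∑ₗ-allFin _)) (l u)) , (λ v → trans (sym (∑ₗ-allFin _)) (r v))

am-gm : ∀ a b → 4 * (a * b) ≤ (a + b) * (a + b)
am-gm a b with ≤-total a b
... | inj₁ le with m≤n⇒∃[o]m+o≡n le
... | δ , refl = ≤-trans (m≤m+n _ (δ * δ)) (≤-reflexive (eq a δ))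
  where
  eq : ∀ a δ → 4 * (a * (a + δ)) + δ * δ ≡ (a + (a + δ)) * (a + (a + δ))
  eq = solve-∀
am-gm a b | inj₂ le with m≤n⇒∃[o]m+o≡n le
... | δ , refl = ≤-trans (m≤m+n _ (δ * δ)) (≤-reflexive (eq b δ))
  where
  eq : ∀ a δ → 4 * ((a + δ) * a) + δ * δ ≡ (a + δ + a) * (a + δ + a)
  eq = solve-∀

-- Since `g ≤ a b ≤ (a + b)²/4 ≤ n (a + b)/4`, at least `(3/4 - 1/2) n (a + b)` edges leave the set.
dense-cut : ∀ n d a b N g → 3 * n ≤ 4 * d → N + 2 * g ≡ d * (a + b) → g ≤ a * b → a + b ≤ n → n * (a + b) ≤ 4 * N
dense-cut n d a b N g dense eq g≤ s≤n = +-cancelʳ-≤ (2 * (n * s)) _ _ (begin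
  n * s + 2 * (n * s)     ≡⟨ eq₁ n s ⟩
  3 * n * s               ≤⟨ *-monoˡ-≤ s dense ⟩
  4 * d * s               ≡⟨ *-assoc 4 d s ⟩
  4 * (d * s)             ≡⟨ cong (4 *_) eq ⟨
  4 * (N + 2 * g)         ≡⟨ eq₂ N g ⟩
  4 * N + 2 * (4 * g)     ≤⟨ +-monoʳ-≤ (4 * N) (*-monoʳ-≤ 2 (≤-trans (*-monoʳ-≤ 4 g≤) (≤-trans (am-gm a b) (*-monoˡ-≤ s s≤n)))) ⟩
  4 * N + 2 * (n * s) ∎)
  where
  open ≤-Reasoning
  s = a + b
  eq₁ : ∀ n s → n * s + 2 * (n * s) ≡ 3 * n * s
  eq₁ = solve-∀
  eq₂ : ∀ N g → 4 * (N + 2 * g) ≡ 4 * N + 2 * (4 * g)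
  eq₂ = solve-∀

e≤size*size : ∀ {n} (S : EdgeSet n) A B → e[ S ] A B ≤ size A * size B
e≤size*size S A B = begin
  e[ S ] A B                                 ≤⟨ ∑-mono (λ u → ∑-mono (λ v → *-monoʳ-≤ (ind (A u)) (≤-trans (*-monoʳ-≤ (ind (B v)) (ind≤1 (S u v))) (≤-reflexive (*-identityʳ _))))) ⟩
  ∑ (λ u → ∑ (λ v → ind (A u) * ind (B v)))  ≡⟨ ∑-cong (λ u → trans (sym (*-∑ (ind (A u)) _)) (*-comm (ind (A u)) _)) ⟩
  ∑ (λ u → size B * ind (A u))               ≡⟨ *-∑ (size B) _ ⟨
  size B * size A                            ≡⟨ *-comm (size B) _ ⟩
  size A * size B ∎
  where open ≤-Reasoning

-- One of the set and its complement has at most `n` vertices, and `dense-cut` applies to that one.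
dense-expansion : ∀ {n d} {G : EdgeSet n} → IsRegular G d → 3 * n ≤ 4 * d → ∀ A B → n * margin A B ≤ 4 * cutSize G A B
dense-expansion {n} {d} {G} reg dense A B with ≤-total (order A B) n
... | inj₁ s≤n = ≤-trans (*-monoʳ-≤ n (m⊓n≤m (order A B) (coorder A B)))
  (dense-cut n d (size A) (size B) (cutSize G A B) (e[ G ] A B) dense degreeSum (e≤size*size G A B) s≤n)
  where
  sw : ∀ x y g → x + y + 2 * g ≡ (g + x) + (g + y)
  sw = solve-∀
  degreeSum : cutSize G A B + 2 * e[ G ] A B ≡ d * (size A + size B)
  degreeSum = trans (sw (e[ G ] A (∁ B)) _ (e[ G ] A B)) (trans (cong₂ _+_ (e-regularₗ {H = G} reg A B) (e-regularᵣ {H = G} reg A B)) (sym (*-distribˡ-+ d (size A) _)))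
... | inj₂ n≤s = ≤-trans (*-monoʳ-≤ n (m⊓n≤n (order A B) (coorder A B)))
  (dense-cut n d (size (∁ A)) (size (∁ B)) (cutSize G A B) (e[ G ] (∁ A) (∁ B)) dense degreeSum (e≤size*size G (∁ A) (∁ B))
    (+-cancelˡ-≤ n _ _ (≤-trans (+-monoˡ-≤ (coorder A B) n≤s) (≤-reflexive (order+coorder A B)))))
  where
  sw : ∀ x y g → x + y + 2 * g ≡ (y + g) + (x + g)
  sw = solve-∀
  degreeSum : cutSize G A B + 2 * e[ G ] (∁ A) (∁ B) ≡ d * (size (∁ A) + size (∁ B))
  degreeSum = trans (sw (e[ G ] A (∁ B)) (e[ G ] (∁ A) B) (e[ G ] (∁ A) (∁ B)))
    (trans (cong₂ _+_ (e-regularₗ {H = G} reg (∁ A) B) (e-regularᵣ {H = G} reg A (∁ B))) (sym (*-distribˡ-+ d (size (∁ A)) _)))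

n≤2^⌈log₂n⌉ : ∀ n → n ≤ 2 ^ ⌈log₂ n ⌉
n≤2^⌈log₂n⌉ = <-rec _ go
  where
  go : ∀ n → (∀ {m} → m < n → m ≤ 2 ^ ⌈log₂ m ⌉) → n ≤ 2 ^ ⌈log₂ n ⌉
  go 0 rec = z≤n
  go 1 rec = m^n>0 2 ⌈log₂ 1 ⌉
  go n@(suc (suc m)) rec = begin
    n                             ≡⟨ ⌊n/2⌋+⌈n/2⌉≡n n ⟨
    ⌊ n /2⌋ + ⌈ n /2⌉             ≤⟨ +-monoˡ-≤ ⌈ n /2⌉ (⌊n/2⌋≤⌈n/2⌉ n) ⟩
    ⌈ n /2⌉ + ⌈ n /2⌉             ≤⟨ +-mono-≤ half half ⟩
    2 ^ (⌈log₂ n ⌉ ∸ 1) + 2 ^ (⌈log₂ n ⌉ ∸ 1) ≡⟨ cong (λ x → 2 ^ (⌈log₂ n ⌉ ∸ 1) + x) (+-identityʳ _) ⟨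
    2 ^ suc (⌈log₂ n ⌉ ∸ 1)       ≡⟨ cong (2 ^_) (m+[n∸m]≡n {1} {⌈log₂ n ⌉} (⌈log₂⌉-mono-≤ {2} {n} (s≤s (s≤s z≤n)))) ⟩
    2 ^ ⌈log₂ n ⌉ ∎
    where
    open ≤-Reasoning
    half : ⌈ n /2⌉ ≤ 2 ^ (⌈log₂ n ⌉ ∸ 1)
    half = subst (λ x → ⌈ n /2⌉ ≤ 2 ^ x) (⌈log₂⌈n/2⌉⌉≡⌈log₂n⌉∸1 n) (rec (⌈n/2⌉<n m))

-- The lower bound supplies the initial expansion, the upper one the final spread. `j ≡ 0` covers
-- `n` of order `c`, where the trivial spread 1 is enough.
depth : ∀ n c → 0 < c → ∃ λ j → (j ≡ 0 ⊎ 4 * (2 ^ j * c) ≤ n) × n ≤ 8 * (2 ^ j * c)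
depth n c c>0 = go n (begin
  n                   ≤⟨ ≤-trans (n≤1+n n) (suc≤2^ n) ⟩
  2 ^ n               ≤⟨ m≤m*n (2 ^ n) c {{>-nonZero c>0}} ⟩
  2 ^ n * c           ≤⟨ m≤n*m (2 ^ n * c) 8 ⟩
  8 * (2 ^ n * c) ∎)
  where
  open ≤-Reasoning
  go : ∀ j → n ≤ 8 * (2 ^ j * c) → ∃ λ j → (j ≡ 0 ⊎ 4 * (2 ^ j * c) ≤ n) × n ≤ 8 * (2 ^ j * c)
  go zero    h = zero , inj₁ refl , h
  go (suc j) h with ≤-total n (8 * (2 ^ j * c))
  ... | inj₁ le = go j le
  ... | inj₂ ge = suc j , inj₂ (≤-trans (≤-reflexive (eq (2 ^ j) c)) ge) , h
    where
    eq : ∀ e c → 4 * (2 * e * c) ≡ 8 * (e * c)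
    eq = solve-∀

-- The parameter `2 (j + 1)/((j + 2) 2^j)` is at most `2 / 2^j`, and `depth` bounds `1 / 2^j` by
-- `8 K L / n`; hence the constant `16 * K`.
rescaled-spread : ∀ {n d} {G : EdgeSet n} → 2 ≤ n → IsRegular G d → 3 * n ≤ 4 * d →
  ∃ λ a → ∃ λ b → 0 < b × a * n ≤ 16 * K * ⌈log₂ n ⌉ * b × SpreadDist a b d G
rescaled-spread {suc k} {d} {G} 2≤n reg dense with depth (suc k) (K * ⌈log₂ suc k ⌉) (*-mono-≤ K>0 (⌈log₂⌉-mono-≤ 2≤n))
... | j , alt , upper = 2 * suc j , (2 + j) * 2 ^ j , *-mono-≤ {1} {2 + j} (s≤s z≤n) (m^n>0 2 j) , bound , dist alt
  where
  open ≤-Reasoning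
  n = suc k
  L = ⌈log₂ n ⌉
  1≤L : 1 ≤ L
  1≤L = ⌈log₂⌉-mono-≤ 2≤n
  open Recursion k L 1≤L (n≤2^⌈log₂n⌉ n) using (spreadDist; Expands)
  bound : 2 * suc j * n ≤ 16 * K * L * ((2 + j) * 2 ^ j)
  bound = begin
    2 * suc j * n                         ≤⟨ *-mono-≤ (*-monoʳ-≤ 2 (n≤1+n (suc j))) upper ⟩
    2 * (2 + j) * (8 * (2 ^ j * (K * L))) ≡⟨ eq (2 + j) (2 ^ j) K L ⟩
    16 * K * L * ((2 + j) * 2 ^ j) ∎
    where
    eq : ∀ i e K L → 2 * i * (8 * (e * (K * L))) ≡ 16 * K * L * (i * e)
    eq = solve-∀
  dist : (j ≡ 0 ⊎ 4 * (2 ^ j * (K * L)) ≤ n) → SpreadDist (2 * suc j) ((2 + j) * 2 ^ j) d G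
  dist (inj₁ refl) = relax (s≤s z≤n) ≤-refl (trivialSpread d G reg)
  dist (inj₂ lower) = spreadDist j d G reg expands 2^j≤n
    where
    KL>0 : 0 < K * L
    KL>0 = *-mono-≤ K>0 1≤L
    2^j≤n : 2 ^ j ≤ n
    2^j≤n = ≤-trans (m≤m*n (2 ^ j) (K * L) {{>-nonZero KL>0}}) (≤-trans (m≤n*m _ 4) lower)
    expands : Expands j G
    expands A B = begin
      suc j * (2 ^ j * (K * L)) * margin A B   ≡⟨ *-assoc (suc j) (2 ^ j * (K * L)) (margin A B) ⟩
      suc j * (2 ^ j * (K * L) * margin A B)   ≤⟨ *-mono-≤ {suc j} {2 + j} {2 ^ j * (K * L) * margin A B} {cutSize G A B} (n≤1+n (suc j)) (*-cancelˡ-≤ 4 (begin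
        4 * (2 ^ j * (K * L) * margin A B)     ≡⟨ *-assoc 4 (2 ^ j * (K * L)) (margin A B) ⟨
        4 * (2 ^ j * (K * L)) * margin A B     ≤⟨ *-monoˡ-≤ (margin A B) lower ⟩
        n * margin A B                         ≤⟨ dense-expansion {G = G} reg dense A B ⟩
        4 * cutSize G A B ∎)) ⟩
      (2 + j) * cutSize G A B ∎

-- From ratios of naturals to the rational spread parameter

^ℚ-nonNeg : ∀ {q} → 0ℚ ℚ.≤ q → ∀ s → 0ℚ ℚ.≤ q ^ℚ s
^ℚ-nonNeg q≥0 zero    = ℚ.nonNegative⁻¹ 1ℚ
^ℚ-nonNeg {q} q≥0 (suc s) = subst (ℚ._≤ q ℚ.* (q ^ℚ s)) (ℚ.*-zeroʳ q)
  (ℚ.*-monoˡ-≤-nonNeg q {{ℚ.nonNegative q≥0}} (^ℚ-nonNeg q≥0 s))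

^ℚ-ratio : ∀ {q} a b → 0ℚ ℚ.≤ q → ι a ℚ.≤ q ℚ.* ι b → ∀ s → ι (a ^ s) ℚ.≤ (q ^ℚ s) ℚ.* ι (b ^ s)
^ℚ-ratio a b q≥0 h zero = ℚ.≤-reflexive (sym (ℚ.*-identityˡ (ι 1)))
^ℚ-ratio {q} a b q≥0 h (suc s) = begin
  ι (a * a ^ s)                                 ≡⟨ ι-* a (a ^ s) ⟩
  ι a ℚ.* ι (a ^ s)                             ≤⟨ *-mono-≤-nonNeg (0≤ι (a ^ s)) (ℚ.≤-trans (0≤ι a) h) h (^ℚ-ratio a b q≥0 h s) ⟩
  q ℚ.* ι b ℚ.* ((q ^ℚ s) ℚ.* ι (b ^ s))        ≡⟨ solve 4 (λ q b x y → q :* b :* (x :* y) := q :* x :* (b :* y)) refl q (ι b) (q ^ℚ s) (ι (b ^ s)) ⟩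
  q ℚ.* (q ^ℚ s) ℚ.* (ι b ℚ.* ι (b ^ s))        ≡⟨ cong (q ℚ.* (q ^ℚ s) ℚ.*_) (ι-* b (b ^ s)) ⟨
  q ℚ.* (q ^ℚ s) ℚ.* ι (b * b ^ s) ∎
  where
  open ℚ.≤-Reasoning
  open ℚSolver

Pr≡E : ∀ {n d} {G : BipGraph n} (μ : Distribution {n} {d} G) S → Pr {G = G} μ S ≡ E μ (contains S)
Pr≡E μ S = cong sumℚ (map-cong (λ p → eq (proj₁ p) (allSubset? S (proj₂ p))) μ)
  where
  eq : ∀ w b → (if b then w else 0ℚ) ≡ w ℚ.* ι (ind b)
  eq w true  = sym (trans (cong (w ℚ.*_) ι-1) (ℚ.*-identityʳ w))
  eq w false = sym (trans (cong (w ℚ.*_) ι-0) (ℚ.*-zeroʳ w))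

module _ {a b n d} {G : BipGraph n} (D : SpreadDist a b d G) (b>0 : 0 < b)
  {q : ℚ} (q≥0 : 0ℚ ℚ.≤ q) (a≤qb : ι a ℚ.≤ q ℚ.* ι b) where

  isDistribution : IsDistributionOn1F G (μ D)
  isDistribution = valid D , trans (cong sumℚ (map-cong (λ p → sym (ℚ.*-identityʳ (proj₁ p))) (μ D))) (total D)

  -- An edge has only one colour in a 1-factorization, so the event is empty.
  overlapping-null : ∀ S i j u v → S i u v ≡ true → S j u v ≡ true → i ≢ j → E (μ D) (contains S) ℚ.≤ 0ℚ
  overlapping-null S i j u v p q i≢j = ℚ.≤-trans (E-mono (valid D) (λ M F → ℚ.≤-trans (ι-mono (none M F)) (ℚ.≤-reflexive (trans ι-0 (sym (ℚ.*-zeroʳ (contains S M)))))))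
      (ℚ.≤-reflexive (trans (E-*ʳ (μ D) (contains S) 0ℚ) (ℚ.*-zeroʳ (E (μ D) (contains S)))))
    where
    open ℚ.≤-Reasoning
    none : ∀ M → OneFactorization G M → ind (allSubset? S M) ≤ 0
    none M (_ , M⊆G , unique) with allSubset? S M in e
    ... | false = z≤n
    ... | true = ⊥-elim (i≢j (trans (proj₂ (proj₂ colour) i (inc i u v p)) (sym (proj₂ (proj₂ colour) j (inc j u v q)))))
      where
      inc : ∀ i → S i ⊆ₑ M i
      inc = allSubset?⁻ {S = S} {M} e
      colour = unique u v (M⊆G i u v (inc i u v p))

  isSpread : Spread {G = G} q (μ D)
  isSpread S _ with any? (λ i → any? (λ j → any? (λ u → any? (λ v → S i u v B.≟ true ×-dec (S j u v B.≟ true ×-dec ¬? (i F.≟ j))))))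
  ... | yes (i , j , u , v , p , p′ , i≢j) = ℚ.≤-trans (ℚ.≤-reflexive (Pr≡E {G = G} (μ D) S))
    (ℚ.≤-trans (overlapping-null S i j u v p p′ i≢j) (^ℚ-nonNeg q≥0 (totalSize S)))
  ... | no none = cancel-ιʳ (b ^ s) (m^n>0 b {{>-nonZero b>0}} s) (begin
    Pr {G = G} (μ D) S ℚ.* ι (b ^ s)    ≡⟨ cong₂ (λ x y → x ℚ.* ι (b ^ y)) (Pr≡E {G = G} (μ D) S) (totalSize≡ S) ⟩
    E (μ D) (contains S) ℚ.* ι (b ^ σ S) ≤⟨ spread D S disjoint ⟩
    ι (a ^ σ S)                      ≡⟨ cong (λ x → ι (a ^ x)) (totalSize≡ S) ⟨
    ι (a ^ s)                        ≤⟨ ^ℚ-ratio a b q≥0 a≤qb s ⟩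
    (q ^ℚ s) ℚ.* ι (b ^ s) ∎)
    where
    open ℚ.≤-Reasoning
    s = totalSize S
    disjoint : Disjoint S
    disjoint i j u v p p′ = decidable-stable (i F.≟ j) (λ i≢j → none (i , j , u , v , p , p′ , i≢j))

C : ℚ
C = ι (16 * K)

spreadParam-ι : ∀ n → .{{_ : NonZero n}} → spreadParam C n ℚ.* ι n ≡ ι (16 * K * ⌈log₂ n ⌉)
spreadParam-ι (suc m) = begin
  C ℚ.* (ℤ.+ ⌈log₂ suc m ⌉ ℚ./ suc m) ℚ.* ι (suc m)   ≡⟨ ℚ.*-assoc C (ℤ.+ ⌈log₂ suc m ⌉ ℚ./ suc m) (ι (suc m)) ⟩
  C ℚ.* ((ℤ.+ ⌈log₂ suc m ⌉ ℚ./ suc m) ℚ.* ι (suc m)) ≡⟨ cong (C ℚ.*_) (/-*-ι ⌈log₂ suc m ⌉ (suc m)) ⟩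
  C ℚ.* ι ⌈log₂ suc m ⌉                           ≡⟨ ι-* (16 * K) ⌈log₂ suc m ⌉ ⟨
  ι (16 * K * ⌈log₂ suc m ⌉) ∎
  where open ≡-Reasoning

density : ∀ n d → (1ℚ ℚ.- (ℤ.+ 1 ℚ./ 4)) ℚ.* ℕ→ℚ n ℚ.≤ ℕ→ℚ d → 3 * n ≤ 4 * d
density n d h = ι-cancel (begin
  ι (3 * n)                    ≡⟨ ι-* 3 n ⟩
  ι 3 ℚ.* ι n                  ≡⟨ cong (ℚ._* ι n) (/-*-ι 3 4) ⟨
  (ℤ.+ 3 ℚ./ 4) ℚ.* ι 4 ℚ.* ι n    ≡⟨ solve 3 (λ x y z → x :* y :* z := x :* z :* y) refl (ℤ.+ 3 ℚ./ 4) (ι 4) (ι n) ⟩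
  -- `h` fits here because `1ℚ` minus one quarter evaluates to three quarters.
  (ℤ.+ 3 ℚ./ 4) ℚ.* ι n ℚ.* ι 4    ≤⟨ mono-ιʳ 4 (subst₂ (λ x y → (ℤ.+ 3 ℚ./ 4) ℚ.* x ℚ.≤ y) (sym (ι≡ n)) (sym (ι≡ d)) h) ⟩
  ι d ℚ.* ι 4                  ≡⟨ ι-* d 4 ⟨
  ι (d * 4)                    ≡⟨ cong ι (*-comm d 4) ⟩
  ι (4 * d) ∎)
  where
  open ℚ.≤-Reasoning
  open ℚSolver

theorem1p10 : ∃ λ (C : ℚ) → ∃ λ (α : ℚ) → (0ℚ ℚ.< C) × (0ℚ ℚ.< α) ×
    ((n d : ℕ) → 2 ≤ n → (G : BipGraph n) → Regular d G →
    (1ℚ ℚ.- α) ℚ.* ℕ→ℚ n ℚ.≤ ℕ→ℚ d →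
    Σ (Distribution {n} {d} G) λ μ →
    IsDistributionOn1F G μ × Spread {G = G} (spreadParam C n) μ)
theorem1p10 = C , ℤ.+ 1 ℚ./ 4 , ℚ.positive⁻¹ C {{ι-pos (16 * K) (*-mono-≤ {1} {16} (s≤s z≤n) K>0)}} , ℚ.positive⁻¹ (ℤ.+ 1 ℚ./ 4) , main
  where
  main : (n d : ℕ) → 2 ≤ n → (G : BipGraph n) → Regular d G → (1ℚ ℚ.- (ℤ.+ 1 ℚ./ 4)) ℚ.* ℕ→ℚ n ℚ.≤ ℕ→ℚ d →
    Σ (Distribution {n} {d} G) λ μ → IsDistributionOn1F G μ × Spread {G = G} (spreadParam C n) μ
  main n d 2≤n G reg h = finish (rescaled-spread {G = G} 2≤n (regular⇒ {G = G} reg) (density n d h))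
    where
    n>0 : 0 < n
    n>0 = ≤-trans (s≤s z≤n) 2≤n
    instance
      n≢0 : NonZero n
      n≢0 = >-nonZero n>0
    q = spreadParam C n
    q≥0 : 0ℚ ℚ.≤ q
    q≥0 = cancel-ιʳ n n>0 (ℚ.≤-trans (ℚ.≤-reflexive (ℚ.*-zeroˡ (ι n))) (ℚ.≤-trans (0≤ι _) (ℚ.≤-reflexive (sym (spreadParam-ι n)))))
    finish : (∃ λ a → ∃ λ b → 0 < b × a * n ≤ 16 * K * ⌈log₂ n ⌉ * b × SpreadDist a b d G) →
      Σ (Distribution {n} {d} G) λ μ → IsDistributionOn1F G μ × Spread {G = G} q μ
    finish (a , b , b>0 , le , D) = μ D , isDistribution D b>0 q≥0 a≤qb , isSpread D b>0 q≥0 a≤qb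
      where
      open ℚ.≤-Reasoning
      open ℚSolver
      a≤qb : ι a ℚ.≤ q ℚ.* ι b
      a≤qb = cancel-ιʳ n n>0 (begin
        ι a ℚ.* ι n                       ≡⟨ ι-* a n ⟨
        ι (a * n)                         ≤⟨ ι-mono le ⟩
        ι (16 * K * ⌈log₂ n ⌉ * b)        ≡⟨ ι-* (16 * K * ⌈log₂ n ⌉) b ⟩
        ι (16 * K * ⌈log₂ n ⌉) ℚ.* ι b    ≡⟨ cong (ℚ._* ι b) (spreadParam-ι n) ⟨
        q ℚ.* ι n ℚ.* ι b                 ≡⟨ solve 3 (λ x y z → x :* y :* z := x :* z :* y) refl q (ι n) (ι b) ⟩
        q ℚ.* ι b ℚ.* ι n ∎)
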